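{- Let $n=4k$ with $k\ge 1$. The maximum number of nonzero entries in an $n\times n$ symmetric alternating sign matrix all of whose main diagonal entries are $0$ equals $\frac{n^2-2n}{2}$ (equivalently, the maximum number of edges of an alternating signed graph of order $n$ without loops is $\frac{n^2-2n}{4}$). Moreover, an $n\times n$ symmetric ASM with zero main diagonal has exactly $\frac{n^2-2n}{2}$ nonzero entries if and only if it is a type 1 hollowed-diamond ASM, a type 2 hollowed-diamond ASM, or the hollowed-near-diamond ASM of order $n$.
   Context: An alternating sign matrix (ASM) is an $n\times n$ matrix with entries in $\{0,+1,-1\}$ such that in each row and each column the nonzero entries alternate in sign, beginning and ending with $+1$. An alternating signed graph of order $n$ without loops is a graph on vertices $1,\dots,n$ with edges signed $\pm1$ whose signed adjacency matrix is a symmetric ASM with zero main diagonal; its number of edges is half the number of nonzero entries. Let $n=4k$, $m=2k$. Let $D=[d_{ij}]$ be the $n\times n$ matrix with $d_{ij}=(-1)^{i+j-m-2}$ if $m+2\le i+j\le 3m$ and $|i-j|\le m$, and $d_{ij}=0$ otherwise; let $D'=[d'_{ij}]$ with $d'_{ij}=d_{n+1-i,j}$ (rows of $D$ reversed). Let $E=[e_{ij}]$ be the $n\times n$ matrix with $e_{ij}=(-1)^{i+j-2k-3}$ if $2k+3\le i+j\le 6k-1$ and $|i-j|\le 2k+1$, and $e_{ij}=0$ otherwise. The type 1 (resp. type 2) hollowed-diamond ASM of order $4k$ is obtained from $D$ (resp. $D'$) by setting to $0$ every entry in position $(i,j)$ with $\{i,j\}\subseteq\{k+2t-1,k+2t\}$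 for some $t\in\{1,\dots,k\}$. The hollowed-near-diamond ASM of order $4k$ is obtained from $E$ by setting to $0$ every entry in position $(i,j)$ with $\{i,j\}\subseteq\{k+2t,k+2t+1\}$ for some $t\in\{1,\dots,k-1\}$. -}

module Defs where

open import Data.Bool.Base using (Bool; true; false; if_then_else_; _∧_; _∨_)
open import Data.Nat.Base using (ℕ; zero; suc; _+_; _*_; _∸_; _≤ᵇ_; _≡ᵇ_; ∣_-_∣)
open import Data.Integer.Base using (ℤ; +_; -[1+_]; 0ℤ; 1ℤ; -1ℤ)
open import Data.Fin.Base using (Fin; toℕ; opposite)
open import Data.List.Base using (List; []; _∷_; length; map; upTo)
open import Data.Nat.ListAction using (sum)
open import Data.Bool.ListAction using (any)
import Data.List.Base as L
open import Data.Sum.Base using (_⊎_)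
open import Relation.Binary.PropositionalEquality using (_≡_)

Matrix : ℕ → Set
Matrix n = Fin n → Fin n → ℤ

row : ∀ {n} → Matrix n → Fin n → List ℤ
row {n} A i = L.tabulate (λ j → A i j)

col : ∀ {n} → Matrix n → Fin n → List ℤ
col {n} A j = L.tabulate (λ i → A i j)

nonzeros : List ℤ → List ℤ
nonzeros []                 = []
nonzeros ((+ zero) ∷ xs)    = nonzeros xs
nonzeros ((+ suc a) ∷ xs)   = (+ suc a) ∷ nonzeros xs
nonzeros (-[1+ a ] ∷ xs)    = -[1+ a ] ∷ nonzeros xs

data AltPlus : List ℤ → Set where
  single : AltPlus (1ℤ ∷ [])
  cons   : ∀ {xs} → AltPlus xs → AltPlus (1ℤ ∷ -1ℤ ∷ xs)

IsSign : ℤ → Set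
IsSign x = (x ≡ 0ℤ) ⊎ ((x ≡ 1ℤ) ⊎ (x ≡ -1ℤ))

record IsASM {n : ℕ} (A : Matrix n) : Set where
  field
    entries : ∀ i j → IsSign (A i j)
    rows    : ∀ i → AltPlus (nonzeros (row A i))
    cols    : ∀ j → AltPlus (nonzeros (col A j))

Symmetric : ∀ {n} → Matrix n → Set
Symmetric A = ∀ i j → A i j ≡ A j i

ZeroDiagonal : ∀ {n} → Matrix n → Set
ZeroDiagonal A = ∀ i → A i i ≡ 0ℤ

nnz : ∀ {n} → Matrix n → ℕ
nnz {n} A = sum (L.tabulate (λ i → length (nonzeros (row A i))))

_≗M_ : ∀ {n} → Matrix n → Matrix n → Set
A ≗M B = ∀ i j → A i j ≡ B i j

-- The special matrices.  Entries are given by functions of 1-based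
-- indices i, j ∈ {1,…,n}.

signPow : ℕ → ℤ
signPow zero          = 1ℤ
signPow (suc zero)    = -1ℤ
signPow (suc (suc e)) = signPow e

fromOneBased : ∀ n → (ℕ → ℕ → ℤ) → Matrix n
fromOneBased n f i j = f (suc (toℕ i)) (suc (toℕ j))

dEntry : ℕ → ℕ → ℕ → ℤ
dEntry m i j =
  if ((m + 2) ≤ᵇ (i + j)) ∧ ((i + j) ≤ᵇ (3 * m)) ∧ (∣ i - j ∣ ≤ᵇ m)
  then signPow (i + j ∸ m ∸ 2) else 0ℤ

eEntry : ℕ → ℕ → ℕ → ℤ
eEntry k i j =
  if ((2 * k + 3) ≤ᵇ (i + j)) ∧ ((i + j) ≤ᵇ (6 * k ∸ 1)) ∧ (∣ i - j ∣ ≤ᵇ (2 * k + 1))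
  then signPow (i + j ∸ (2 * k) ∸ 3) else 0ℤ

oneTo : ℕ → List ℕ
oneTo r = map suc (upTo r)

hollow₁ : ℕ → ℕ → ℕ → Bool
hollow₁ k i j = any (λ t → inB t i ∧ inB t j) (oneTo k)
  where
  inB : ℕ → ℕ → Bool
  inB t x = (x ≡ᵇ (k + 2 * t ∸ 1)) ∨ (x ≡ᵇ (k + 2 * t))

hollow₂ : ℕ → ℕ → ℕ → Bool
hollow₂ k i j = any (λ t → inB t i ∧ inB t j) (oneTo (k ∸ 1))
  where
  inB : ℕ → ℕ → Bool
  inB t x = (x ≡ᵇ (k + 2 * t)) ∨ (x ≡ᵇ (k + 2 * t + 1))

hollowedDiamond₁ : (k : ℕ) → Matrix (4 * k)
hollowedDiamond₁ k = fromOneBased (4 * k)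
  (λ i j → if hollow₁ k i j then 0ℤ else dEntry (2 * k) i j)

D′ : (k : ℕ) → Matrix (4 * k)
D′ k i j = fromOneBased (4 * k) (dEntry (2 * k)) (opposite i) j

hollowedDiamond₂ : (k : ℕ) → Matrix (4 * k)
hollowedDiamond₂ k i j =
  if hollow₁ k (suc (toℕ i)) (suc (toℕ j)) then 0ℤ else D′ k i j

hollowedNearDiamond : (k : ℕ) → Matrix (4 * k)
hollowedNearDiamond k = fromOneBased (4 * k)
  (λ i j → if hollow₂ k i j then 0ℤ else eEntry k i j)

{-# OPTIONS --safe #-}
-- Let C(i , j) be the sum of the leading i × j block of A, and h(i , j) = i + j − 2 C(i , j) the height
-- function on the vertices of the n × n grid of cells.  It is symmetric, changes by ±1 along edges,
-- has boundary values h(i , 0) = i and h(i , n) = n − i, and a cell carries a zero entry iff exactly one of its two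
-- diagonals joins vertices of different height.  So the zeros above the main diagonal are counted by the
-- total variation of h along the lines i − j = const and i + j = const, separately on the even and on the
-- odd vertices.  On each of the two lattices let μ be the least, over the lines j − i = d > 0, of the
-- maximum of h.  A line j − i = d climbs from d to at least μ and back; a line i + j = s descends from its
-- boundary value to at most μ; and on the even lattice a vertex (i , i) satisfies h(i , i) ≡ 2i (mod 4),
-- because the diagonal of A vanishes, so every other diagonal vertex differs from μ.  With p = ⌈μ / 2⌉ and
-- q = 2k − p each lattice contributes at least p(p − 1) + q(q + 1) ≥ 2k², with equality only for
-- p ∈ {k , k + 1}.  In case of equality every line is tight, which forces h to be constant on both
-- lattices in the middle of the square; of the four combinations one is impossible and the others are
-- the three hollowed matrices.

module Submission where

open import Defs
open import Data.Bool.Base using (Bool; true; false; if_then_else_; _∧_; _∨_; T)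
open import Data.Bool.ListAction using (any)
open import Data.Bool.Properties using (∧-comm; ∧-zeroʳ; ∨-zeroʳ)
open import Data.Empty using (⊥; ⊥-elim)
open import Data.Fin.Base using (Fin; zero; suc; toℕ; fromℕ<)
open import Data.Fin.Properties using (toℕ<n; toℕ-fromℕ<; toℕ-injective; opposite-prop)
open import Data.Integer.Base using (ℤ; -[1+_]; 0ℤ; 1ℤ; -1ℤ) renaming (+_ to ⁺_)
open import Data.List.Base using (List; []; _∷_; _++_; map; allFin; applyUpTo)
import Data.List.Base as L
open import Data.List.Properties using (tabulate-cong)
open import Data.List.Relation.Unary.All using (All; []; _∷_)
open import Data.List.Relation.Unary.All.Properties using (++⁺)
open import Data.Nat.Base
open import Data.Nat.DivMod using (m*n/n≡m)
open import Data.Nat.ListAction using (sum)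
open import Data.Nat.Properties
open import Data.Nat.Tactic.RingSolver using (solve-∀)
open import Data.Product.Base using (Σ; _×_; _,_; proj₁; proj₂; ∃)
open import Data.Sum.Base using (_⊎_; inj₁; inj₂)
import Data.Sum.Base as Sum
open import Data.Unit.Base using (tt)
open import Data.Vec.Base using (Vec; []; _∷_; lookup; replicate; tabulate)
open import Function.Base using (_∘_; _$_; id)
open import Function.Bundles using (_⇔_; mk⇔)
open import Relation.Binary.Definitions using (tri<; tri≈; tri>)
open import Relation.Binary.PropositionalEquality
open import Relation.Nullary using (¬_; yes; no)
open import Algebra.Properties.CommutativeSemigroup +-commutativeSemigroup using (interchange)

-- One number `p` controls both families of lines because the line `x₀` attaining the minimax stays
-- at or below `p` and crosses every antidiagonal of length at least `p`, while every line of
-- constant x has to climb to `p`. The two lattices reach the same bound for different reasons. On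
-- the odd lattice the excesses of the antidiagonals over `p` form a tent of sum q(q + 1). On the
-- even lattice the tent only has sum q², and the missing q is paid by the diagonal vertices that
-- parity keeps away from `p`. With the n forced zeros on the main diagonal there are at least n +
-- 2(2k² + 2k²) zeros, which leaves 8k² - 4k nonzero entries. In the equality case flatness says
-- nothing about the diagonal vertices themselves. They are recovered from their neighbours and from
-- parity, and the hollow cells are exactly the places where parity pushes them off the plateau. For
-- the converse a lower count of nonzero entries suffices, since the upper bound holds for every
-- matrix in question. The equivalence concerns matrices already assumed to be ASMs, so one verified
-- example, type 1, settles existence.

-- Linear arithmetic over ℕ by reflection

module LinearArithmetic where

  -- Fourier–Motzkin refutation over ℕ.  A constraint is a pair of coefficient
  -- vectors (index 0 is the constant term) read as "left ≤ right".

  Coefs : ℕ → Set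
  Coefs n = Vec ℕ (suc n)

  Constraint : ℕ → Set
  Constraint n = Coefs n × Coefs n

  dot : ∀ {n} → Vec ℕ n → Vec ℕ n → ℕ
  dot []       []       = 0
  dot (a ∷ as) (x ∷ xs) = a * x + dot as xs

  zip : ∀ {n} → (ℕ → ℕ → ℕ) → Vec ℕ n → Vec ℕ n → Vec ℕ n
  zip f []       []       = []
  zip f (a ∷ as) (b ∷ bs) = f a b ∷ zip f as bs

  scale : ∀ {n} → ℕ → Vec ℕ n → Vec ℕ n
  scale k []       = []
  scale k (a ∷ as) = k * a ∷ scale k as

  dot-+ : ∀ {n} (as bs xs : Vec ℕ n) → dot (zip _+_ as bs) xs ≡ dot as xs + dot bs xs
  dot-+ []       []       []       = refl
  dot-+ (a ∷ as) (b ∷ bs) (x ∷ xs)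
    rewrite dot-+ as bs xs | *-distribʳ-+ x a b = interchange (a * x) (b * x) (dot as xs) (dot bs xs)

  dot-scale : ∀ {n} k (as xs : Vec ℕ n) → dot (scale k as) xs ≡ k * dot as xs
  dot-scale k []       []       = sym (*-zeroʳ k)
  dot-scale k (a ∷ as) (x ∷ xs)
    rewrite dot-scale k as xs | *-assoc k a x = sym (*-distribˡ-+ k (a * x) (dot as xs))

  -- Each coefficient splits as l = (l ∸ r) + (l ⊓ r). The second summand is common to both sides of
  -- a constraint, so it can be cancelled and all coefficients stay in ℕ.
  dot-cancel : ∀ {n} (ls rs xs : Vec ℕ n) → dot ls xs ≡ dot (zip _∸_ ls rs) xs + dot (zip _⊓_ ls rs) xs
  dot-cancel []       []       []       = refl
  dot-cancel (l ∷ ls) (r ∷ rs) (x ∷ xs) = begin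
    l * x + dot ls xs
      ≡⟨ cong₂ (λ u v → u * x + v) (sym (split l r)) (dot-cancel ls rs xs) ⟩
    (l ∸ r + l ⊓ r) * x + (dot (zip _∸_ ls rs) xs + dot (zip _⊓_ ls rs) xs)
      ≡⟨ cong (_+ (dot (zip _∸_ ls rs) xs + dot (zip _⊓_ ls rs) xs)) (*-distribʳ-+ x (l ∸ r) (l ⊓ r)) ⟩
    ((l ∸ r) * x + (l ⊓ r) * x) + (dot (zip _∸_ ls rs) xs + dot (zip _⊓_ ls rs) xs)
      ≡⟨ interchange ((l ∸ r) * x) ((l ⊓ r) * x) _ _ ⟩
    _ ∎
    where
    open ≡-Reasoning
    split : ∀ l r → l ∸ r + l ⊓ r ≡ l
    split l r = trans (+-comm (l ∸ r) (l ⊓ r)) (trans (cong (_+ (l ∸ r)) (⊓-comm l r)) (m⊓n+n∸m≡n r l))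

  zip-comm : ∀ {n} (ls rs : Vec ℕ n) → zip _⊓_ ls rs ≡ zip _⊓_ rs ls
  zip-comm []       []       = refl
  zip-comm (l ∷ ls) (r ∷ rs) = cong₂ _∷_ (⊓-comm l r) (zip-comm ls rs)

  Holds : ∀ {n} → Vec ℕ n → Constraint n → Set
  Holds ρ (l , r) = dot l (1 ∷ ρ) ≤ dot r (1 ∷ ρ)

  -- Variable `i` exceeds by `v` on the left of the first constraint and by `u` on the right of the
  -- second. After scaling by `u` and `v` both excesses are u · v, so the variable cancels.
  combine : ∀ {n} → Fin (suc n) → Constraint n → Constraint n → Constraint n
  combine i (l , r) (l′ , r′) = zip _∸_ L R , zip _∸_ R L
    where
    u = lookup r′ i ∸ lookup l′ i
    v = lookup l i ∸ lookup r i
    L = zip _+_ (scale u l) (scale v l′)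
    R = zip _+_ (scale u r) (scale v r′)

  cancel-holds : ∀ {n} (ρ : Vec ℕ n) l r → Holds ρ (l , r) → Holds ρ (zip _∸_ l r , zip _∸_ r l)
  cancel-holds ρ l r h = +-cancelʳ-≤ (dot (zip _⊓_ l r) (1 ∷ ρ)) _ _ (begin
    dot (zip _∸_ l r) (1 ∷ ρ) + dot (zip _⊓_ l r) (1 ∷ ρ) ≡⟨ dot-cancel l r (1 ∷ ρ) ⟨
    dot l (1 ∷ ρ) ≤⟨ h ⟩
    dot r (1 ∷ ρ) ≡⟨ dot-cancel r l (1 ∷ ρ) ⟩
    dot (zip _∸_ r l) (1 ∷ ρ) + dot (zip _⊓_ r l) (1 ∷ ρ)
      ≡⟨ cong (λ v → dot (zip _∸_ r l) (1 ∷ ρ) + dot v (1 ∷ ρ)) (zip-comm r l) ⟩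
    dot (zip _∸_ r l) (1 ∷ ρ) + dot (zip _⊓_ l r) (1 ∷ ρ) ∎)
    where open ≤-Reasoning

  combine-holds : ∀ {n} (ρ : Vec ℕ n) i c d → Holds ρ c → Holds ρ d → Holds ρ (combine i c d)
  combine-holds ρ i (l , r) (l′ , r′) h h′ = cancel-holds ρ (zip _+_ (scale u l) (scale v l′))
      (zip _+_ (scale u r) (scale v r′)) (begin
    dot (zip _+_ (scale u l) (scale v l′)) (1 ∷ ρ) ≡⟨ expand l l′ ⟩
    u * dot l (1 ∷ ρ) + v * dot l′ (1 ∷ ρ)         ≤⟨ +-mono-≤ (*-monoʳ-≤ u h) (*-monoʳ-≤ v h′) ⟩
    u * dot r (1 ∷ ρ) + v * dot r′ (1 ∷ ρ)         ≡⟨ expand r r′ ⟨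
    dot (zip _+_ (scale u r) (scale v r′)) (1 ∷ ρ) ∎)
    where
    open ≤-Reasoning
    u = lookup r′ i ∸ lookup l′ i
    v = lookup l i ∸ lookup r i
    expand : ∀ a a′ → dot (zip _+_ (scale u a) (scale v a′)) (1 ∷ ρ) ≡ u * dot a (1 ∷ ρ) + v * dot a′ (1 ∷ ρ)
    expand a a′ = trans (dot-+ (scale u a) (scale v a′) (1 ∷ ρ))
                        (cong₂ _+_ (dot-scale u a (1 ∷ ρ)) (dot-scale v a′ (1 ∷ ρ)))

  select : ∀ {n} → (Constraint n → Bool) → List (Constraint n) → List (Constraint n)
  select p []       = []
  select p (c ∷ cs) = if p c then c ∷ select p cs else select p cs

  upper lower balanced : ∀ {n} → Fin (suc n) → Constraint n → Bool
  upper i (l , r) = lookup r i <ᵇ lookup l i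
  lower i (l , r) = lookup l i <ᵇ lookup r i
  balanced i c = if upper i c then false else (if lower i c then false else true)

  products : ∀ {n} → Fin (suc n) → List (Constraint n) → List (Constraint n) → List (Constraint n)
  products i []       ds = []
  products i (c ∷ cs) ds = map (combine i c) ds ++ products i cs ds

  eliminate : ∀ {n} → Fin (suc n) → List (Constraint n) → List (Constraint n)
  eliminate i cs = products i (select (upper i) cs) (select (lower i) cs) ++ select (balanced i) cs

  size : ∀ {n} → List (Constraint n) → ℕ
  size []       = 0
  size (_ ∷ cs) = suc (size cs)

  weight : ∀ {n} → List (Constraint n) → Fin n → ℕ
  weight cs i with size (select (upper (suc i)) cs) | size (select (lower (suc i)) cs)
  -- A variable that is balanced in every constraint leaves nothing to eliminate; the large weight
  -- keeps it from using up one of the `n` rounds. Otherwise the weight is the number of constraints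
  -- created.
  ... | 0 | 0 = 1000000
  ... | u | l = u * l

  cheapest : ∀ {n} → List (Constraint n) → ℕ → Fin n → List (Fin n) → Fin n
  cheapest cs w i []       = i
  cheapest cs w i (j ∷ js) = if weight cs j <ᵇ w then cheapest cs (weight cs j) j js else cheapest cs w i js

  eliminateAll : ∀ {n} → ℕ → List (Constraint n) → List (Constraint n)
  eliminateAll         zero    cs = cs
  eliminateAll {zero}  (suc f) cs = cs
  eliminateAll {suc n} (suc f) cs =
    eliminateAll f (eliminate (suc (cheapest cs (weight cs zero) zero (allFin (suc n)))) cs)

  dominates : ∀ {n} → Vec ℕ n → Vec ℕ n → Bool
  dominates []       []       = true
  dominates (l ∷ ls) (r ∷ rs) = (r ≤ᵇ l) ∧ dominates ls rs

  -- Variables are nonnegative, so a left side with dominating coefficients and a larger constant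
  -- term exceeds the right side everywhere.
  absurd : ∀ {n} → Constraint n → Bool
  absurd (l ∷ ls , r ∷ rs) = (r <ᵇ l) ∧ dominates ls rs

  anyAbsurd : ∀ {n} → List (Constraint n) → Bool
  anyAbsurd []       = false
  anyAbsurd (c ∷ cs) = absurd c ∨ anyAbsurd cs

  unit : ∀ {n} → Fin n → Vec ℕ n
  unit zero    = 1 ∷ replicate _ 0
  unit (suc i) = 0 ∷ unit i

  nonneg : ∀ {n} → List (Fin n) → List (Constraint n)
  nonneg []       = []
  nonneg (i ∷ is) = (replicate _ 0 , 0 ∷ unit i) ∷ nonneg is

  refutes : ∀ {n} → List (Constraint n) → Bool
  refutes {n} cs = anyAbsurd (eliminateAll n (nonneg (allFin n) ++ cs))

  module _ {n} (ρ : Vec ℕ n) where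

    select-holds : ∀ p cs → All (Holds ρ) cs → All (Holds ρ) (select p cs)
    select-holds p []       []       = []
    select-holds p (c ∷ cs) (h ∷ hs) with p c
    ... | true  = h ∷ select-holds p cs hs
    ... | false = select-holds p cs hs

    map-holds : ∀ i c ds → Holds ρ c → All (Holds ρ) ds → All (Holds ρ) (map (combine i c) ds)
    map-holds i c []       h []        = []
    map-holds i c (d ∷ ds) h (h′ ∷ hs) = combine-holds ρ i c d h h′ ∷ map-holds i c ds h hs

    products-holds : ∀ i cs ds → All (Holds ρ) cs → All (Holds ρ) ds → All (Holds ρ) (products i cs ds)
    products-holds i []       ds []       hs = []
    products-holds i (c ∷ cs) ds (h ∷ hs) h′ = ++⁺ (map-holds i c ds h h′) (products-holds i cs ds hs h′)

    eliminate-holds : ∀ i cs → All (Holds ρ) cs → All (Holds ρ) (eliminate i cs)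
    eliminate-holds i cs hs =
      ++⁺ (products-holds i _ _ (select-holds (upper i) cs hs) (select-holds (lower i) cs hs))
          (select-holds (balanced i) cs hs)

  eliminateAll-holds : ∀ {n} (ρ : Vec ℕ n) f cs → All (Holds ρ) cs → All (Holds ρ) (eliminateAll f cs)
  eliminateAll-holds         ρ zero    cs hs = hs
  eliminateAll-holds {zero}  ρ (suc f) cs hs = hs
  eliminateAll-holds {suc n} ρ (suc f) cs hs = eliminateAll-holds ρ f _ (eliminate-holds ρ _ cs hs)

  T-∧ˡ : ∀ {a b} → T (a ∧ b) → T a
  T-∧ˡ {true} _ = tt

  T-∧ʳ : ∀ {a b} → T (a ∧ b) → T b
  T-∧ʳ {true} t = t

  dominates-dot : ∀ {n} (ls rs xs : Vec ℕ n) → T (dominates ls rs) → dot rs xs ≤ dot ls xs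
  dominates-dot []       []       []       t = z≤n
  dominates-dot (l ∷ ls) (r ∷ rs) (x ∷ xs) t =
    +-mono-≤ (*-monoˡ-≤ x (≤ᵇ⇒≤ r l (T-∧ˡ t))) (dominates-dot ls rs xs (T-∧ʳ {r ≤ᵇ l} t))

  absurd-fails : ∀ {n} (ρ : Vec ℕ n) c → T (absurd c) → ¬ Holds ρ c
  absurd-fails ρ (l ∷ ls , r ∷ rs) t h = <⇒≱ strict h
    where
    strict : dot (r ∷ rs) (1 ∷ ρ) < dot (l ∷ ls) (1 ∷ ρ)
    strict = +-mono-<-≤ (*-monoˡ-< 1 (<ᵇ⇒< r l (T-∧ˡ t))) (dominates-dot ls rs ρ (T-∧ʳ {r <ᵇ l} t))

  anyAbsurd-fails : ∀ {n} (ρ : Vec ℕ n) cs → T (anyAbsurd cs) → ¬ All (Holds ρ) cs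
  anyAbsurd-fails ρ (c ∷ cs) t (h ∷ hs) with absurd c in eq
  ... | true  = absurd-fails ρ c (subst T (sym eq) tt) h
  ... | false = anyAbsurd-fails ρ cs t hs

  dot-zero : ∀ {n} (xs : Vec ℕ n) → dot (replicate n 0) xs ≡ 0
  dot-zero []       = refl
  dot-zero (x ∷ xs) = dot-zero xs

  nonneg-holds : ∀ {n} (ρ : Vec ℕ n) is → All (Holds ρ) (nonneg is)
  nonneg-holds ρ []       = []
  nonneg-holds ρ (i ∷ is) = subst (_≤ dot (0 ∷ unit i) (1 ∷ ρ)) (sym (dot-zero (1 ∷ ρ))) z≤n ∷ nonneg-holds ρ is

  refutes-sound : ∀ {n} (ρ : Vec ℕ n) cs → T (refutes cs) → ¬ All (Holds ρ) cs
  refutes-sound {n} ρ cs t hs =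
    anyAbsurd-fails ρ _ t (eliminateAll-holds ρ n _ (++⁺ (nonneg-holds ρ (allFin n)) hs))

  infixl 7 _⊕_
  infixl 8 _⊛_
  infix  5 _≼_ _≺_ _≈_
  infix  9 1+_
  infixr 4 _⇒_
  infix  4 ⊢_

  data Expr (n : ℕ) : Set where
    var : Fin n → Expr n
    #_  : ℕ → Expr n
    _⊕_ : Expr n → Expr n → Expr n
    _⊛_ : ℕ → Expr n → Expr n

  data Atom (n : ℕ) : Set where
    _≼_ _≈_ : Expr n → Expr n → Atom n

  1+_ : ∀ {n} → Expr n → Expr n
  1+ a = # 1 ⊕ a

  _≺_ : ∀ {n} → Expr n → Expr n → Atom n
  a ≺ b = # 1 ⊕ a ≼ b

  data Sequent (n : ℕ) : Set where
    _⇒_ : Atom n → Sequent n → Sequent n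
    ⊢_  : Atom n → Sequent n

  -- Coordinates of a cell (i , j) at even or odd distance above the main diagonal.
  on-even on-odd : ∀ {n} → (i j c x : Expr n) → Sequent n → Sequent n
  on-even i j σ x s = i ⊕ x ≈ σ ⇒ σ ⊕ x ≈ j ⇒ s
  on-odd  i j τ x s = i ⊕ x ≈ τ ⇒ τ ⊕ x ≈ 1+ j ⇒ s

  ⟦_⟧ : ∀ {n} → Expr n → Vec ℕ n → ℕ
  ⟦ var i ⟧ ρ = lookup ρ i
  ⟦ # c   ⟧ ρ = c
  ⟦ a ⊕ b ⟧ ρ = ⟦ a ⟧ ρ + ⟦ b ⟧ ρ
  ⟦ k ⊛ a ⟧ ρ = k * ⟦ a ⟧ ρ

  ⟦_⟧ᵃ : ∀ {n} → Atom n → Vec ℕ n → Set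
  ⟦ a ≼ b ⟧ᵃ ρ = ⟦ a ⟧ ρ ≤ ⟦ b ⟧ ρ
  ⟦ a ≈ b ⟧ᵃ ρ = ⟦ a ⟧ ρ ≡ ⟦ b ⟧ ρ

  ⟦_⟧ˢ : ∀ {n} → Sequent n → Vec ℕ n → Set
  ⟦ a ⇒ s ⟧ˢ ρ = ⟦ a ⟧ᵃ ρ → ⟦ s ⟧ˢ ρ
  ⟦ ⊢ a   ⟧ˢ ρ = ⟦ a ⟧ᵃ ρ

  coefs : ∀ {n} → Expr n → Coefs n
  coefs (var i) = 0 ∷ unit i
  coefs (# c)   = c ∷ replicate _ 0
  coefs (a ⊕ b) = zip _+_ (coefs a) (coefs b)
  coefs (k ⊛ a) = scale k (coefs a)

  dot-unit : ∀ {n} (i : Fin n) xs → dot (unit i) xs ≡ lookup xs i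
  dot-unit zero    (x ∷ xs) = trans (cong₂ _+_ (*-identityˡ x) (dot-zero xs)) (+-identityʳ x)
  dot-unit (suc i) (x ∷ xs) = dot-unit i xs

  dot-coefs : ∀ {n} (e : Expr n) ρ → dot (coefs e) (1 ∷ ρ) ≡ ⟦ e ⟧ ρ
  dot-coefs (var i) ρ = dot-unit i ρ
  dot-coefs (# c)   ρ = trans (cong₂ _+_ (*-identityʳ c) (dot-zero ρ)) (+-identityʳ c)
  dot-coefs (a ⊕ b) ρ = trans (dot-+ (coefs a) (coefs b) (1 ∷ ρ)) (cong₂ _+_ (dot-coefs a ρ) (dot-coefs b ρ))
  dot-coefs (k ⊛ a) ρ = trans (dot-scale k (coefs a) (1 ∷ ρ)) (cong (k *_) (dot-coefs a ρ))

  constraint : ∀ {n} → Expr n → Expr n → Constraint n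
  constraint a b = coefs a , coefs b

  constraint-holds : ∀ {n} (a b : Expr n) ρ → ⟦ a ⟧ ρ ≤ ⟦ b ⟧ ρ → Holds ρ (constraint a b)
  constraint-holds a b ρ = subst₂ _≤_ (sym (dot-coefs a ρ)) (sym (dot-coefs b ρ))

  hypotheses : ∀ {n} → Atom n → List (Constraint n) → List (Constraint n)
  hypotheses (a ≼ b) cs = constraint a b ∷ cs
  hypotheses (a ≈ b) cs = constraint a b ∷ constraint b a ∷ cs

  -- The negation of a ≤ b is entered as 1 + b ≤ a. Integrality is exploited only through such
  -- strict inequalities; the elimination itself is rational.
  decide : ∀ {n} → List (Constraint n) → Sequent n → Bool
  decide cs (a ⇒ s)      = decide (hypotheses a cs) s
  decide cs (⊢ (a ≼ b)) = refutes (constraint (1+ b) a ∷ cs)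
  decide cs (⊢ (a ≈ b)) = refutes (constraint (1+ b) a ∷ cs) ∧ refutes (constraint (1+ a) b ∷ cs)

  refutes-≤ : ∀ {n} (ρ : Vec ℕ n) cs a b → All (Holds ρ) cs →
              T (refutes (constraint (1+ b) a ∷ cs)) → ⟦ a ⟧ ρ ≤ ⟦ b ⟧ ρ
  refutes-≤ ρ cs a b hs t with ⟦ a ⟧ ρ ≤? ⟦ b ⟧ ρ
  ... | yes a≤b = a≤b
  ... | no  a≰b = ⊥-elim (refutes-sound ρ _ t (constraint-holds (1+ b) a ρ (≰⇒> a≰b) ∷ hs))

  decide-sound : ∀ {n} (ρ : Vec ℕ n) cs s → All (Holds ρ) cs → T (decide cs s) → ⟦ s ⟧ˢ ρ
  decide-sound ρ cs ((a ≼ b) ⇒ s) hs t h = decide-sound ρ _ s (constraint-holds a b ρ h ∷ hs) t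
  decide-sound ρ cs ((a ≈ b) ⇒ s) hs t h =
    decide-sound ρ _ s (constraint-holds a b ρ (≤-reflexive h) ∷ constraint-holds b a ρ (≤-reflexive (sym h)) ∷ hs) t
  decide-sound ρ cs (⊢ (a ≼ b)) hs t = refutes-≤ ρ cs a b hs t
  decide-sound ρ cs (⊢ (a ≈ b)) hs t =
    ≤-antisym (refutes-≤ ρ cs a b hs (T-∧ˡ t))
              (refutes-≤ ρ cs b a hs (T-∧ʳ {refutes (constraint (1+ b) a ∷ cs)} t))

  Fun : ℕ → Set → Set → Set
  Fun zero    A B = B
  Fun (suc n) A B = A → Fun n A B

  apply : ∀ {n A B} → Fun n A B → Vec A n → B
  apply f []       = f
  apply f (x ∷ xs) = apply (f x) xs

  Forall : ∀ n → (Vec ℕ n → Set) → Set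
  Forall zero    P = P []
  Forall (suc n) P = (x : ℕ) → Forall n (λ ρ → P (x ∷ ρ))

  forall⁺ : ∀ n {P : Vec ℕ n → Set} → (∀ ρ → P ρ) → Forall n P
  forall⁺ zero    f = f []
  forall⁺ (suc n) f = λ x → forall⁺ n (λ ρ → f (x ∷ ρ))

  variables : ∀ n → Vec (Expr n) n
  variables n = tabulate var

  -- Proof by evaluation: once `decide` computes to true, the implicit argument has the unit type
  -- and is filled in by unification. Nonlinear terms such as k * k are passed as opaque variables.
  lin : ∀ n (f : Fun n (Expr n) (Sequent n)) → {T (decide [] (apply f (variables n)))} →
        Forall n ⟦ apply f (variables n) ⟧ˢ
  lin n f {t} = forall⁺ n (λ ρ → decide-sound ρ [] (apply f (variables n)) [] t)

open LinearArithmetic using (lin; #_; 1+_; _⊕_; _⊛_; _≼_; _≺_; _≈_; _⇒_; ⊢_; on-even; on-odd)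

-- Finite sums

∑ : ℕ → (ℕ → ℕ) → ℕ
∑ zero    f = 0
∑ (suc n) f = ∑ n f + f n

∑-cong : ∀ n {f g} → (∀ i → i < n → f i ≡ g i) → ∑ n f ≡ ∑ n g
∑-cong zero    h = refl
∑-cong (suc n) h = cong₂ _+_ (∑-cong n (λ i i<n → h i (m<n⇒m<1+n i<n))) (h n ≤-refl)

∑-mono : ∀ n {f g} → (∀ i → i < n → f i ≤ g i) → ∑ n f ≤ ∑ n g
∑-mono zero    h = z≤n
∑-mono (suc n) h = +-mono-≤ (∑-mono n (λ i i<n → h i (m<n⇒m<1+n i<n))) (h n ≤-refl)

∑-+ : ∀ n f g → ∑ n (λ i → f i + g i) ≡ ∑ n f + ∑ n g
∑-+ zero    f g = refl
∑-+ (suc n) f g rewrite ∑-+ n f g = interchange (∑ n f) (∑ n g) (f n) (g n)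

∑-const : ∀ n c → ∑ n (λ _ → c) ≡ n * c
∑-const zero    c = refl
∑-const (suc n) c rewrite ∑-const n c = +-comm (n * c) c

∑-zero : ∀ n {f} → (∀ i → i < n → f i ≡ 0) → ∑ n f ≡ 0
∑-zero n h = trans (∑-cong n h) (trans (∑-const n 0) (*-zeroʳ n))

∑-swap : ∀ m n (g : ℕ → ℕ → ℕ) → ∑ m (λ i → ∑ n (g i)) ≡ ∑ n (λ j → ∑ m (λ i → g i j))
∑-swap zero    n g = sym (∑-zero n (λ _ _ → refl))
∑-swap (suc m) n g = trans (cong (_+ ∑ n (g m)) (∑-swap m n g)) (sym (∑-+ n (λ j → ∑ m (λ i → g i j)) (g m)))

∑-head : ∀ n f → ∑ (suc n) f ≡ f 0 + ∑ n (f ∘ suc)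
∑-head zero    f = sym (+-identityʳ (f 0))
∑-head (suc n) f rewrite ∑-head n f = +-assoc (f 0) (∑ n (f ∘ suc)) (f (suc n))

∑-split : ∀ m n f → ∑ (m + n) f ≡ ∑ m f + ∑ n (λ i → f (m + i))
∑-split m zero    f rewrite +-identityʳ m = sym (+-identityʳ (∑ m f))
∑-split m (suc n) f rewrite +-suc m n | ∑-split m n f = +-assoc (∑ m f) (∑ n (λ i → f (m + i))) (f (m + n))

∑-window : ∀ a l n f → a + l ≤ n → ∑ l (λ i → f (a + i)) ≤ ∑ n f
∑-window a l n f a+l≤n with m≤n⇒∃[o]m+o≡n a+l≤n
... | o , refl rewrite ∑-split (a + l) o f | ∑-split a l f =
  ≤-trans (m≤n+m _ (∑ a f)) (m≤m+n _ _)

∑-prefix : ∀ l n f → l ≤ n → ∑ l f ≤ ∑ n f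
∑-prefix l n f = ∑-window 0 l n f

∑-reverse : ∀ n f → ∑ (suc n) (λ y → f (n ∸ y)) ≡ ∑ (suc n) f
∑-reverse zero    f = refl
∑-reverse (suc n) f = trans (∑-head (suc n) (λ y → f (suc n ∸ y)))
  (trans (cong (f (suc n) +_) (∑-reverse n f)) (+-comm (f (suc n)) (∑ (suc n) f)))

∑-evenOdd : ∀ n f → ∑ (n + n) f ≡ ∑ n (λ y → f (y + y) + f (suc (y + y)))
∑-evenOdd zero    f = refl
∑-evenOdd (suc n) f rewrite +-suc n n | ∑-evenOdd n f =
  +-assoc (∑ n (λ y → f (y + y) + f (suc (y + y)))) (f (n + n)) (f (suc (n + n)))

-- The antidiagonals t < n fill the triangle i + y < n inside the square. In the induction a new
-- antidiagonal lengthens every row of the triangle by one cell.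
∑-antidiagonals : ∀ n (g : ℕ → ℕ → ℕ) →
  ∑ n (λ t → ∑ (suc t) (λ y → g (t ∸ y) y)) ≤ ∑ n (λ i → ∑ n (g i))
∑-antidiagonals n g = ≤-trans (≤-reflexive (triangle n)) (∑-mono n (λ i _ → ∑-prefix (n ∸ i) n (g i) (m∸n≤m n i)))
  where
  triangle : ∀ n → ∑ n (λ t → ∑ (suc t) (λ y → g (t ∸ y) y)) ≡ ∑ n (λ i → ∑ (n ∸ i) (g i))
  triangle zero    = refl
  triangle (suc n) = begin
    ∑ n (λ t → ∑ (suc t) (λ y → g (t ∸ y) y)) + ∑ (suc n) (λ y → g (n ∸ y) y)
      ≡⟨ cong₂ _+_ (triangle n) reversed ⟩
    ∑ n (λ i → ∑ (n ∸ i) (g i)) + (∑ n (λ i → g i (n ∸ i)) + g n 0)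
      ≡⟨ +-assoc (∑ n (λ i → ∑ (n ∸ i) (g i))) _ _ ⟨
    (∑ n (λ i → ∑ (n ∸ i) (g i)) + ∑ n (λ i → g i (n ∸ i))) + g n 0
      ≡⟨ cong₂ _+_ (trans (sym (∑-+ n _ _)) (∑-cong n (λ i i<n → grow i (<⇒≤ i<n)))) last ⟩
    ∑ n (λ i → ∑ (suc n ∸ i) (g i)) + ∑ (suc n ∸ n) (g n) ∎
    where
    open ≡-Reasoning
    reversed : ∑ (suc n) (λ y → g (n ∸ y) y) ≡ ∑ n (λ i → g i (n ∸ i)) + g n 0
    reversed = trans (∑-cong (suc n) (λ y y<n → cong (g (n ∸ y)) (sym (m∸[m∸n]≡n (s≤s⁻¹ y<n)))))
      (trans (∑-reverse n (λ i → g i (n ∸ i))) (cong (λ z → ∑ n (λ i → g i (n ∸ i)) + g n z) (n∸n≡0 n)))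
    grow : ∀ i → i ≤ n → ∑ (n ∸ i) (g i) + g i (n ∸ i) ≡ ∑ (suc n ∸ i) (g i)
    grow i i≤n rewrite +-∸-assoc 1 i≤n = refl
    last : g n 0 ≡ ∑ (suc n ∸ n) (g n)
    last rewrite +-∸-assoc 1 (≤-refl {n}) | n∸n≡0 n = refl

-- This passes equality in a total cost on to each single line, and all rigidity comes from it.
∑-tight : ∀ n {f g} → (∀ i → i < n → f i ≤ g i) → ∑ n g ≤ ∑ n f → ∀ i → i < n → g i ≤ f i
∑-tight (suc n) {f} {g} h total i i<1+n with m<1+n⇒m<n∨m≡n i<1+n
... | inj₁ i<n  = ∑-tight n (λ j j<n → h j (m<n⇒m<1+n j<n)) rest i i<n
  where
  rest : ∑ n g ≤ ∑ n f
  rest = (lin 4 λ F G a b → G ⊕ b ≼ F ⊕ a ⇒ a ≼ b ⇒ ⊢ G ≼ F) (∑ n f) (∑ n g) (f n) (g n) total (h n ≤-refl)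
... | inj₂ refl = (lin 4 λ F G a b → G ⊕ b ≼ F ⊕ a ⇒ F ≼ G ⇒ ⊢ b ≼ a) (∑ n f) (∑ n g) (f n) (g n) total
                    (∑-mono n {f} {g} (λ j j<n → h j (m<n⇒m<1+n j<n)))

-- Total variation of a sequence

tv : (ℕ → ℕ) → ℕ → ℕ
tv φ n = ∑ n (λ i → ∣ φ (suc i) - φ i ∣)

tv-split : ∀ φ m n → tv φ (m + n) ≡ tv φ m + tv (λ i → φ (m + i)) n
tv-split φ m n = trans (∑-split m n _) (cong (tv φ m +_)
  (∑-cong n (λ i _ → cong (λ s → ∣ φ s - φ (m + i) ∣) (sym (+-suc m i)))))

tv-ends : ∀ φ n → φ n ≤ φ 0 + tv φ n × φ 0 ≤ φ n + tv φ n
tv-ends φ zero    = ≤-reflexive (sym (+-identityʳ _)) , ≤-reflexive (sym (+-identityʳ _))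
tv-ends φ (suc n) with tv-ends φ n
... | p , q =
  (lin 5 λ a b c t d → b ≼ a ⊕ t ⇒ c ≼ b ⊕ d ⇒ ⊢ c ≼ a ⊕ (t ⊕ d)) (φ 0) (φ n) (φ (suc n)) (tv φ n) _ p (m≤n+∣m-n∣ _ _) ,
  (lin 5 λ a b c t d → a ≼ b ⊕ t ⇒ b ≼ c ⊕ d ⇒ ⊢ a ≼ c ⊕ (t ⊕ d)) (φ 0) (φ n) (φ (suc n)) (tv φ n) _ q
    (subst (λ d → φ n ≤ φ (suc n) + d) (∣-∣-comm (φ n) (φ (suc n))) (m≤n+∣m-n∣ _ _))

tv-between : ∀ φ {i j} → i ≤ j → φ j + tv φ i ≤ φ i + tv φ j × φ i + tv φ i ≤ φ j + tv φ j
tv-between φ {i} i≤j with m≤n⇒∃[o]m+o≡n i≤j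
... | o , refl rewrite tv-split φ i o with tv-ends (λ y → φ (i + y)) o
... | p , q rewrite +-identityʳ i =
  (lin 4 λ a b t d → b ≼ a ⊕ d ⇒ ⊢ b ⊕ t ≼ a ⊕ (t ⊕ d)) (φ i) (φ (i + o)) (tv φ i) _ p ,
  (lin 4 λ a b t d → a ≼ b ⊕ d ⇒ ⊢ a ⊕ t ≼ b ⊕ (t ⊕ d)) (φ i) (φ (i + o)) (tv φ i) _ q

tv-peak : ∀ φ {i n} → i ≤ n → 2 * φ i ≤ φ 0 + φ n + tv φ n
tv-peak φ {i} {n} i≤n = (lin 5 λ a b c s t → b ≼ a ⊕ s ⇒ b ⊕ s ≼ c ⊕ t ⇒ ⊢ 2 ⊛ b ≼ a ⊕ c ⊕ t)
  (φ 0) (φ i) (φ n) (tv φ i) (tv φ n) (proj₁ (tv-ends φ i)) (proj₂ (tv-between φ i≤n))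

tv-pit : ∀ φ {i n} → i ≤ n → φ 0 + φ n ≤ 2 * φ i + tv φ n
tv-pit φ {i} {n} i≤n = (lin 5 λ a b c s t → a ≼ b ⊕ s ⇒ c ⊕ s ≼ b ⊕ t ⇒ ⊢ a ⊕ c ≼ 2 ⊛ b ⊕ t)
  (φ 0) (φ i) (φ n) (tv φ i) (tv φ n) (proj₂ (tv-ends φ i)) (proj₁ (tv-between φ i≤n))

-- The sequence has to rise to `φ i`, fall to `φ j`, rise again to `φ l` and fall to the end, so a
-- dip between two high points is paid for on both sides.
tv-dip : ∀ φ {i j l n} → i ≤ j → j ≤ l → l ≤ n → 2 * φ i + 2 * φ l ≤ φ 0 + φ n + 2 * φ j + tv φ n
tv-dip φ {i} {j} {l} {n} i≤j j≤l l≤n =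
  (lin 9 λ a b c d e s t u v → b ≼ a ⊕ s ⇒ b ⊕ s ≼ c ⊕ t ⇒ d ⊕ t ≼ c ⊕ u ⇒ d ⊕ u ≼ e ⊕ v ⇒
     ⊢ 2 ⊛ b ⊕ 2 ⊛ d ≼ a ⊕ e ⊕ 2 ⊛ c ⊕ v)
  (φ 0) (φ i) (φ j) (φ l) (φ n) (tv φ i) (tv φ j) (tv φ l) (tv φ n)
  (proj₁ (tv-ends φ i)) (proj₂ (tv-between φ i≤j)) (proj₁ (tv-between φ j≤l)) (proj₂ (tv-between φ l≤n))

tv-suffix : ∀ φ {i n} → i ≤ n → φ n ≤ φ i + tv φ n
tv-suffix φ {i} {n} i≤n = (lin 4 λ b c s t → c ⊕ s ≼ b ⊕ t ⇒ ⊢ c ≼ b ⊕ t)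
  (φ i) (φ n) (tv φ i) (tv φ n) (proj₁ (tv-between φ i≤n))

argmax : ∀ (f : ℕ → ℕ) n → ∃ λ i → i ≤ n × (∀ j → j ≤ n → f j ≤ f i)
argmax f zero = 0 , z≤n , λ { zero z≤n → ≤-refl }
argmax f (suc n) with argmax f n
... | i , i≤n , top with ≤-total (f i) (f (suc n))
... | inj₁ le = suc n , ≤-refl , λ j j≤ → case-last j j≤
  where
  case-last : ∀ j → j ≤ suc n → f j ≤ f (suc n)
  case-last j j≤ with m≤n⇒m<n∨m≡n j≤
  ... | inj₁ j< = ≤-trans (top j (s≤s⁻¹ j<)) le
  ... | inj₂ refl = ≤-refl
... | inj₂ ge = i , m≤n⇒m≤1+n i≤n , λ j j≤ → case-last j j≤
  where
  case-last : ∀ j → j ≤ suc n → f j ≤ f i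
  case-last j j≤ with m≤n⇒m<n∨m≡n j≤
  ... | inj₁ j< = top j (s≤s⁻¹ j<)
  ... | inj₂ refl = ge

argmin : ∀ (f : ℕ → ℕ) n → ∃ λ i → i ≤ n × (∀ j → j ≤ n → f i ≤ f j)
-- The maximum of `f` bounds all its values, so truncated subtraction from it is exact and reverses
-- the order.
argmin f n with argmax (λ i → f (proj₁ (argmax f n)) ∸ f i) n
... | i , i≤n , top = i , i≤n , λ j j≤n →
  subst₂ _≤_ (m∸[m∸n]≡n (bound i i≤n)) (m∸[m∸n]≡n (bound j j≤n)) (∸-monoʳ-≤ _ (top j j≤n))
  where
  bound : ∀ j → j ≤ n → f j ≤ f (proj₁ (argmax f n))
  bound = proj₂ (proj₂ (argmax f n))

tv-suffix′ : ∀ φ {i n} → i ≤ n → φ i ≤ φ n + tv φ n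
tv-suffix′ φ {i} {n} i≤n = (lin 4 λ b c s t → b ⊕ s ≼ c ⊕ t ⇒ ⊢ b ≼ c ⊕ t)
  (φ i) (φ n) (tv φ i) (tv φ n) (proj₂ (tv-between φ i≤n))

-- Parity and closed forms of the cost sums

odd : ℕ → ℕ
odd 0             = 0
odd 1             = 1
odd (suc (suc n)) = odd n

odd-double : ∀ n m → odd (n + n + m) ≡ odd m
odd-double zero    m = refl
odd-double (suc n) m rewrite +-suc n n = odd-double n m

odd-complement : ∀ y → odd (suc (y + y)) + odd (suc (suc (y + y))) ≡ 1
odd-complement zero    = refl
odd-complement (suc y) rewrite +-suc y y = odd-complement y

∑-odd : ∀ q → ∑ (q + q) (λ r → odd (suc r)) ≡ q
∑-odd q = trans (∑-evenOdd q _) (trans (∑-cong q (λ y _ → odd-complement y)) (trans (∑-const q 1) (*-identityʳ q)))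

-- Climbing to p and back from the heights 1, ..., p costs p(p - 1) in total; the term p is moved to
-- the left to avoid subtraction.
∑-descending : ∀ p → ∑ p (λ y → 2 * (p ∸ suc y)) + p ≡ p * p
∑-descending zero    = refl
∑-descending (suc n) = begin
  ∑ (suc n) (λ y → 2 * (n ∸ y)) + suc n ≡⟨ cong (_+ suc n) (∑-reverse n (2 *_)) ⟩
  ∑ (suc n) (2 *_) + suc n              ≡⟨ gauss n ⟩
  suc n * suc n                         ∎
  where
  open ≡-Reasoning
  gauss : ∀ n → ∑ (suc n) (2 *_) + suc n ≡ suc n * suc n
  gauss zero    = refl
  gauss (suc n) = (lin 4 λ s a b n → s ⊕ 1+ n ≈ a ⇒ b ≈ a ⊕ 1+ n ⊕ (# 2 ⊕ n) ⇒
                     ⊢ s ⊕ 2 ⊛ 1+ n ⊕ (# 2 ⊕ n) ≈ b) _ _ _ n (gauss n) (square n)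
    where
    square : ∀ n → suc (suc n) * suc (suc n) ≡ suc n * suc n + suc n + suc (suc n)
    square = solve-∀

-- Removing the two end terms, both 1, and lowering the other 2q terms by 1 leaves the tent for q,
-- so the sum grows by 2q + 2.
∑-tentOdd : ∀ q → ∑ (q + q) (λ r → suc r ⊓ (q + q ∸ r)) ≡ q * suc q
∑-tentOdd zero = refl
∑-tentOdd (suc q) rewrite +-suc q q = begin
  ∑ (suc (suc (q + q))) (λ r → suc r ⊓ (suc (suc (q + q)) ∸ r))
    ≡⟨ ∑-head (suc (q + q)) _ ⟩
  1 + (∑ (q + q) (λ r → suc (suc r) ⊓ (suc (q + q) ∸ r)) + suc (suc (q + q)) ⊓ (suc (q + q) ∸ (q + q)))
    ≡⟨ cong₂ (λ a b → 1 + (a + b)) (trans (∑-cong (q + q) step) (∑-+ (q + q) (λ _ → 1) (λ r → suc r ⊓ (q + q ∸ r))))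
         (cong (suc (suc (q + q)) ⊓_) (trans (+-∸-assoc 1 (≤-refl {q + q})) (cong suc (n∸n≡0 (q + q))))) ⟩
  1 + ((∑ (q + q) (λ _ → 1) + ∑ (q + q) (λ r → suc r ⊓ (q + q ∸ r))) + 1)
    ≡⟨ cong₂ (λ a b → 1 + ((a + b) + 1)) (∑-const (q + q) 1) (∑-tentOdd q) ⟩
  1 + (((q + q) * 1 + q * suc q) + 1)
    ≡⟨ close q ⟩
  suc q * suc (suc q) ∎
  where
  open ≡-Reasoning
  step : ∀ r → r < q + q → suc (suc r) ⊓ (suc (q + q) ∸ r) ≡ 1 + suc r ⊓ (q + q ∸ r)
  step r r< = cong (suc (suc r) ⊓_) (+-∸-assoc 1 (<⇒≤ r<))
  close : ∀ q → 1 + (((q + q) * 1 + q * suc q) + 1) ≡ suc q * suc (suc q)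
  close = solve-∀

-- The right slope is one step shorter here: the terms are 1, ..., q, ..., 1, 0, with a single peak.
∑-tentEven : ∀ q → ∑ (q + q) (λ r → suc r ⊓ (q + q ∸ suc r)) ≡ q * q
∑-tentEven zero = refl
∑-tentEven (suc q) rewrite +-suc q q = begin
  ∑ (suc (suc (q + q))) (λ r → suc r ⊓ (suc (q + q) ∸ r))
    ≡⟨ ∑-head (suc (q + q)) _ ⟩
  1 + (∑ (q + q) (λ r → suc (suc r) ⊓ (q + q ∸ r)) + suc (suc (q + q)) ⊓ (q + q ∸ (q + q)))
    ≡⟨ cong₂ (λ a b → 1 + (a + b)) (trans (∑-cong (q + q) step) (∑-+ (q + q) (λ _ → 1) (λ r → suc r ⊓ (q + q ∸ suc r))))
         (cong (suc (suc (q + q)) ⊓_) (n∸n≡0 (q + q))) ⟩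
  1 + ((∑ (q + q) (λ _ → 1) + ∑ (q + q) (λ r → suc r ⊓ (q + q ∸ suc r))) + 0)
    ≡⟨ cong₂ (λ a b → 1 + ((a + b) + 0)) (∑-const (q + q) 1) (∑-tentEven q) ⟩
  1 + (((q + q) * 1 + q * q) + 0)
    ≡⟨ close q ⟩
  suc q * suc q ∎
  where
  open ≡-Reasoning
  step : ∀ r → r < q + q → suc (suc r) ⊓ (q + q ∸ r) ≡ 1 + suc r ⊓ (q + q ∸ suc r)
  step r r< = cong (suc (suc r) ⊓_) (sym (suc-∸-suc (q + q) r r<))
    where
    suc-∸-suc : ∀ m r → r < m → suc (m ∸ suc r) ≡ m ∸ r
    suc-∸-suc (suc m) zero    _       = refl
    suc-∸-suc (suc m) (suc r) (s≤s h) = suc-∸-suc m r h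
  close : ∀ q → 1 + (((q + q) * 1 + q * q) + 0) ≡ suc q * suc q
  close = solve-∀

-- The quadratic bound and the rigidity of one lattice

module Quadratic (k p q : ℕ) (p+q≡2k : p + q ≡ 2 * k) where

  private
    -- The quantity p(p - 1) + q(q + 1) is invariant under p ↦ 2k + 1 - p. Both cases therefore have
    -- the same excess 2r(r + 1), where r is the distance from p to the nearer of k and k + 1.
    excess : ∀ {r} → (p ≤ k × k ≡ p + r) ⊎ (k < p × k ≡ q + 1 + r) →
             p * p + q * suc q ≡ 2 * (k * k) + p + (2 * (r * r) + 2 * r)
    excess {r} (inj₁ (_ , refl)) = trans (cong (λ q → p * p + q * suc q) q≡) (identity p r)
      where
      q≡ : q ≡ p + 2 * r
      q≡ = (lin 3 λ p q r → p ⊕ q ≈ 2 ⊛ (p ⊕ r) ⇒ ⊢ q ≈ p ⊕ 2 ⊛ r) p q r p+q≡2k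
      identity : ∀ p r → p * p + (p + 2 * r) * suc (p + 2 * r) ≡ 2 * ((p + r) * (p + r)) + p + (2 * (r * r) + 2 * r)
      identity = solve-∀
    excess {r} (inj₂ (_ , refl)) =
      trans (cong (λ p → p * p + q * suc q) p≡) (trans (identity q r)
        (cong (λ p → 2 * ((q + 1 + r) * (q + 1 + r)) + p + (2 * (r * r) + 2 * r)) (sym p≡)))
      where
      p≡ : p ≡ q + 2 + 2 * r
      p≡ = (lin 3 λ p q r → p ⊕ q ≈ 2 ⊛ (q ⊕ # 1 ⊕ r) ⇒ ⊢ p ≈ q ⊕ # 2 ⊕ 2 ⊛ r) p q r p+q≡2k
      identity : ∀ q r → (q + 2 + 2 * r) * (q + 2 + 2 * r) + q * suc q ≡
                 2 * ((q + 1 + r) * (q + 1 + r)) + (q + 2 + 2 * r) + (2 * (r * r) + 2 * r)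
      identity = solve-∀

    offset : ∃ λ r → (p ≤ k × k ≡ p + r) ⊎ (k < p × k ≡ q + 1 + r)
    offset with p ≤? k
    ... | yes p≤k with m≤n⇒∃[o]m+o≡n p≤k
    ...   | r , eq = r , inj₁ (p≤k , sym eq)
    offset | no p≰k with m≤n⇒∃[o]m+o≡n (q<k (≰⇒> p≰k))
      where
      q<k : k < p → suc q ≤ k
      q<k = (lin 3 λ p q k → p ⊕ q ≈ 2 ⊛ k ⇒ k ≺ p ⇒ ⊢ q ≺ k) p q k p+q≡2k
    ...   | r , eq = r , inj₂ (≰⇒> p≰k , trans (sym eq) (cong (_+ r) (+-comm 1 q)))

  bound : 2 * (k * k) + p ≤ p * p + q * suc q
  bound with offset
  ... | r , c rewrite excess c = m≤m+n _ _

  equality : p * p + q * suc q ≤ 2 * (k * k) + p → (p ≡ k) ⊎ (p ≡ suc k)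
  equality h with offset
  ... | r , c rewrite excess c = conclude c
    where
    r≡0 : r ≡ 0
    r≡0 = n≤0⇒n≡0 ((lin 3 λ a b r → a ⊕ (2 ⊛ b ⊕ 2 ⊛ r) ≼ a ⇒ ⊢ r ≼ # 0) (2 * (k * k) + p) (r * r) r h)
    conclude : (p ≤ k × k ≡ p + r) ⊎ (k < p × k ≡ q + 1 + r) → (p ≡ k) ⊎ (p ≡ suc k)
    conclude (inj₁ (_ , e)) = inj₁ ((lin 3 λ p k r → k ≈ p ⊕ r ⇒ r ≈ # 0 ⇒ ⊢ p ≈ k) p k r e r≡0)
    conclude (inj₂ (_ , e)) = inj₂ ((lin 4 λ p q k r → p ⊕ q ≈ 2 ⊛ k ⇒ k ≈ q ⊕ # 1 ⊕ r ⇒ r ≈ # 0 ⇒ ⊢ p ≈ 1+ k)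
                                     p q k r p+q≡2k e r≡0)

-- For 2p ≤ N this is the function max(x, min(p, σ, N - σ)) on the triangle: the leg values rise
-- until they meet a plateau of height `p`. The column x = 0, which on the even lattice is the main
-- diagonal of the matrix, is left open.
record Flat (N p : ℕ) (F : ℕ → ℕ → ℕ) : Set where
  field
    outside : ∀ {σ x} → 1 ≤ x → x ≤ σ → σ + x ≤ N → p ≤ x → F σ x ≡ x
    left    : ∀ {σ x} → 1 ≤ x → x ≤ σ → σ + x ≤ N → σ ≤ p → F σ x ≡ σ
    right   : ∀ {σ x} → 1 ≤ x → x ≤ σ → σ + x ≤ N → N ≤ σ + p → F σ x + σ ≡ N
    middle  : ∀ {σ x} → 1 ≤ x → x ≤ σ → σ + x ≤ N → x ≤ p → p ≤ σ → σ + p ≤ N → F σ x ≡ p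

-- A function on the triangle 1 ≤ x ≤ min(σ, N − σ) with value x on the two legs.
-- Its thresholds p and x₀ are the minimax over the lines "x constant".

module Lines (K N e : ℕ) (1≤K : 1 ≤ K) (N≡ : N ≡ e + 2 * K) (e≤1 : e ≤ 1) (F : ℕ → ℕ → ℕ)
             (legˡ : ∀ x → 1 ≤ x → x ≤ K → F x x ≡ x)
             (legʳ : ∀ x → 1 ≤ x → x ≤ K → F (N ∸ x) x ≡ x) where

  S : ℕ → ℕ
  S σ = σ ⊓ (N ∸ σ)

  line : ℕ → ℕ → ℕ
  line x i = F (x + i) x

  W V : ℕ → ℕ
  W x = tv (line x) (N ∸ 2 * x)
  V σ = tv (λ y → F σ (suc y)) (S σ ∸ 1)

  private
    peak : ∀ x → ∃ λ i → i ≤ N ∸ 2 * x × (∀ j → j ≤ N ∸ 2 * x → line x j ≤ line x i)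
    peak x = argmax (line x) (N ∸ 2 * x)

    height : ℕ → ℕ
    height y = line (suc y) (proj₁ (peak (suc y)))

    lowest : ∃ λ y → y ≤ K ∸ 1 × (∀ j → j ≤ K ∸ 1 → height y ≤ height j)
    lowest = argmin height (K ∸ 1)

    suc-pred-K : suc (K ∸ 1) ≡ K
    suc-pred-K = m+[n∸m]≡n 1≤K

  2x≤N : ∀ {x} → x ≤ K → 2 * x ≤ N
  2x≤N {x} h = (lin 4 λ x K N e → x ≼ K ⇒ N ≈ e ⊕ 2 ⊛ K ⇒ ⊢ 2 ⊛ x ≼ N) x K N e h N≡

  p x₀ : ℕ
  p  = height (proj₁ lowest)
  x₀ = suc (proj₁ lowest)

  x₀≤K : x₀ ≤ K
  x₀≤K = subst (x₀ ≤_) suc-pred-K (s≤s (proj₁ (proj₂ lowest)))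

  -- `x₀` has the lowest peak of all lines, hence every other peak is at least `p`. Together with
  -- `capped` these are the two halves of the minimax.
  reached : ∀ x → 1 ≤ x → x ≤ K → ∃ λ i → i ≤ N ∸ 2 * x × p ≤ line x i
  reached (suc y) _ x≤K with peak (suc y) | proj₂ (proj₂ lowest) y (s≤s⁻¹ (subst (suc y ≤_) (sym suc-pred-K) x≤K))
  ... | i , i≤ , _ | le = i , i≤ , le

  capped : ∀ i → i ≤ N ∸ 2 * x₀ → line x₀ i ≤ p
  capped = proj₂ (proj₂ (peak x₀))

  line-start : ∀ x → 1 ≤ x → x ≤ K → line x 0 ≡ x
  line-start x 1≤x x≤K = trans (cong (λ s → F s x) (+-identityʳ x)) (legˡ x 1≤x x≤K)

  line-end : ∀ x → 1 ≤ x → x ≤ K → line x (N ∸ 2 * x) ≡ x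
  line-end x 1≤x x≤K = trans (cong (λ s → F s x) end) (legʳ x 1≤x x≤K)
    where
    end : x + (N ∸ 2 * x) ≡ N ∸ x
    end = +-cancelʳ-≡ x _ _ (trans
      ((lin 3 λ x N d → d ⊕ 2 ⊛ x ≈ N ⇒ ⊢ x ⊕ d ⊕ x ≈ N) x N (N ∸ 2 * x) (m∸n+n≡m (2x≤N x≤K)))
      (sym (m∸n+n≡m (≤-trans (m≤m+n x _) (2x≤N x≤K)))))

  x₀≤p : x₀ ≤ p
  x₀≤p = subst (_≤ p) (line-start x₀ (s≤s z≤n) x₀≤K) (capped 0 z≤n)

  1≤p : 1 ≤ p
  1≤p = ≤-trans (s≤s z≤n) x₀≤p

  -- The line x = K has at most two points, both on legs and hence of height K, so its peak is K.
  p≤K : p ≤ K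
  p≤K with reached K 1≤K ≤-refl
  ... | i , i≤ , p≤ = ≤-trans p≤ (short i (subst (i ≤_) length i≤))
    where
    length : N ∸ 2 * K ≡ e
    length = trans (cong (_∸ 2 * K) N≡) (m+n∸n≡m e (2 * K))
    short : ∀ i → i ≤ e → line K i ≤ K
    short i i≤e with m≤n⇒m<n∨m≡n i≤e
    ... | inj₂ refl = ≤-reflexive (trans (cong (line K) (sym length)) (line-end K 1≤K ≤-refl))
    ... | inj₁ i<e  = ≤-reflexive (trans (cong (line K) (n≤0⇒n≡0 (s≤s⁻¹ (≤-trans i<e e≤1)))) (line-start K 1≤K ≤-refl))

  q : ℕ
  q = K ∸ p

  p+q≡K : p + q ≡ K
  p+q≡K = m+[n∸m]≡n p≤K

  on-line : ∀ {σ x} → x ≤ σ → σ + x ≤ N → (σ ∸ x ≤ N ∸ 2 * x) × (F σ x ≡ line x (σ ∸ x))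
  on-line {σ} {x} x≤σ σ+x≤N =
    ((lin 5 λ x σ N a b → a ⊕ x ≈ σ ⇒ b ⊕ 2 ⊛ x ≈ N ⇒ σ ⊕ x ≼ N ⇒ ⊢ a ≼ b) x σ N _ _
       (m∸n+n≡m x≤σ) (m∸n+n≡m 2x≤) σ+x≤N) ,
    cong (λ s → F s x) (sym (m+[n∸m]≡n x≤σ))
    where
    2x≤ : 2 * x ≤ N
    2x≤ = (lin 3 λ x σ N → x ≼ σ ⇒ σ ⊕ x ≼ N ⇒ ⊢ 2 ⊛ x ≼ N) x σ N x≤σ σ+x≤N

  ≤S : ∀ {σ x} → x ≤ σ → σ + x ≤ N → x ≤ S σ
  ≤S {σ} {x} x≤σ σ+x≤N = ⊓-glb x≤σ (m+n≤o⇒m≤o∸n x (subst (_≤ N) (+-comm σ x) σ+x≤N))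

  S≤σ : ∀ σ → S σ ≤ σ
  S≤σ σ = m⊓n≤m σ (N ∸ σ)

  σ+S≤N : ∀ {σ} → σ ≤ N → σ + S σ ≤ N
  σ+S≤N {σ} σ≤N = ≤-trans (+-monoʳ-≤ σ (m⊓n≤n σ (N ∸ σ))) (≤-reflexive (m+[n∸m]≡n σ≤N))

  S≤K : ∀ {σ} → σ ≤ N → S σ ≤ K
  S≤K {σ} σ≤N = (lin 5 λ s σ N K e → s ≼ σ ⇒ σ ⊕ s ≼ N ⇒ N ≈ e ⊕ 2 ⊛ K ⇒ e ≼ # 1 ⇒ ⊢ s ≼ K)
    (S σ) σ N K e (S≤σ σ) (σ+S≤N σ≤N) N≡ e≤1

  leg : ∀ {σ} → σ ≤ N → 1 ≤ S σ → F σ (S σ) ≡ S σ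
  leg {σ} σ≤N 1≤S with ≤-total σ (N ∸ σ)
  ... | inj₁ le = subst (λ s → F σ s ≡ s) (sym S≡) (legˡ σ (subst (1 ≤_) S≡ 1≤S) (subst (_≤ K) S≡ (S≤K σ≤N)))
    where
    S≡ : S σ ≡ σ
    S≡ = m≤n⇒m⊓n≡m le
  ... | inj₂ ge = subst (λ s → F σ s ≡ s) (sym S≡)
                    (trans (cong (λ τ → F τ (N ∸ σ)) (sym (m∸[m∸n]≡n σ≤N)))
                           (legʳ (N ∸ σ) (subst (1 ≤_) S≡ 1≤S) (subst (_≤ K) S≡ (S≤K σ≤N))))
    where
    S≡ : S σ ≡ N ∸ σ
    S≡ = m≥n⇒m⊓n≡n ge

  -- From x₀ ≤ p ≤ S σ the antidiagonal σ crosses the line `x₀`, whose values are capped.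
  F-x₀≤p : ∀ {σ} → σ ≤ N → p ≤ S σ → F σ x₀ ≤ p
  F-x₀≤p {σ} σ≤N p≤S with on-line {σ} {x₀} (≤-trans x₀≤S (S≤σ σ)) (≤-trans (+-monoʳ-≤ σ x₀≤S) (σ+S≤N σ≤N))
    where
    x₀≤S : x₀ ≤ S σ
    x₀≤S = ≤-trans x₀≤p p≤S
  ... | i≤ , eq = ≤-trans (≤-reflexive eq) (capped _ i≤)

  W-bound : ∀ x → 1 ≤ x → x ≤ K → 2 * (p ∸ x) ≤ W x
  W-bound x 1≤x x≤K with reached x 1≤x x≤K
  ... | i , i≤ , p≤ with ≤-total p x
  ...   | inj₁ p≤x = subst (λ d → 2 * d ≤ W x) (sym (m≤n⇒m∸n≡0 p≤x)) z≤n
  ...   | inj₂ x≤p = (lin 7 λ p x d l a b w → p ≼ l ⇒ d ⊕ x ≈ p ⇒ a ≈ x ⇒ b ≈ x ⇒ 2 ⊛ l ≼ a ⊕ b ⊕ w ⇒ ⊢ 2 ⊛ d ≼ w)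
                       p x (p ∸ x) _ _ _ (W x) p≤ (m∸n+n≡m x≤p) (line-start x 1≤x x≤K) (line-end x 1≤x x≤K)
                       (tv-peak (line x) i≤)

  W-total : p * p ≤ ∑ K (λ y → W (suc y)) + p
  W-total = begin
    p * p                                 ≡⟨ ∑-descending p ⟨
    ∑ p (λ y → 2 * (p ∸ suc y)) + p       ≤⟨ +-monoˡ-≤ p (∑-prefix p K _ p≤K) ⟩
    ∑ K (λ y → 2 * (p ∸ suc y)) + p       ≤⟨ +-monoˡ-≤ p (∑-mono K (λ y y<K → W-bound (suc y) (s≤s z≤n) y<K)) ⟩
    ∑ K (λ y → W (suc y)) + p             ∎
    where open ≤-Reasoning

  V-zero : ∀ {σ x} → σ ≤ N → 1 ≤ x → x ≤ S σ → V σ ≤ 0 → F σ x ≡ S σ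
  V-zero {σ} {suc y} σ≤N 1≤x x≤S V≤0 =
    (lin 4 λ a b c v → a ≼ b ⊕ v ⇒ b ≼ a ⊕ v ⇒ v ≼ # 0 ⇒ b ≈ c ⇒ ⊢ a ≈ c)
      (F σ (suc y)) (F σ (suc (S σ ∸ 1))) (S σ) (V σ)
      (tv-suffix′ (λ y → F σ (suc y)) y≤) (tv-suffix (λ y → F σ (suc y)) y≤) V≤0
      (trans (cong (F σ) (m+[n∸m]≡n 1≤S)) (leg σ≤N 1≤S))
    where
    1≤S : 1 ≤ S σ
    1≤S = ≤-trans 1≤x x≤S
    y≤ : y ≤ S σ ∸ 1
    y≤ = ∸-monoˡ-≤ 1 x≤S

  module Tight (W-tight : ∀ x → 1 ≤ x → x ≤ K → W x ≤ 2 * (p ∸ x)) where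

    module _ {σ x} (1≤x : 1 ≤ x) (x≤σ : x ≤ σ) (σ+x≤N : σ + x ≤ N) where

      x≤K : x ≤ K
      x≤K = ≤-trans (≤S x≤σ σ+x≤N) (S≤K (≤-trans (m≤m+n σ x) σ+x≤N))

      -- The budget 2 (p ∸ x) is zero here, so the whole line stays at its leg value.
      at-outside : p ≤ x → F σ x ≡ x
      at-outside p≤x = (lin 6 λ f l x a b w →
          f ≈ l ⇒ a ≈ x ⇒ b ≈ x ⇒ 2 ⊛ l ≼ a ⊕ b ⊕ w ⇒ a ⊕ b ≼ 2 ⊛ l ⊕ w ⇒ w ≼ # 0 ⇒ ⊢ f ≈ x)
        _ _ x _ _ (W x) (proj₂ pos) (line-start x 1≤x x≤K) (line-end x 1≤x x≤K)
        (tv-peak (line x) (proj₁ pos)) (tv-pit (line x) (proj₁ pos))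
        (subst (λ d → W x ≤ 2 * d) (m≤n⇒m∸n≡0 p≤x) (W-tight x 1≤x x≤K))
        where
        pos = on-line x≤σ σ+x≤N

      at-most : x ≤ p → F σ x ≤ p
      at-most x≤p = (lin 8 λ f l x p d a b w →
          f ≈ l ⇒ a ≈ x ⇒ b ≈ x ⇒ 2 ⊛ l ≼ a ⊕ b ⊕ w ⇒ w ≼ 2 ⊛ d ⇒ d ⊕ x ≈ p ⇒ ⊢ f ≼ p)
        _ _ x p (p ∸ x) _ _ (W x) (proj₂ pos) (line-start x 1≤x x≤K) (line-end x 1≤x x≤K)
        (tv-peak (line x) (proj₁ pos)) (W-tight x 1≤x x≤K) (m∸n+n≡m x≤p)
        where
        pos = on-line x≤σ σ+x≤N

  -- The lattices differ only in how their antidiagonals are controlled. That part is isolated in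
  -- `corner` for antidiagonals of length at most `p` and in `above` for the longer ones.
  flat : (W-tight : ∀ x → 1 ≤ x → x ≤ K → W x ≤ 2 * (p ∸ x)) →
         (corner : ∀ {σ x} → 1 ≤ x → x ≤ S σ → σ ≤ N → S σ ≤ p → F σ x ≡ S σ) →
         (above : ∀ {σ x} → 1 ≤ x → x ≤ S σ → σ ≤ N → x ≤ p → p ≤ S σ → p ≤ F σ x) → Flat N p F
  flat W-tight corner above = record
    { outside = at-outside
    ; left    = λ {σ} {x} 1≤x x≤σ σ+x≤N σ≤p →
        let p≤K⇒σ≤N∸σ = ≤S {σ} {σ} ≤-refl
              ((lin 5 λ σ p K N e → σ ≼ p ⇒ p ≼ K ⇒ N ≈ e ⊕ 2 ⊛ K ⇒ ⊢ σ ⊕ σ ≼ N) σ p K N e σ≤p p≤K N≡)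
            S≡ = ≤-antisym (S≤σ σ) p≤K⇒σ≤N∸σ
        in trans (corner 1≤x (≤S x≤σ σ+x≤N) (≤-trans (m≤m+n σ x) σ+x≤N) (≤-trans (S≤σ σ) σ≤p)) S≡
    ; right   = λ {σ} {x} 1≤x x≤σ σ+x≤N N≤σ+p →
        let σ≤N = ≤-trans (m≤m+n σ x) σ+x≤N
            S≡ = m≥n⇒m⊓n≡n {σ} {N ∸ σ}
              ((lin 6 λ σ p K N e d → d ⊕ σ ≈ N ⇒ N ≼ σ ⊕ p ⇒ p ≼ K ⇒ N ≈ e ⊕ 2 ⊛ K ⇒ ⊢ d ≼ σ)
                 σ p K N e (N ∸ σ) (m∸n+n≡m σ≤N) N≤σ+p p≤K N≡)
            d≤p = (lin 4 λ σ p N d → d ⊕ σ ≈ N ⇒ N ≼ σ ⊕ p ⇒ ⊢ d ≼ p) σ p N (N ∸ σ) (m∸n+n≡m σ≤N) N≤σ+p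
        in trans (cong (_+ σ) (trans (corner 1≤x (≤S x≤σ σ+x≤N) σ≤N (subst (_≤ p) (sym S≡) d≤p)) S≡)) (m∸n+n≡m σ≤N)
    ; middle  = λ {σ} {x} 1≤x x≤σ σ+x≤N x≤p p≤σ σ+p≤N →
        ≤-antisym (at-most 1≤x x≤σ σ+x≤N x≤p)
                  (above 1≤x (≤S x≤σ σ+x≤N) (≤-trans (m≤m+n σ x) σ+x≤N) x≤p (≤S p≤σ σ+p≤N))
    }
    where open Tight W-tight

-- The odd and the even lattice

odd≤1 : ∀ n → odd n ≤ 1
odd≤1 0             = z≤n
odd≤1 1             = ≤-refl
odd≤1 (suc (suc n)) = odd≤1 n

odd-suc : ∀ n → odd n + odd (suc n) ≡ 1
odd-suc 0             = refl
odd-suc 1             = refl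
odd-suc (suc (suc n)) = odd-suc n

odd-2* : ∀ n → odd (2 * n) ≡ 0
odd-2* n = trans (cong odd (double n)) (odd-double n 0)
  where
  double : ∀ n → 2 * n ≡ n + n + 0
  double = solve-∀

-- Odd vertices above the main diagonal begin at x = 1, and N = 2K + 1 because their coordinate τ is
-- rounded up. This extra unit is what raises the tent sum from q² to q(q + 1).
module OddLattice (k : ℕ) (1≤K : 1 ≤ 2 * k) (F : ℕ → ℕ → ℕ)
                  (legˡ : ∀ x → 1 ≤ x → x ≤ 2 * k → F x x ≡ x)
                  (legʳ : ∀ x → 1 ≤ x → x ≤ 2 * k → F (1 + 2 * (2 * k) ∸ x) x ≡ x) where

  private
    K N : ℕ
    K = 2 * k
    N = 1 + 2 * K

  open Lines K N 1 1≤K refl ≤-refl F legˡ legʳ public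
  open Quadratic k p q p+q≡K

  -- Antidiagonals with σ ≤ 1 contain at most one vertex and cost nothing, so the second sum begins
  -- at σ = 2.
  cost : ℕ
  cost = ∑ K (λ y → W (suc y)) + ∑ (2 * K) (λ t → V (suc (suc t)))

  private
    V-bound : ∀ {σ} → σ ≤ N → S σ ∸ p ≤ V σ
    V-bound {σ} σ≤N with ≤-total (S σ) p
    ... | inj₁ S≤p = subst (_≤ V σ) (sym (m≤n⇒m∸n≡0 S≤p)) z≤n
    ... | inj₂ p≤S = (lin 6 λ f l s v p d → f ≼ p ⇒ l ≈ s ⇒ l ≼ f ⊕ v ⇒ d ⊕ p ≈ s ⇒ ⊢ d ≼ v)
        (F σ x₀) _ (S σ) (V σ) p (S σ ∸ p) (F-x₀≤p σ≤N p≤S)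
        (trans (cong (F σ) (m+[n∸m]≡n 1≤S)) (leg σ≤N 1≤S))
        (tv-suffix (λ y → F σ (suc y)) (∸-monoˡ-≤ 1 (≤-trans x₀≤p p≤S))) (m∸n+n≡m p≤S)
      where
      1≤S : 1 ≤ S σ
      1≤S = ≤-trans 1≤p p≤S

    tent : ∀ r → S (suc (p + r)) ∸ p ≡ suc r ⊓ (q + q ∸ r)
    tent r = trans (∸-distribʳ-⊓ p (suc (p + r)) (N ∸ suc (p + r))) (cong₂ _⊓_ left right)
      where
      left : suc (p + r) ∸ p ≡ suc r
      left = trans (cong (_∸ p) (sym (+-suc p r))) (m+n∸m≡n p (suc r))
      right : N ∸ suc (p + r) ∸ p ≡ q + q ∸ r
      right = begin
        2 * K ∸ (p + r) ∸ p                 ≡⟨ ∸-+-assoc (2 * K) (p + r) p ⟩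
        2 * K ∸ (p + r + p)                 ≡⟨ cong₂ _∸_ (trans (cong (2 *_) (sym p+q≡K)) (e₁ p q)) (e₂ p r) ⟩
        (p + p + (q + q)) ∸ (p + p + r)     ≡⟨ [m+n]∸[m+o]≡n∸o (p + p) (q + q) r ⟩
        q + q ∸ r                           ∎
        where
        open ≡-Reasoning
        e₁ : ∀ p q → 2 * (p + q) ≡ p + p + (q + q)
        e₁ = solve-∀
        e₂ : ∀ p r → p + r + p ≡ p + p + r
        e₂ = solve-∀

    -- Only the antidiagonals σ = p + 1 + r with r < 2q are longer than `p`. Since σ = t + 2, the
    -- window opens at t = p ∸ 1.
    V-window : q * suc q ≤ ∑ (2 * K) (λ t → S (suc (suc t)) ∸ p)
    V-window = begin
      q * suc q                                              ≡⟨ ∑-tentOdd q ⟨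
      ∑ (q + q) (λ r → suc r ⊓ (q + q ∸ r))                  ≡⟨ ∑-cong (q + q) (λ r _ → sym (shift r)) ⟩
      ∑ (q + q) (λ r → S (suc (suc (p ∸ 1 + r))) ∸ p)        ≤⟨ ∑-window (p ∸ 1) (q + q) (2 * K) _ fits ⟩
      ∑ (2 * K) (λ t → S (suc (suc t)) ∸ p)                  ∎
      where
      open ≤-Reasoning
      shift : ∀ r → S (suc (suc (p ∸ 1 + r))) ∸ p ≡ suc r ⊓ (q + q ∸ r)
      shift r = trans (cong (λ a → S (suc (a + r)) ∸ p) (m+[n∸m]≡n 1≤p)) (tent r)
      fits : p ∸ 1 + (q + q) ≤ 2 * K
      fits = (lin 4 λ a p q K → a ≼ p ⇒ p ⊕ q ≈ K ⇒ ⊢ a ⊕ (q ⊕ q) ≼ 2 ⊛ K) (p ∸ 1) p q K (m∸n≤m p 1) p+q≡K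

    V-mono : ∀ t → t < 2 * K → S (suc (suc t)) ∸ p ≤ V (suc (suc t))
    V-mono t t< = V-bound (s≤s t<)

    V-total : q * suc q ≤ ∑ (2 * K) (λ t → V (suc (suc t)))
    V-total = ≤-trans V-window (∑-mono (2 * K) V-mono)

  cost-bound : 2 * (k * k) ≤ cost
  cost-bound = (lin 6 λ a p b c w v → a ⊕ p ≼ b ⊕ c ⇒ b ≼ w ⊕ p ⇒ c ≼ v ⇒ ⊢ a ≼ w ⊕ v)
    (2 * (k * k)) p (p * p) (q * suc q) _ _ bound W-total V-total

  -- If the total is minimal, each of the inequalities composing `cost-bound` is an equality, and
  -- `∑-tight` makes every single line and antidiagonal minimal.
  cost-tight : cost ≤ 2 * (k * k) → Flat N p F × ((p ≡ k) ⊎ (p ≡ suc k))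
  cost-tight tight = flat W-tight corner above , equality
      ((lin 6 λ a p b c w v → w ⊕ v ≼ a ⇒ b ≼ w ⊕ p ⇒ c ≼ v ⇒ ⊢ b ⊕ c ≼ a ⊕ p)
         (2 * (k * k)) p (p * p) (q * suc q) _ _ tight W-total V-total)
    where
    W-tight : ∀ x → 1 ≤ x → x ≤ K → W x ≤ 2 * (p ∸ x)
    W-tight (suc y) _ x≤K = ∑-tight K (λ y y<K → W-bound (suc y) (s≤s z≤n) y<K)
      ((lin 7 λ a p b c w v f → a ⊕ p ≼ b ⊕ c ⇒ w ⊕ v ≼ a ⇒ b ≼ f ⊕ p ⇒ c ≼ v ⇒ ⊢ w ≼ f)
         (2 * (k * k)) p (p * p) (q * suc q) _ _ _ bound tight
         (≤-trans (≤-reflexive (sym (∑-descending p))) (+-monoˡ-≤ p (∑-prefix p K _ p≤K))) V-total) y x≤K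
    V-tight : ∀ t → t < 2 * K → V (suc (suc t)) ≤ S (suc (suc t)) ∸ p
    V-tight = ∑-tight (2 * K) V-mono
      ((lin 7 λ a p b c w v f → a ⊕ p ≼ b ⊕ c ⇒ w ⊕ v ≼ a ⇒ b ≼ w ⊕ p ⇒ c ≼ f ⇒ ⊢ v ≼ f)
         (2 * (k * k)) p (p * p) (q * suc q) _ _ _ bound tight W-total V-window)
    on-leg : ∀ {σ x} → 1 ≤ x → x ≤ S σ → σ ≤ 1 → F σ x ≡ S σ
    on-leg {σ} {x} 1≤x x≤S σ≤1 = trans (cong (F σ) x≡S) (leg (≤-trans σ≤1 (s≤s z≤n)) (≤-trans 1≤x x≤S))
      where
      x≡S : x ≡ S σ
      x≡S = (lin 3 λ x s σ → # 1 ≼ x ⇒ x ≼ s ⇒ s ≼ σ ⇒ σ ≼ # 1 ⇒ ⊢ x ≈ s) x (S σ) σ 1≤x x≤S (S≤σ σ) σ≤1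
    corner : ∀ {σ x} → 1 ≤ x → x ≤ S σ → σ ≤ N → S σ ≤ p → F σ x ≡ S σ
    corner {0}           1≤x x≤S σ≤N S≤p = on-leg 1≤x x≤S z≤n
    corner {1}           1≤x x≤S σ≤N S≤p = on-leg 1≤x x≤S ≤-refl
    corner {suc (suc t)} 1≤x x≤S σ≤N S≤p =
      V-zero σ≤N 1≤x x≤S (subst (V (suc (suc t)) ≤_) (m≤n⇒m∸n≡0 S≤p) (V-tight t (s≤s⁻¹ σ≤N)))
    -- The variation of a minimal antidiagonal is S σ ∸ p, just enough to come down from its leg
    -- value S σ to `p`.
    above : ∀ {σ x} → 1 ≤ x → x ≤ S σ → σ ≤ N → x ≤ p → p ≤ S σ → p ≤ F σ x
    above {0} 1≤x x≤S σ≤N x≤p p≤S = ≤-trans p≤S (≤-reflexive (sym (on-leg 1≤x x≤S z≤n)))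
    above {1} 1≤x x≤S σ≤N x≤p p≤S = ≤-trans p≤S (≤-reflexive (sym (on-leg 1≤x x≤S ≤-refl)))
    above {suc (suc t)} {suc y} 1≤x x≤S σ≤N x≤p p≤S =
      (lin 6 λ f l s v p d → l ≈ s ⇒ l ≼ f ⊕ v ⇒ v ≼ d ⇒ d ⊕ p ≈ s ⇒ ⊢ p ≼ f)
        (F σ (suc y)) _ (S σ) (V σ) p (S σ ∸ p)
        (trans (cong (F σ) (m+[n∸m]≡n 1≤S)) (leg σ≤N 1≤S))
        (tv-suffix (λ y → F σ (suc y)) (∸-monoˡ-≤ 1 x≤S)) (V-tight t (s≤s⁻¹ σ≤N)) (m∸n+n≡m p≤S)
      where
      σ = suc (suc t)
      1≤S : 1 ≤ S σ
      1≤S = ≤-trans 1≤x x≤S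

-- The hypothesis `parity` carries the zero main diagonal of the matrix into the lattice: a diagonal
-- vertex with σ + p odd cannot have value `p`.
module EvenLattice (k : ℕ) (1≤K : 1 ≤ 2 * k) (F : ℕ → ℕ → ℕ)
                   (legˡ : ∀ x → 1 ≤ x → x ≤ 2 * k → F x x ≡ x)
                   (legʳ : ∀ x → 1 ≤ x → x ≤ 2 * k → F (2 * (2 * k) ∸ x) x ≡ x)
                   (parity : ∀ σ → σ ≤ 2 * (2 * k) → ∃ λ T → F σ 0 + 2 * T ≡ σ) where

  private
    K N : ℕ
    K = 2 * k
    N = 2 * K

  open Lines K N 0 1≤K refl z≤n F legˡ legʳ public
  open Quadratic k p q p+q≡K

  U : ℕ → ℕ
  U σ = tv (F σ) (S σ)

  cost : ℕ
  cost = ∑ K (λ y → W (suc y)) + ∑ (2 * K) (λ t → U (suc t))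

  private
    -- The last factor is the indicator of p ≤ S σ.
    jump : ℕ → ℕ
    jump σ = odd (σ + p) * (1 ⊓ (suc (S σ) ∸ p))

    jump-inside : ∀ {σ} → p ≤ S σ → jump σ ≡ odd (σ + p)
    jump-inside {σ} p≤S = trans (cong (odd (σ + p) *_) (m≤n⇒m⊓n≡m (m+n≤o⇒m≤o∸n 1 (s≤s p≤S)))) (*-identityʳ _)

    jump-outside : ∀ {σ} → S σ < p → jump σ ≡ 0
    jump-outside {σ} S<p = trans (cong (λ d → odd (σ + p) * (1 ⊓ d)) (m≤n⇒m∸n≡0 S<p)) (*-zeroʳ (odd (σ + p)))

    F₀≢p : ∀ {σ} → σ ≤ N → odd (σ + p) ≡ 1 → ¬ F σ 0 ≡ p
    F₀≢p {σ} σ≤N o≡1 F≡p with parity σ σ≤N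
    ... | T , eq with trans (sym o≡1) (trans (cong odd ((lin 4 λ f p σ T → f ⊕ 2 ⊛ T ≈ σ ⇒ f ≈ p ⇒ ⊢ σ ⊕ p ≈ 2 ⊛ (p ⊕ T))
                                         (F σ 0) p σ T eq F≡p)) (odd-2* (p + T)))
    ...   | ()

    jump≤distance : ∀ {σ} → σ ≤ N → odd (σ + p) ≤ ∣ F σ 0 - p ∣
    jump≤distance {σ} σ≤N with odd (σ + p) in eq | odd≤1 (σ + p)
    ... | 0 | _ = z≤n
    ... | 1 | _ = n≢0⇒n>0 (λ z → F₀≢p σ≤N eq (∣m-n∣≡0⇒m≡n z))
    ... | suc (suc _) | s≤s ()

    -- A diagonal value below `p` lengthens the climb to the leg. From a value above `p` the
    -- antidiagonal first descends to the line `x₀` and then climbs. Either way the distance to `p`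
    -- is paid on top of S σ - p.
    U-diagonal : ∀ {σ} → σ ≤ N → p ≤ S σ → S σ + ∣ F σ 0 - p ∣ ≤ p + U σ
    U-diagonal {σ} σ≤N p≤S with ≤-total (F σ 0) p
    ... | inj₁ F≤p rewrite m≤n⇒∣m-n∣≡n∸m F≤p =
      (lin 6 λ f l s u p d → l ≈ s ⇒ l ≼ f ⊕ u ⇒ d ⊕ f ≈ p ⇒ ⊢ s ⊕ d ≼ p ⊕ u)
        (F σ 0) _ (S σ) (U σ) p (p ∸ F σ 0) (leg σ≤N (≤-trans 1≤p p≤S)) (proj₁ (tv-ends (F σ) (S σ))) (m∸n+n≡m F≤p)
    ... | inj₂ p≤F rewrite m≤n⇒∣n-m∣≡n∸m p≤F =
      (lin 7 λ f l s u p d g → l ≈ s ⇒ f ⊕ l ≼ 2 ⊛ g ⊕ u ⇒ d ⊕ p ≈ f ⇒ g ≼ p ⇒ ⊢ s ⊕ d ≼ p ⊕ u)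
        (F σ 0) _ (S σ) (U σ) p (F σ 0 ∸ p) (F σ x₀) (leg σ≤N (≤-trans 1≤p p≤S))
        (tv-pit (F σ) (≤-trans x₀≤p p≤S)) (m∸n+n≡m p≤F) (F-x₀≤p σ≤N p≤S)

    U-bound : ∀ {σ} → σ ≤ N → (S σ ∸ p) + jump σ ≤ U σ
    U-bound {σ} σ≤N with ≤-<-connex p (S σ)
    ... | inj₂ S<p = subst (_≤ U σ) (sym (cong₂ _+_ (m≤n⇒m∸n≡0 (<⇒≤ S<p)) (jump-outside {σ} S<p))) z≤n
    ... | inj₁ p≤S = (lin 7 λ s d j o a p u → d ⊕ p ≈ s ⇒ j ≈ o ⇒ o ≼ a ⇒ s ⊕ a ≼ p ⊕ u ⇒ ⊢ d ⊕ j ≼ u)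
        (S σ) (S σ ∸ p) (jump σ) (odd (σ + p)) _ p (U σ) (m∸n+n≡m p≤S) (jump-inside {σ} p≤S)
        (jump≤distance σ≤N) (U-diagonal σ≤N p≤S)

    2K≡ : 2 * K ≡ p + p + (q + q)
    2K≡ = (lin 3 λ p q K → p ⊕ q ≈ K ⇒ ⊢ 2 ⊛ K ≈ p ⊕ p ⊕ (q ⊕ q)) p q K p+q≡K

    tent : ∀ r → r < q + q → (S (suc (p + r)) ∸ p) + jump (suc (p + r)) ≡ suc r ⊓ (q + q ∸ suc r) + odd (suc r)
    tent r r< = cong₂ _+_
      (trans (∸-distribʳ-⊓ p (suc (p + r)) (N ∸ suc (p + r))) (cong₂ _⊓_ left right))
      (trans (jump-inside {suc (p + r)} p≤S) (trans (cong odd (e₂ p r)) (odd-double p (suc r))))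
      where
      left : suc (p + r) ∸ p ≡ suc r
      left = trans (cong (_∸ p) (sym (+-suc p r))) (m+n∸m≡n p (suc r))
      e₂ : ∀ p r → suc (p + r) + p ≡ p + p + suc r
      e₂ = solve-∀
      right : N ∸ suc (p + r) ∸ p ≡ q + q ∸ suc r
      right = begin
        2 * K ∸ suc (p + r) ∸ p             ≡⟨ ∸-+-assoc (2 * K) (suc (p + r)) p ⟩
        2 * K ∸ (suc (p + r) + p)           ≡⟨ cong₂ _∸_ 2K≡ (e₂ p r) ⟩
        (p + p + (q + q)) ∸ (p + p + suc r) ≡⟨ [m+n]∸[m+o]≡n∸o (p + p) (q + q) (suc r) ⟩
        q + q ∸ suc r                       ∎
        where open ≡-Reasoning
      p≤S : p ≤ S (suc (p + r))
      p≤S = ≤S {suc (p + r)} {p} (m≤n⇒m≤1+n (m≤m+n p r))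
        ((lin 4 λ p q r N → N ≈ p ⊕ p ⊕ (q ⊕ q) ⇒ r ≺ q ⊕ q ⇒ ⊢ 1+ (p ⊕ r) ⊕ p ≼ N) p q r N 2K≡ r<)

    -- With N = 2K the tent sums to q² only. Among the 2q antidiagonals of the window q have σ + p
    -- odd, and their jumps restore q(q + 1).
    U-window : q * suc q ≤ ∑ (2 * K) (λ t → (S (suc t) ∸ p) + jump (suc t))
    U-window = begin
      q * suc q
        ≡⟨ trans (*-suc q q) (+-comm q (q * q)) ⟩
      q * q + q
        ≡⟨ cong₂ _+_ (sym (∑-tentEven q)) (sym (∑-odd q)) ⟩
      ∑ (q + q) (λ r → suc r ⊓ (q + q ∸ suc r)) + ∑ (q + q) (λ r → odd (suc r))
        ≡⟨ ∑-+ (q + q) _ _ ⟨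
      ∑ (q + q) (λ r → suc r ⊓ (q + q ∸ suc r) + odd (suc r))
        ≡⟨ ∑-cong (q + q) (λ r r< → sym (tent r r<)) ⟩
      ∑ (q + q) (λ r → (S (suc (p + r)) ∸ p) + jump (suc (p + r)))
        ≤⟨ ∑-window p (q + q) (2 * K) _ fits ⟩
      ∑ (2 * K) (λ t → (S (suc t) ∸ p) + jump (suc t)) ∎
      where
      open ≤-Reasoning
      fits : p + (q + q) ≤ 2 * K
      fits = (lin 3 λ p q K → p ⊕ q ≈ K ⇒ ⊢ p ⊕ (q ⊕ q) ≼ 2 ⊛ K) p q K p+q≡K

    U-mono : ∀ t → t < 2 * K → (S (suc t) ∸ p) + jump (suc t) ≤ U (suc t)
    U-mono t t< = U-bound t<

    U-total : q * suc q ≤ ∑ (2 * K) (λ t → U (suc t))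
    U-total = ≤-trans U-window (∑-mono (2 * K) U-mono)

  cost-bound : 2 * (k * k) ≤ cost
  cost-bound = (lin 6 λ a p b c w v → a ⊕ p ≼ b ⊕ c ⇒ b ≼ w ⊕ p ⇒ c ≼ v ⇒ ⊢ a ≼ w ⊕ v)
    (2 * (k * k)) p (p * p) (q * suc q) _ _ bound W-total U-total

  cost-tight : cost ≤ 2 * (k * k) → Flat N p F × ((p ≡ k) ⊎ (p ≡ suc k))
  cost-tight tight = flat W-tight corner above , equality
      ((lin 6 λ a p b c w v → w ⊕ v ≼ a ⇒ b ≼ w ⊕ p ⇒ c ≼ v ⇒ ⊢ b ⊕ c ≼ a ⊕ p)
         (2 * (k * k)) p (p * p) (q * suc q) _ _ tight W-total U-total)
    where
    W-tight : ∀ x → 1 ≤ x → x ≤ K → W x ≤ 2 * (p ∸ x)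
    W-tight (suc y) _ x≤K = ∑-tight K (λ y y<K → W-bound (suc y) (s≤s z≤n) y<K)
      ((lin 7 λ a p b c w v f → a ⊕ p ≼ b ⊕ c ⇒ w ⊕ v ≼ a ⇒ b ≼ f ⊕ p ⇒ c ≼ v ⇒ ⊢ w ≼ f)
         (2 * (k * k)) p (p * p) (q * suc q) _ _ _ bound tight
         (≤-trans (≤-reflexive (sym (∑-descending p))) (+-monoˡ-≤ p (∑-prefix p K _ p≤K))) U-total) y x≤K
    U-tight : ∀ {σ} → 1 ≤ σ → σ ≤ N → U σ ≤ (S σ ∸ p) + jump σ
    U-tight {suc t} _ σ≤N = ∑-tight (2 * K) U-mono
      ((lin 7 λ a p b c w v f → a ⊕ p ≼ b ⊕ c ⇒ w ⊕ v ≼ a ⇒ b ≼ w ⊕ p ⇒ c ≼ f ⇒ ⊢ v ≼ f)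
         (2 * (k * k)) p (p * p) (q * suc q) _ _ _ bound tight W-total U-window) t σ≤N

    -- The delicate case is S σ = p. Then σ = p or σ = N - p, so σ + p is even, the jump vanishes,
    -- and the antidiagonal has no variation.
    corner : ∀ {σ x} → 1 ≤ x → x ≤ S σ → σ ≤ N → S σ ≤ p → F σ x ≡ S σ
    corner {σ} {x} 1≤x x≤S σ≤N S≤p with m≤n⇒m<n∨m≡n S≤p
    ... | inj₁ S<p = (lin 5 λ f l s u j → l ≈ s ⇒ l ≼ f ⊕ u ⇒ f ≼ l ⊕ u ⇒ u ≼ j ⇒ j ≈ # 0 ⇒ ⊢ f ≈ s)
        (F σ x) (F σ (S σ)) (S σ) (U σ) _ (leg σ≤N (≤-trans 1≤x x≤S))
        (tv-suffix (F σ) x≤S) (tv-suffix′ (F σ) x≤S) (U-tight (≤-trans (≤-trans 1≤x x≤S) (S≤σ σ)) σ≤N)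
        (cong₂ _+_ (m≤n⇒m∸n≡0 S≤p) (jump-outside {σ} S<p))
    ... | inj₂ S≡p with σ≡p∨ (≤-total σ (N ∸ σ))
      where
      σ≡p∨ : (σ ≤ N ∸ σ) ⊎ (N ∸ σ ≤ σ) → odd (σ + p) ≡ 0
      σ≡p∨ (inj₁ le) = trans (cong odd ((lin 3 λ σ p s → s ≈ p ⇒ s ≈ σ ⇒ ⊢ σ ⊕ p ≈ 2 ⊛ p) σ p (S σ) S≡p (m≤n⇒m⊓n≡m le)))
                             (odd-2* p)
      σ≡p∨ (inj₂ ge) = trans (cong odd ((lin 5 λ σ p s N d → s ≈ p ⇒ s ≈ d ⇒ d ⊕ σ ≈ N ⇒ ⊢ σ ⊕ p ≈ N)
                                          σ p (S σ) N (N ∸ σ) S≡p (m≥n⇒m⊓n≡n ge) (m∸n+n≡m σ≤N))) (odd-2* K)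
    ...   | o≡0 = (lin 5 λ f l s u j → l ≈ s ⇒ l ≼ f ⊕ u ⇒ f ≼ l ⊕ u ⇒ u ≼ j ⇒ j ≈ # 0 ⇒ ⊢ f ≈ s)
        (F σ x) (F σ (S σ)) (S σ) (U σ) _ (leg σ≤N (≤-trans 1≤x x≤S))
        (tv-suffix (F σ) x≤S) (tv-suffix′ (F σ) x≤S) (U-tight (≤-trans (≤-trans 1≤x x≤S) (S≤σ σ)) σ≤N)
        (cong₂ _+_ (m≤n⇒m∸n≡0 S≤p) (trans (jump-inside {σ} (≤-reflexive (sym S≡p))) o≡0))

    distance : ∀ {σ} → σ ≤ N → p ≤ S σ → ∣ F σ 0 - p ∣ ≤ odd (σ + p)
    distance {σ} σ≤N p≤S = (lin 7 λ s d j o a p u → d ⊕ p ≈ s ⇒ j ≈ o ⇒ s ⊕ a ≼ p ⊕ u ⇒ u ≼ d ⊕ j ⇒ ⊢ a ≼ o)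
      (S σ) (S σ ∸ p) (jump σ) (odd (σ + p)) _ p (U σ) (m∸n+n≡m p≤S) (jump-inside {σ} p≤S)
      (U-diagonal σ≤N p≤S) (U-tight (≤-trans (≤-trans 1≤p p≤S) (S≤σ σ)) σ≤N)

    -- When the start is this high, the minimal variation covers only the descent to `p` and the
    -- climb to the leg.
    above-high : ∀ {σ x} → x ≤ S σ → σ ≤ N → p ≤ S σ → odd (σ + p) + p ≤ F σ 0 → p ≤ F σ x
    above-high {σ} {x} x≤S σ≤N p≤S high =
      (lin 9 λ f l s u j p d g o → l ≈ s ⇒ f ⊕ l ≼ 2 ⊛ g ⊕ u ⇒ u ≼ d ⊕ j ⇒ j ≈ o ⇒ d ⊕ p ≈ s ⇒ o ⊕ p ≼ f ⇒ ⊢ p ≼ g)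
        (F σ 0) (F σ (S σ)) (S σ) (U σ) (jump σ) p (S σ ∸ p) (F σ x) (odd (σ + p))
        (leg σ≤N 1≤S) (tv-pit (F σ) x≤S) (U-tight (≤-trans 1≤S (S≤σ σ)) σ≤N)
        (jump-inside {σ} p≤S) (m∸n+n≡m p≤S) high
      where
      1≤S : 1 ≤ S σ
      1≤S = ≤-trans 1≤p p≤S

    above-even : ∀ {σ x} → x ≤ S σ → σ ≤ N → p ≤ S σ → odd (σ + p) ≡ 0 → p ≤ F σ x
    above-even {σ} {x} x≤S σ≤N p≤S o≡0 = above-high x≤S σ≤N p≤S
      (≤-reflexive (trans (cong (_+ p) o≡0) (sym (∣m-n∣≡0⇒m≡n (n≤0⇒n≡0 (≤-trans (distance σ≤N p≤S) (≤-reflexive o≡0)))))))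

    -- If F σ 0 lies below `p`, the antidiagonal alone could stay at p - 1 for x ≥ 1 as well. The
    -- neighbours σ - 1 and σ + 1, where the parity is even, exclude that.
    above : ∀ {σ x} → 1 ≤ x → x ≤ S σ → σ ≤ N → x ≤ p → p ≤ S σ → p ≤ F σ x
    above {σ} {x} 1≤x x≤S σ≤N x≤p p≤S with odd (σ + p) in o | odd≤1 (σ + p)
    ... | suc (suc _) | s≤s ()
    ... | 0 | _ = above-even x≤S σ≤N p≤S o
    ... | 1 | _ with <-≤-connex p (F σ 0)
    ...   | inj₁ p<F = above-high x≤S σ≤N p≤S (subst (λ z → z + p ≤ F σ 0) (sym o) p<F)
    ...   | inj₂ F≤p = between σ o p<σ σ≤N σ+p<N
      where
      -- Parity rules out σ = p and σ + p = N, so both neighbouring antidiagonals still have length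
      -- at least `p`.
      p<σ : p < σ
      p<σ = ≤∧≢⇒< (≤-trans p≤S (S≤σ σ))
          (λ { refl → case (trans (sym o) (trans (cong odd ((lin 1 λ p → ⊢ p ⊕ p ≈ 2 ⊛ p) p)) (odd-2* p))) })
        where
        case : ¬ 1 ≡ 0
        case ()
      σ+p<N : σ + p < N
      σ+p<N = ≤∧≢⇒< (≤-trans (+-monoʳ-≤ σ p≤S) (σ+S≤N σ≤N)) (λ e → case (trans (sym o) (trans (cong odd e) (odd-2* K))))
        where
        case : ¬ 1 ≡ 0
        case ()
      -- The line through (σ , x) returns to height p on both sides of σ, so a dip at σ would cost too much.
      between : ∀ σ → odd (σ + p) ≡ 1 → p < σ → σ ≤ N → σ + p < N → p ≤ F σ x
      between (suc σ⁻) o p<σ σ≤N σ+p<N =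
        (lin 9 λ a b c d l r w x p → p ≼ a ⇒ p ≼ c ⇒ l ≈ x ⇒ r ≈ x ⇒ w ≼ 2 ⊛ d ⇒ d ⊕ x ≈ p ⇒
            2 ⊛ a ⊕ 2 ⊛ c ≼ l ⊕ r ⊕ 2 ⊛ b ⊕ w ⇒ ⊢ p ≼ b)
          (line x i) (F (suc σ⁻) x) (line x (suc (suc i))) (p ∸ x) _ _ (W x) x p
          (subst (p ≤_) (eqn σ⁻ (sym i≡)) left)
          (subst (p ≤_) (eqn (suc (suc σ⁻)) (sym (trans (+-suc x (suc i)) (cong suc (trans (+-suc x i) (cong suc i≡)))))) right)
          (line-start x 1≤x x≤K) (line-end x 1≤x x≤K) (W-tight x 1≤x x≤K) (m∸n+n≡m x≤p)
          (subst (λ f → 2 * line x i + 2 * line x (suc (suc i)) ≤ line x 0 + line x (N ∸ 2 * x) + 2 * f + W x)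
                 (sym (eqn (suc σ⁻) (sym (trans (+-suc x i) (cong suc i≡)))))
                 (tv-dip (line x) (n≤1+n i) (n≤1+n (suc i)) fits))
        where
        x≤K : x ≤ K
        x≤K = ≤-trans x≤p p≤K
        i : ℕ
        i = σ⁻ ∸ x
        i≡ : x + i ≡ σ⁻
        i≡ = m+[n∸m]≡n (≤-trans x≤p (s≤s⁻¹ p<σ))
        eqn : ∀ σ {τ} → σ ≡ τ → F σ x ≡ F τ x
        eqn σ refl = refl
        fits : suc (suc i) ≤ N ∸ 2 * x
        fits = m+n≤o⇒m≤o∸n (suc (suc i))
          ((lin 5 λ x i s p N → x ⊕ i ≈ s ⇒ x ≼ p ⇒ 1+ s ⊕ p ≺ N ⇒ ⊢ # 2 ⊕ i ⊕ 2 ⊛ x ≼ N) x i σ⁻ p N i≡ x≤p σ+p<N)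
        p≤S⁻ : p ≤ S σ⁻
        p≤S⁻ = ≤S (s≤s⁻¹ p<σ) ((lin 3 λ s p N → 1+ s ⊕ p ≺ N ⇒ ⊢ s ⊕ p ≼ N) σ⁻ p N σ+p<N)
        p≤S⁺ : p ≤ S (suc (suc σ⁻))
        p≤S⁺ = ≤S (≤-trans (<⇒≤ p<σ) (n≤1+n _)) σ+p<N
        left : p ≤ F σ⁻ x
        left = above-even (≤-trans x≤p p≤S⁻) (≤-trans (n≤1+n _) σ≤N) p≤S⁻
          ((lin 2 λ a b → a ⊕ b ≈ # 1 ⇒ b ≈ # 1 ⇒ ⊢ a ≈ # 0) _ _ (odd-suc (σ⁻ + p)) o)
        right : p ≤ F (suc (suc σ⁻)) x
        right = above-even (≤-trans x≤p p≤S⁺) (≤-trans (m≤m+n _ p) σ+p<N) p≤S⁺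
          ((lin 2 λ a b → a ⊕ b ≈ # 1 ⇒ b ≈ # 1 ⇒ ⊢ a ≈ # 0) _ _ (odd-suc (σ⁻ + p)) o)

-- Counting cells above the main diagonal

lt : ℕ → ℕ → ℕ
lt i j = 1 ⊓ (j ∸ i)

lt-yes : ∀ {i j} → i < j → lt i j ≡ 1
lt-yes i<j = m≤n⇒m⊓n≡m (m<n⇒0<n∸m i<j)

lt-no : ∀ {i j} → j ≤ i → lt i j ≡ 0
lt-no j≤i = cong (1 ⊓_) (m≤n⇒m∸n≡0 j≤i)

-- A value a of F has the form s - c with a corner sum c. Adding c + c′ to both terms turns a
-- difference of F into one of corner sums without subtraction.
∣-∣-shift : ∀ {a a′ c c′ s s′} → a + c ≡ s → a′ + c′ ≡ s′ → ∣ a′ - a ∣ ≡ ∣ s′ + c - s + c′ ∣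
∣-∣-shift {a} {a′} {c} {c′} refl refl = begin
  ∣ a′ - a ∣                           ≡⟨ ∣m+n-m+o∣≡∣n-o∣ (c + c′) a′ a ⟨
  ∣ c + c′ + a′ - c + c′ + a ∣         ≡⟨ cong₂ ∣_-_∣ (e₁ c c′ a′) (e₂ c c′ a) ⟩
  ∣ a′ + c′ + c - a + c + c′ ∣         ∎
  where
  open ≡-Reasoning
  e₁ : ∀ c c′ a → c + c′ + a ≡ a + c′ + c
  e₁ = solve-∀
  e₂ : ∀ c c′ a → c + c′ + a ≡ a + c + c′
  e₂ = solve-∀

-- A cell (i , j) with i < j is indexed by i and y, where j − i − 1 is 2y (j₀) or 2y + 1 (j₁).

module CellSums (n : ℕ) where

  j₀ j₁ : ℕ → ℕ → ℕ
  j₀ i y = suc i + (y + y)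
  j₁ i y = suc i + suc (y + y)

  cell : (ℕ → ℕ → ℕ) → ℕ → ℕ → ℕ
  cell f i j = lt j n * f i j

  cell-inside : ∀ f {i j} → j < n → cell f i j ≡ f i j
  cell-inside f {i} {j} j<n = trans (cong (_* f i j) (lt-yes j<n)) (+-identityʳ _)

  total above : (ℕ → ℕ → ℕ) → ℕ
  total f = ∑ n (λ i → ∑ n (f i))
  above f = ∑ n (λ i → ∑ n (λ j → lt i j * f i j))

  part : (ℕ → ℕ → ℕ) → (ℕ → ℕ → ℕ) → ℕ
  part f j = ∑ n (λ i → ∑ n (λ y → cell f i (j i y)))

  -- The factor `1 ∸ ∣ i - j ∣` is the Kronecker delta, so the three summands live on the diagonal,
  -- above it and below it. The zeros are counted with d = 1, the nonzero entries with d = 0.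
  total-above : ∀ f d → (∀ {i j} → i < n → j < n → f i j ≡ f j i) → (∀ {i} → i < n → d ≤ f i i) →
                n * d + 2 * above f ≤ total f
  total-above f d f-sym diag = begin
    n * d + 2 * above f
      ≡⟨ cong₂ (λ a b → a + (above f + b)) (sym (∑-const n d)) (+-identityʳ (above f)) ⟩
    ∑ n (λ _ → d) + (above f + above f)
      ≤⟨ +-mono-≤ (∑-mono n (λ i i<n → ≤-trans
          (≤-reflexive (sym (trans (cong (λ e → d * (1 ∸ e)) (trans (cong (∣_-_∣ i) (+-identityʳ i)) (∣n-n∣≡0 i)))
            (*-identityʳ d))))
           (∑-window i 1 n (λ j → d * (1 ∸ ∣ i - j ∣)) (subst (_≤ n) (+-comm 1 i) i<n))))
             (+-monoʳ-≤ (above f) (≤-reflexive (∑-swap n n _))) ⟩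
    ∑ n (λ i → ∑ n (λ j → d * (1 ∸ ∣ i - j ∣))) + (above f + ∑ n (λ i → ∑ n (λ j → lt j i * f j i)))
      ≡⟨ cong (∑ n (λ i → ∑ n (λ j → d * (1 ∸ ∣ i - j ∣))) +_) (sym (∑-+ n _ _)) ⟩
    ∑ n (λ i → ∑ n (λ j → d * (1 ∸ ∣ i - j ∣))) + ∑ n (λ i → ∑ n (λ j → lt i j * f i j) + ∑ n (λ j → lt j i * f j i))
      ≡⟨ ∑-+ n _ _ ⟨
    ∑ n (λ i → ∑ n (λ j → d * (1 ∸ ∣ i - j ∣)) + (∑ n (λ j → lt i j * f i j) + ∑ n (λ j → lt j i * f j i)))
      ≡⟨ ∑-cong n (λ i _ → trans (cong (∑ n (λ j → d * (1 ∸ ∣ i - j ∣)) +_) (sym (∑-+ n _ _))) (sym (∑-+ n _ _))) ⟩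
    ∑ n (λ i → ∑ n (λ j → d * (1 ∸ ∣ i - j ∣) + (lt i j * f i j + lt j i * f j i)))
      ≤⟨ ∑-mono n (λ i i<n → ∑-mono n (λ j j<n → pointwise i j i<n j<n)) ⟩
    total f ∎
    where
    open ≤-Reasoning
    pointwise : ∀ i j → i < n → j < n → d * (1 ∸ ∣ i - j ∣) + (lt i j * f i j + lt j i * f j i) ≤ f i j
    pointwise i j i<n j<n with <-cmp i j
    ... | tri< i<j _ _ rewrite lt-yes i<j | lt-no (<⇒≤ i<j) | m≤n⇒∣m-n∣≡n∸m (<⇒≤ i<j)
                     | m≤n⇒m∸n≡0 (m<n⇒0<n∸m i<j) | *-zeroʳ d = ≤-reflexive (trans (+-identityʳ _) (+-identityʳ _))
    ... | tri≈ _ refl _ rewrite ∣n-n∣≡0 i | lt-no (≤-refl {i}) = ≤-trans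
        (≤-reflexive (trans (+-identityʳ (d * 1)) (*-identityʳ d))) (diag i<n)
    ... | tri> _ _ j<i rewrite lt-yes j<i | lt-no (<⇒≤ j<i) | m≤n⇒∣n-m∣≡n∸m (<⇒≤ j<i)
                     | m≤n⇒m∸n≡0 (m<n⇒0<n∸m j<i) | *-zeroʳ d = ≤-reflexive (trans (+-identityʳ _) (f-sym j<n i<n))

  -- The parity of j - i - 1 splits the row. The index y may run past the matrix because `cell`
  -- vanishes there.
  row-split : ∀ g i → ∑ n (λ y → cell g i (j₀ i y) + cell g i (j₁ i y)) ≤ ∑ n (λ j → lt i j * g i j)
  row-split g i = begin
    ∑ n (λ y → cell g i (j₀ i y) + cell g i (j₁ i y))
      ≡⟨ ∑-evenOdd n (λ e → cell g i (suc i + e)) ⟨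
    ∑ (n + n) (λ e → cell g i (suc i + e))
      ≡⟨ ∑-cong (n + n) (λ e _ → cong (lt (suc i + e) n *_)
           (sym (trans (cong (_* g i (suc i + e)) (lt-yes (m≤m+n (suc i) e))) (+-identityʳ _)))) ⟩
    ∑ (n + n) (λ e → f (suc i + e))
      ≤⟨ ∑-window (suc i) (n + n) (n + (suc i + (n + n))) f (m≤n+m _ n) ⟩
    ∑ (n + (suc i + (n + n))) f
      ≡⟨ ∑-split n _ f ⟩
    ∑ n f + ∑ (suc i + (n + n)) (λ e → f (n + e))
      ≡⟨ cong₂ _+_ (∑-cong n (λ j j<n → trans (cong (_* (lt i j * g i j)) (lt-yes j<n)) (+-identityʳ _)))
           (∑-zero _ (λ e _ → cong (_* (lt i (n + e) * g i (n + e))) (lt-no (m≤m+n n e)))) ⟩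
    ∑ n (λ j → lt i j * g i j) + 0
      ≡⟨ +-identityʳ _ ⟩
    ∑ n (λ j → lt i j * g i j) ∎
    where
    open ≤-Reasoning
    f : ℕ → ℕ
    f j = lt j n * (lt i j * g i j)

  above-split : ∀ f → part f j₀ + part f j₁ ≤ above f
  above-split f = begin
    part f j₀ + part f j₁
      ≡⟨ ∑-+ n _ _ ⟨
    ∑ n (λ i → ∑ n (λ y → cell f i (j₀ i y)) + ∑ n (λ y → cell f i (j₁ i y)))
      ≡⟨ ∑-cong n (λ i _ → ∑-+ n _ _) ⟨
    ∑ n (λ i → ∑ n (λ y → cell f i (j₀ i y) + cell f i (j₁ i y)))
      ≤⟨ ∑-mono n (λ i _ → row-split f i) ⟩
    above f ∎
    where open ≤-Reasoning

  part-+ : ∀ f g j → part (λ i j → f i j + g i j) j ≡ part f j + part g j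
  part-+ f g j = trans (∑-cong n (λ i _ → trans (∑-cong n (λ y _ → *-distribˡ-+ (lt (j i y) n) _ _)) (∑-+ n _ _))) (∑-+ n _ _)

  part-lines : ∀ f j {K} {w : ℕ → ℕ} → K ≤ n → (∀ y → y < K → w y ≤ ∑ n (λ i → cell f i (j i y))) → ∑ K w ≤ part f j
  part-lines f j {K} {w} K≤n w≤ = begin
    ∑ K w                                     ≤⟨ ∑-mono K w≤ ⟩
    ∑ K (λ y → ∑ n (λ i → cell f i (j i y)))  ≤⟨ ∑-prefix K n _ K≤n ⟩
    ∑ n (λ y → ∑ n (λ i → cell f i (j i y)))  ≡⟨ ∑-swap n n _ ⟩
    part f j                                  ∎
    where open ≤-Reasoning

  -- With i = t - y the sum i + j depends on t alone, for `j₀` as well as for `j₁`.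
  part-antidiagonals : ∀ f j {w : ℕ → ℕ} {L : ℕ → ℕ} {v : ℕ → ℕ → ℕ} → (∀ t → t < n → L t ≤ suc t) →
            (∀ t → t < n → w t ≡ ∑ (L t) (v t)) →
            (∀ t y → t < n → y < L t → v t y ≡ cell f (t ∸ y) (j (t ∸ y) y)) → ∑ n w ≤ part f j
  part-antidiagonals f j {w} {L} {v} L≤ w≡ v≡ = begin
    ∑ n w                                                      ≡⟨ ∑-cong n w≡ ⟩
    ∑ n (λ t → ∑ (L t) (v t))                                  ≡⟨ ∑-cong n (λ t t<n → ∑-cong (L t) (λ y → v≡ t y t<n)) ⟩
    ∑ n (λ t → ∑ (L t) (λ y → cell f (t ∸ y) (j (t ∸ y) y)))   ≤⟨ ∑-mono n (λ t t<n → ∑-prefix (L t) (suc t) _ (L≤ t t<n)) ⟩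
    ∑ n (λ t → ∑ (suc t) (λ y → cell f (t ∸ y) (j (t ∸ y) y))) ≤⟨ ∑-antidiagonals n (λ i y → cell f i (j i y)) ⟩
    part f j                                                   ∎
    where open ≤-Reasoning

-- Corner sums and the number of zeros

order : ℕ → ℕ
order k = 2 * (2 * k)

-- What the lower bound takes from the matrix; `even` and `diag` both reflect the zero main diagonal
-- of a symmetric matrix.
record Corners (k : ℕ) (C : ℕ → ℕ → ℕ) : Set where
  field
    1≤k   : 1 ≤ k
    top   : ∀ j → C 0 j ≡ 0
    right : ∀ i → i ≤ order k → C i (order k) ≡ i
    C-sym : ∀ i j → i ≤ order k → j ≤ order k → C i j ≡ C j i
    C≤row : ∀ i j → C i j ≤ i
    even  : ∀ i → i ≤ order k → ∃ λ T → C i i ≡ 2 * T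
    diag  : ∀ i → i < order k → 1 ≤ ∣ suc (C i i) - C (suc i) (suc i) ∣

-- In a cell with corner sums C, the entry vanishes iff exactly one of the two
-- diagonals of the cell is not flat.

module _ (C : ℕ → ℕ → ℕ) where

  zd zs z : ℕ → ℕ → ℕ
  zd i j = ∣ suc (C i j) - C (suc i) (suc j) ∣
  zs i j = ∣ C (suc i) j - C i (suc j) ∣
  z  i j = zd i j + zs i j

  zeros : ℕ → ℕ
  zeros n = ∑ n (λ i → ∑ n (z i))

  -- The height function i + j − 2 C(i , j) takes even values on the vertices with i + j = 2σ
  -- and odd values on those with i + j = 2τ − 1.  Fₑ and Fₒ are half of it (rounded up), in the
  -- coordinates (i , j) = (σ − x , σ + x) and (i , j) = (τ − x , τ + x − 1).
  Fₑ Fₒ : ℕ → ℕ → ℕ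
  Fₑ σ x = σ ∸ C (σ ∸ x) (σ + x)
  Fₒ σ x = σ ∸ C (σ ∸ x) (σ + x ∸ 1)

module CornerSums {k : ℕ} {C : ℕ → ℕ → ℕ} (c : Corners k C) where

  open Corners c

  private
    n K : ℕ
    K = 2 * k
    n = order k

  1≤K : 1 ≤ 2 * k
  1≤K = ≤-trans 1≤k (m≤m+n k _)

  -- From C i j ≤ i ≤ σ the truncated subtraction is exact, and later computations use this additive
  -- form.
  Fₑ-spec : ∀ {i j σ x} → i + x ≡ σ → σ + x ≡ j → j ≤ n → Fₑ C σ x + C i j ≡ σ
  Fₑ-spec {i} {j} {σ} {x} refl refl j≤n rewrite m+n∸n≡m i x =
    m∸n+n≡m (≤-trans (C≤row i _) (m≤m+n i x))

  Fₒ-spec : ∀ {i j σ x} → i + x ≡ σ → σ + x ≡ suc j → 1 ≤ x → j ≤ n → Fₒ C σ x + C i j ≡ σ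
  Fₒ-spec {i} {j} {σ} {x} refl e 1≤x j≤n rewrite m+n∸n≡m i x | e =
    m∸n+n≡m (≤-trans (C≤row i j) (m≤m+n i x))
    where
    i≤n : i ≤ n
    i≤n = (lin 4 λ i x j n → i ⊕ x ⊕ x ≈ 1+ j ⇒ # 1 ≼ x ⇒ j ≼ n ⇒ ⊢ i ≼ n) i x j n e 1≤x j≤n

  legₑˡ : ∀ x → 1 ≤ x → x ≤ K → Fₑ C x x ≡ x
  legₑˡ x _ _ rewrite n∸n≡0 x | top (x + x) = refl

  legₒˡ : ∀ x → 1 ≤ x → x ≤ K → Fₒ C x x ≡ x
  legₒˡ x _ _ rewrite n∸n≡0 x | top (x + x ∸ 1) = refl

  -- The vertex lies in the last column, where C i n = i, and σ - i = x.
  legₑʳ : ∀ x → 1 ≤ x → x ≤ K → Fₑ C (n ∸ x) x ≡ x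
  legₑʳ x 1≤x x≤K = (lin 6 λ f c i x n s → f ⊕ c ≈ s ⇒ c ≈ i ⇒ i ⊕ 2 ⊛ x ≈ n ⇒ s ⊕ x ≈ n ⇒ ⊢ f ≈ x)
      _ _ (n ∸ 2 * x) x n (n ∸ x)
      (Fₑ-spec {n ∸ 2 * x} {n} {n ∸ x} {x}
        ((lin 4 λ i s x n → i ⊕ 2 ⊛ x ≈ n ⇒ s ⊕ x ≈ n ⇒ ⊢ i ⊕ x ≈ s) (n ∸ 2 * x) (n ∸ x) x n i≡ s≡) s≡ ≤-refl)
      (right _ (m∸n≤m n (2 * x))) i≡ s≡
    where
    i≡ : n ∸ 2 * x + 2 * x ≡ n
    i≡ = m∸n+n≡m (*-monoʳ-≤ 2 x≤K)
    s≡ : n ∸ x + x ≡ n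
    s≡ = m∸n+n≡m (≤-trans (m≤m+n x _) (*-monoʳ-≤ 2 x≤K))

  legₒʳ : ∀ x → 1 ≤ x → x ≤ K → Fₒ C (1 + n ∸ x) x ≡ x
  legₒʳ x 1≤x x≤K = (lin 6 λ f c i x n s → f ⊕ c ≈ s ⇒ c ≈ i ⇒ i ⊕ 2 ⊛ x ≈ 1+ n ⇒ s ⊕ x ≈ 1+ n ⇒ ⊢ f ≈ x)
      _ _ i x n s
      (Fₒ-spec {i} {n} {s} {x}
        ((lin 4 λ i s x n → i ⊕ 2 ⊛ x ≈ 1+ n ⇒ s ⊕ x ≈ 1+ n ⇒ ⊢ i ⊕ x ≈ s) i s x n i≡ s≡) s≡ 1≤x ≤-refl)
      (right i ((lin 3 λ i x n → i ⊕ 2 ⊛ x ≈ 1+ n ⇒ # 1 ≼ x ⇒ ⊢ i ≼ n) i x n i≡ 1≤x)) i≡ s≡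
    where
    i = 1 + n ∸ 2 * x
    s = 1 + n ∸ x
    i≡ : i + 2 * x ≡ 1 + n
    i≡ = m∸n+n≡m (m≤n⇒m≤1+n (*-monoʳ-≤ 2 x≤K))
    s≡ : s + x ≡ 1 + n
    s≡ = m∸n+n≡m (m≤n⇒m≤1+n (≤-trans (m≤m+n x _) (*-monoʳ-≤ 2 x≤K)))

  Fₑ-parity : ∀ σ → σ ≤ n → ∃ λ T → Fₑ C σ 0 + 2 * T ≡ σ
  Fₑ-parity σ σ≤n with even σ σ≤n
  ... | T , eq = T , trans (cong (Fₑ C σ 0 +_) (sym eq)) (Fₑ-spec (+-identityʳ σ) (+-identityʳ σ) σ≤n)

  module O = OddLattice k 1≤K (Fₒ C) legₒˡ legₒʳ
  module E = EvenLattice k 1≤K (Fₑ C) legₑˡ legₑʳ Fₑ-parity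

  open CellSums n

  private
    -- The two diagonals of a cell belong to different lattices. On the cells `j₀` the direction i -
    -- j = const is odd and the other even; on `j₁` it is the reverse. The four cost sums are thus
    -- charged to four separate parts of the count.
    Wₒ≤ : ∑ K (λ y → O.W (suc y)) ≤ part (zd C) j₀
    Wₒ≤ = part-lines (zd C) j₀ (m≤m+n K _) λ y y<K → ≤-trans (≤-reflexive (∑-cong (1 + n ∸ 2 * suc y) (λ i → edge y i y<K)))
      (∑-prefix (1 + n ∸ 2 * suc y) n _ (m≤n+o⇒m∸n≤o (1 + n) (2 * suc y) (s≤s (m≤n+m n (y + 1 * suc y)))))
      where
      edge : ∀ y i → y < K → i < 1 + n ∸ 2 * suc y →
             ∣ O.line (suc y) (suc i) - O.line (suc y) i ∣ ≡ cell (zd C) i (j₀ i y)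
      edge y i y<K i< = trans
        (∣-∣-shift {Fₒ C (suc y + i) (suc y)} {Fₒ C (suc y + suc i) (suc y)} {C i j} {C (suc i) (suc j)}
                   (Fₒ-spec {i} {j} (+-comm i (suc y)) (e₁ y i) (s≤s z≤n) (<⇒≤ j<n))
                   (Fₒ-spec {suc i} {suc j} (+-comm (suc i) (suc y)) (e₂ y i) (s≤s z≤n) j<n))
        (trans (trans (cong₂ ∣_-_∣ (e₃ y i (C i j)) (refl {x = suc y + i + C (suc i) (suc j)}))
                      (∣m+n-m+o∣≡∣n-o∣ (suc y + i) (suc (C i j)) (C (suc i) (suc j)))) (sym (cell-inside (zd C) j<n)))
        where
        j = j₀ i y
        e₁ : ∀ y i → suc y + i + suc y ≡ suc (suc i + (y + y))
        e₁ = solve-∀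
        e₂ : ∀ y i → suc y + suc i + suc y ≡ suc (suc (suc i + (y + y)))
        e₂ = solve-∀
        e₃ : ∀ y i c → suc y + suc i + c ≡ suc y + i + suc c
        e₃ = solve-∀
        j<n : j < n
        j<n = (lin 4 λ i y d n → i ≺ d ⇒ d ⊕ 2 ⊛ 1+ y ≈ 1+ n ⇒ ⊢ 1+ i ⊕ (y ⊕ y) ≺ n) i y _ n i<
                (m∸n+n≡m {1 + n} {2 * suc y} (m≤n⇒m≤1+n (*-monoʳ-≤ 2 y<K)))

    Wₑ≤ : ∑ K (λ y → E.W (suc y)) ≤ part (zd C) j₁
    Wₑ≤ = part-lines (zd C) j₁ (m≤m+n K _) λ y y<K → ≤-trans (≤-reflexive (∑-cong (n ∸ 2 * suc y) (λ i → edge y i y<K)))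
      (∑-prefix (n ∸ 2 * suc y) n _ (m∸n≤m n (2 * suc y)))
      where
      edge : ∀ y i → y < K → i < n ∸ 2 * suc y →
             ∣ E.line (suc y) (suc i) - E.line (suc y) i ∣ ≡ cell (zd C) i (j₁ i y)
      edge y i y<K i< = trans
        (∣-∣-shift {Fₑ C (suc y + i) (suc y)} {Fₑ C (suc y + suc i) (suc y)} {C i j} {C (suc i) (suc j)}
                   (Fₑ-spec {i} {j} (+-comm i (suc y)) (e₁ y i) (<⇒≤ j<n))
                   (Fₑ-spec {suc i} {suc j} (+-comm (suc i) (suc y)) (e₂ y i) j<n))
        (trans (trans (cong₂ ∣_-_∣ (e₃ y i (C i j)) (refl {x = suc y + i + C (suc i) (suc j)}))
                      (∣m+n-m+o∣≡∣n-o∣ (suc y + i) (suc (C i j)) (C (suc i) (suc j)))) (sym (cell-inside (zd C) j<n)))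
        where
        j = j₁ i y
        e₁ : ∀ y i → suc y + i + suc y ≡ suc i + suc (y + y)
        e₁ = solve-∀
        e₂ : ∀ y i → suc y + suc i + suc y ≡ suc (suc i + suc (y + y))
        e₂ = solve-∀
        e₃ : ∀ y i c → suc y + suc i + c ≡ suc y + i + suc c
        e₃ = solve-∀
        j<n : j < n
        j<n = (lin 4 λ i y d n → i ≺ d ⇒ d ⊕ 2 ⊛ 1+ y ≈ n ⇒ ⊢ 1+ i ⊕ (1+ (y ⊕ y)) ≺ n) i y _ n i<
                (m∸n+n≡m {n} {2 * suc y} (*-monoʳ-≤ 2 y<K))

    Uₑ≤ : ∑ n (λ t → E.U (suc t)) ≤ part (zs C) j₀
    Uₑ≤ = part-antidiagonals (zs C) j₀ {L = λ t → E.S (suc t)} (λ t _ → E.S≤σ (suc t)) (λ _ _ → refl) edge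
      where
      edge : ∀ t y → t < n → y < E.S (suc t) →
             ∣ Fₑ C (suc t) (suc y) - Fₑ C (suc t) y ∣ ≡ cell (zs C) (t ∸ y) (j₀ (t ∸ y) y)
      edge t y t<n y<S = trans
        (∣-∣-shift (Fₑ-spec {suc i} {j} (cong suc i+y)
          ((lin 3 λ i y t → i ⊕ y ≈ t ⇒ ⊢ 1+ t ⊕ y ≈ 1+ i ⊕ (y ⊕ y)) i y t i+y) (<⇒≤ j<n))
                   (Fₑ-spec {i} {suc j} (trans (+-suc i y) (cong suc i+y))
                      ((lin 3 λ i y t → i ⊕ y ≈ t ⇒ ⊢ 1+ t ⊕ 1+ y ≈ 1+ (1+ i ⊕ (y ⊕ y))) i y t i+y) j<n))
        (trans (∣m+n-m+o∣≡∣n-o∣ (suc t) (C (suc i) j) (C i (suc j))) (sym (cell-inside (zs C) j<n)))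
        where
        i = t ∸ y
        j = j₀ i y
        i+y : i + y ≡ t
        i+y = m∸n+n≡m (s≤s⁻¹ (≤-trans y<S (E.S≤σ (suc t))))
        j<n : j < n
        j<n = (lin 5 λ i y t s n → i ⊕ y ≈ t ⇒ y ≺ s ⇒ 1+ t ⊕ s ≼ n ⇒ ⊢ 1+ i ⊕ (y ⊕ y) ≺ n)
                i y t (E.S (suc t)) n i+y y<S (E.σ+S≤N t<n)

    Vₒ≤ : ∑ n (λ t → O.V (suc (suc t))) ≤ part (zs C) j₁
    Vₒ≤ = part-antidiagonals (zs C) j₁ {L = λ t → O.S (suc (suc t)) ∸ 1} (λ t _ → ∸-monoˡ-≤ 1 (O.S≤σ (suc (suc t))))
        (λ _ _ → refl) edge
      where
      edge : ∀ t y → t < n → y < O.S (suc (suc t)) ∸ 1 →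
             ∣ Fₒ C (suc (suc t)) (suc (suc y)) - Fₒ C (suc (suc t)) (suc y) ∣ ≡ cell (zs C) (t ∸ y) (j₁ (t ∸ y) y)
      edge t y t<n y<S = trans
        (∣-∣-shift (Fₒ-spec {suc i} {j} (cong suc (trans (+-suc i y) (cong suc i+y)))
                      ((lin 3 λ i y t → i ⊕ y ≈ t ⇒ ⊢ # 2 ⊕ t ⊕ 1+ y ≈ 1+ (1+ i ⊕ (1+ (y ⊕ y)))) i y t i+y) (s≤s z≤n) (<⇒≤ j<n))
                   (Fₒ-spec {i} {suc j} (trans (+-suc i (suc y)) (cong suc (trans (+-suc i y) (cong suc i+y))))
                      ((lin 3 λ i y t → i ⊕ y ≈ t ⇒ ⊢ # 2 ⊕ t ⊕ (# 2 ⊕ y) ≈ # 2 ⊕ (1+ i ⊕ (1+ (y ⊕ y)))) i y t i+y)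
                        (s≤s z≤n) j<n))
        (trans (∣m+n-m+o∣≡∣n-o∣ (suc (suc t)) (C (suc i) j) (C i (suc j))) (sym (cell-inside (zs C) j<n)))
        where
        i = t ∸ y
        j = j₁ i y
        s = O.S (suc (suc t))
        1+y<s : suc y < s
        1+y<s = subst (_≤ s) (+-comm (suc y) 1) (m≤n∸o⇒m+o≤n′ y<S)
          where
          m≤n∸o⇒m+o≤n′ : ∀ {m n} → suc m ≤ n ∸ 1 → suc m + 1 ≤ n
          m≤n∸o⇒m+o≤n′ {m} {suc n} h = subst (_≤ suc n) (+-comm 1 (suc m)) (s≤s h)
        i+y : i + y ≡ t
        i+y = m∸n+n≡m (s≤s⁻¹ (s≤s⁻¹ (≤-trans 1+y<s (O.S≤σ (suc (suc t))))))
        j<n : j < n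
        j<n = (lin 5 λ i y t s n → i ⊕ y ≈ t ⇒ 1+ y ≺ s ⇒ # 2 ⊕ t ⊕ s ≼ 1+ n ⇒ ⊢ 1+ i ⊕ (1+ (y ⊕ y)) ≺ n)
                i y t s n i+y 1+y<s (O.σ+S≤N (s≤s t<n))

  -- The main diagonal contributes n, and symmetry doubles what lies above it.
  zeros-costs : n + 2 * (O.cost + E.cost) ≤ zeros C n
  zeros-costs = begin
    n + 2 * (O.cost + E.cost)
      ≤⟨ +-monoʳ-≤ n (*-monoʳ-≤ 2 costs≤) ⟩
    n + 2 * above (z C)
      ≡⟨ cong (_+ 2 * above (z C)) (*-identityʳ n) ⟨
    n * 1 + 2 * above (z C)
      ≤⟨ total-above (z C) 1 z-sym (λ {i} i<n → ≤-trans (diag i i<n) (m≤m+n _ _)) ⟩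
    zeros C n ∎
    where
    open ≤-Reasoning
    z-sym : ∀ {i j} → i < n → j < n → z C i j ≡ z C j i
    z-sym {i} {j} i<n j<n = cong₂ _+_
      (cong₂ (λ a b → ∣ suc a - b ∣) (C-sym i j (<⇒≤ i<n) (<⇒≤ j<n)) (C-sym (suc i) (suc j) i<n j<n))
      (trans (cong₂ ∣_-_∣ (C-sym (suc i) j i<n (<⇒≤ j<n)) (C-sym i (suc j) (<⇒≤ i<n) j<n))
        (∣-∣-comm (C j (suc i)) (C (suc j) i)))
    costs≤ : O.cost + E.cost ≤ above (z C)
    costs≤ = (lin 11 λ wo vo we ue a b c d e f t → wo ≼ a ⇒ ue ≼ b ⇒ we ≼ c ⇒ vo ≼ d ⇒ e ≈ a ⊕ b ⇒ f ≈ c ⊕ d ⇒ e ⊕ f ≼ t ⇒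
        ⊢ (wo ⊕ vo) ⊕ (we ⊕ ue) ≼ t)
      _ _ _ _ (part (zd C) j₀) (part (zs C) j₀) (part (zd C) j₁) (part (zs C) j₁) (part (z C) j₀) (part (z C) j₁) (above (z C))
      Wₒ≤ Uₑ≤ Wₑ≤ Vₒ≤ (part-+ (zd C) (zs C) j₀) (part-+ (zd C) (zs C) j₁) (above-split (z C))

  zeros-bound : n + 8 * (k * k) ≤ zeros C n
  zeros-bound = (lin 5 λ n s o e t → 2 ⊛ s ≼ o ⇒ 2 ⊛ s ≼ e ⇒ n ⊕ 2 ⊛ (o ⊕ e) ≼ t ⇒ ⊢ n ⊕ 8 ⊛ s ≼ t)
    n (k * k) O.cost E.cost (zeros C n) O.cost-bound E.cost-bound zeros-costs

  zeros-tight : zeros C n ≤ n + 8 * (k * k) → ∃ λ p′ → ∃ λ p →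
                (Flat (1 + n) p′ (Fₒ C) × Flat n p (Fₑ C)) × (((p′ ≡ k) ⊎ (p′ ≡ suc k)) × ((p ≡ k) ⊎ (p ≡ suc k)))
  zeros-tight tight = O.p , E.p , (proj₁ odds , proj₁ evens) , (proj₂ odds , proj₂ evens)
    where
    odds : Flat (1 + n) O.p (Fₒ C) × ((O.p ≡ k) ⊎ (O.p ≡ suc k))
    odds = O.cost-tight ((lin 5 λ n s o e t → 2 ⊛ s ≼ e ⇒ n ⊕ 2 ⊛ (o ⊕ e) ≼ t ⇒ t ≼ n ⊕ 8 ⊛ s ⇒ ⊢ o ≼ 2 ⊛ s)
      n (k * k) O.cost E.cost (zeros C n) E.cost-bound zeros-costs tight)
    evens : Flat n E.p (Fₑ C) × ((E.p ≡ k) ⊎ (E.p ≡ suc k))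
    evens = E.cost-tight ((lin 5 λ n s o e t → 2 ⊛ s ≼ o ⇒ n ⊕ 2 ⊛ (o ⊕ e) ≼ t ⇒ t ≼ n ⊕ 8 ⊛ s ⇒ ⊢ e ≼ 2 ⊛ s)
      n (k * k) O.cost E.cost (zeros C n) O.cost-bound zeros-costs tight)

-- From the matrix to its corner sums

ext : ∀ {n} {X : Set} → (Fin n → X) → X → ℕ → X
ext {zero}  f d j       = d
ext {suc n} f d zero    = f zero
ext {suc n} f d (suc j) = ext (f ∘ suc) d j

ext-toℕ : ∀ {n} {X : Set} (f : Fin n → X) d i → ext f d (toℕ i) ≡ f i
ext-toℕ f d zero    = refl
ext-toℕ f d (suc i) = ext-toℕ (f ∘ suc) d i

-- Splitting an entry into `pos` and `neg` lets it enter balanced equations over ℕ.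
nz pos neg : ℤ → ℕ
nz (⁺ zero)  = 0
nz (⁺ suc _) = 1
nz -[1+ _ ]  = 1
pos (⁺ a)    = a
pos -[1+ _ ] = 0
neg (⁺ _)    = 0
neg -[1+ a ] = suc a

length-nonzeros : ∀ n (g : ℕ → ℤ) → L.length (nonzeros (L.tabulate {n = n} (g ∘ toℕ))) ≡ ∑ n (nz ∘ g)
length-nonzeros zero    g = refl
length-nonzeros (suc n) g with g 0 | length-nonzeros n (g ∘ suc) | ∑-head n (nz ∘ g)
... | ⁺ zero   | ih | h = trans ih (sym h)
... | ⁺ suc a  | ih | h = trans (cong suc ih) (sym h)
... | -[1+ a ] | ih | h = trans (cong suc ih) (sym h)

sum-tabulate : ∀ n (f : ℕ → ℕ) → sum (L.tabulate {n = n} (f ∘ toℕ)) ≡ ∑ n f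
sum-tabulate zero    f = refl
sum-tabulate (suc n) f = trans (cong (f 0 +_) (sum-tabulate n (f ∘ suc))) (sym (∑-head n f))

nnz-∑ : ∀ {n} (A : Matrix n) (g : ℕ → ℕ → ℤ) → (∀ i j → A i j ≡ g (toℕ i) (toℕ j)) →
        nnz A ≡ ∑ n (λ i → ∑ n (λ j → nz (g i j)))
nnz-∑ {n} A g A≡g = trans (cong sum (tabulate-cong λ i →
    trans (cong (L.length ∘ nonzeros) (tabulate-cong (A≡g i))) (length-nonzeros n (g (toℕ i)))))
  (sum-tabulate n (λ i → ∑ n (λ j → nz (g i j))))

-- The prefix sums of an alternating row, as the state (0 or 1) of the automaton reading it.

step : ℕ → ℤ → ℕ
step s (⁺ zero)  = s
step s (⁺ suc _) = 1
step s -[1+ _ ]  = 0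

run : ℕ → (ℕ → ℤ) → ℕ → ℕ
run s g zero    = s
run s g (suc j) = run (step s (g 0)) (g ∘ suc) j

-- State 1 means that a +1 has been read and still awaits its -1 or the end of the row. Putting that
-- 1 back makes the rest an alternating list again.
AltFrom : ℕ → List ℤ → Set
AltFrom zero    xs = AltPlus xs
AltFrom (suc _) xs = AltPlus (1ℤ ∷ xs)

run≤1 : ∀ {s} g j → s ≤ 1 → run s g j ≤ 1
run≤1     g zero    s≤1 = s≤1
run≤1 {s} g (suc j) s≤1 = run≤1 (g ∘ suc) j (step≤1 (g 0))
  where
  step≤1 : ∀ x → step s x ≤ 1
  step≤1 (⁺ zero)  = s≤1
  step≤1 (⁺ suc _) = ≤-refl
  step≤1 -[1+ _ ]  = z≤n

Alternates : ℕ → ℕ → (ℕ → ℤ) → Set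
Alternates n s g = run s g n ≡ 1 × (∀ j → j < n → run s g (suc j) + neg (g j) ≡ run s g j + pos (g j))

alternates-suc : ∀ n s s′ g → step s (g 0) ≡ s′ → s′ + neg (g 0) ≡ s + pos (g 0) →
                 Alternates n s′ (g ∘ suc) → Alternates (suc n) s g
alternates-suc n s _ g refl first (e , h) = e , λ { zero _ → first ; (suc j) (s≤s j<n) → h j j<n }

run-alternating : ∀ n s g → s ≤ 1 → AltFrom s (nonzeros (L.tabulate {n = n} (g ∘ toℕ))) → Alternates n s g
alternates-head : ∀ n s g x → g 0 ≡ x → s ≤ 1 →
                  AltFrom s (nonzeros (x ∷ L.tabulate {n = n} (g ∘ suc ∘ toℕ))) → Alternates (suc n) s g

run-alternating zero    0 g _ ()
run-alternating zero    1 g _ _ = refl , λ _ ()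
run-alternating zero    (suc (suc _)) g (s≤s ()) _
run-alternating (suc n) s g s≤1 alt = alternates-head n s g (g 0) refl s≤1 alt

alternates-head n s g (⁺ zero) g0 s≤1 alt =
  alternates-suc n s s g (cong (step s) g0)
    (trans (cong (λ x → s + neg x) g0) (sym (cong (λ x → s + pos x) g0)))
    (run-alternating n s (g ∘ suc) s≤1 alt)
alternates-head n 0 g (⁺ suc u) g0 s≤1 alt =
  alternates-suc n 0 1 g (cong (step 0) g0)
    (trans (cong (suc ∘ neg) g0) (sym (trans (cong pos g0) (cong suc (proj₁ (plus alt))))))
    (run-alternating n 1 (g ∘ suc) ≤-refl (proj₂ (plus alt)))
  where
  plus : ∀ {u xs} → AltPlus ((⁺ suc u) ∷ xs) → u ≡ 0 × AltPlus (1ℤ ∷ xs)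
  plus single   = refl , single
  plus (cons p) = refl , cons p
alternates-head n 1 g (⁺ suc u) g0 s≤1 ()
alternates-head n 0 g -[1+ u ] g0 s≤1 ()
alternates-head n 1 g -[1+ u ] g0 s≤1 alt =
  alternates-suc n 1 0 g (cong (step 1) g0)
    (trans (cong neg g0) (trans (cong suc (proj₁ (minus alt))) (sym (cong (suc ∘ pos) g0))))
    (run-alternating n 0 (g ∘ suc) z≤n (proj₂ (minus alt)))
  where
  minus : ∀ {u xs} → AltPlus (1ℤ ∷ -[1+ u ] ∷ xs) → u ≡ 0 × AltPlus xs
  minus (cons p) = refl , p
alternates-head n (suc (suc _)) g (⁺ suc _) _ (s≤s ()) _
alternates-head n (suc (suc _)) g -[1+ _ ] _ (s≤s ()) _

module Corner {n : ℕ} (A : Matrix n) (asm : IsASM A) (symm : Symmetric A) (zdiag : ZeroDiagonal A) where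

  a : ℕ → ℕ → ℤ
  a i j = ext (λ i′ → ext (A i′) 0ℤ j) 0ℤ i

  a-toℕ : ∀ i j → a (toℕ i) (toℕ j) ≡ A i j
  a-toℕ i j = trans (ext-toℕ (λ i′ → ext (A i′) 0ℤ (toℕ j)) 0ℤ i) (ext-toℕ (A i) 0ℤ j)

  a-fromℕ< : ∀ {i j} (i<n : i < n) (j<n : j < n) → a i j ≡ A (fromℕ< i<n) (fromℕ< j<n)
  a-fromℕ< i<n j<n = trans (sym (cong₂ a (toℕ-fromℕ< i<n) (toℕ-fromℕ< j<n))) (a-toℕ _ _)

  a-sym : ∀ {i j} → i < n → j < n → a i j ≡ a j i
  a-sym i<n j<n = trans (a-fromℕ< i<n j<n) (trans (symm _ _) (sym (a-fromℕ< j<n i<n)))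

  a-diag : ∀ {i} → i < n → a i i ≡ 0ℤ
  a-diag i<n = trans (a-fromℕ< i<n i<n) (zdiag _)

  b : ℕ → ℕ → ℕ
  b i = run 0 (a i)

  b≤1 : ∀ i j → b i j ≤ 1
  b≤1 i j = run≤1 (a i) j z≤n

  private
    alternating : ∀ {i} → i < n → Alternates n 0 (a i)
    alternating {i} i<n = run-alternating n 0 (a i) z≤n
      (subst (AltPlus ∘ nonzeros) (tabulate-cong (λ j →
         trans (sym (a-toℕ (fromℕ< i<n) j)) (cong (λ i → a i (toℕ j)) (toℕ-fromℕ< i<n)))) (IsASM.rows asm (fromℕ< i<n)))

  b-end : ∀ {i} → i < n → b i n ≡ 1
  b-end i<n = proj₁ (alternating i<n)

  b-step : ∀ {i j} → i < n → j < n → b i (suc j) + neg (a i j) ≡ b i j + pos (a i j)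
  b-step i<n = proj₂ (alternating i<n) _

  C : ℕ → ℕ → ℕ
  C i j = ∑ i (λ p → b p j)

  -- Expanding both sides by the last row, the induction hypotheses leave a row prefix against its
  -- mirror image; these advance by the entries (i , j) and (j , i), which agree.
  C-sym : ∀ i j → i ≤ n → j ≤ n → C i j ≡ C j i
  C-sym zero    j       _   _   = sym (∑-zero j (λ _ _ → refl))
  C-sym (suc i) zero    _   _   = ∑-zero (suc i) (λ _ _ → refl)
  C-sym (suc i) (suc j) i<n j<n =
    (lin 10 λ c c′ d d′ β β′ γ γ′ u v →
        c ≈ d′ ⊕ γ ⇒ d ⊕ β ≈ c′ ⇒ d ≈ d′ ⇒
        β′ ⊕ v ≈ β ⊕ u ⇒ γ′ ⊕ v ≈ γ ⊕ u ⇒ ⊢ c ⊕ β′ ≈ c′ ⊕ γ′)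
      (C i (suc j)) (C j (suc i)) (C i j) (C j i) (b i j) (b i (suc j)) (b j i) (b j (suc i)) (pos (a i j)) (neg (a i j))
      (C-sym i (suc j) (<⇒≤ i<n) j<n) (C-sym (suc i) j i<n (<⇒≤ j<n)) (C-sym i j (<⇒≤ i<n) (<⇒≤ j<n))
      (b-step i<n j<n) (subst (λ x → b j (suc i) + neg x ≡ b j i + pos x) (a-sym j<n i<n) (b-step j<n i<n))

  -- A new column contributes a column prefix, which by symmetry is the row prefix `b j i`.
  C-right : ∀ {i j} → i ≤ n → j < n → C i (suc j) ≡ C i j + b j i
  C-right {i} {j} i≤n j<n = trans (C-sym i (suc j) i≤n j<n) (cong (_+ b j i) (C-sym j i (<⇒≤ j<n) i≤n))

  C-top : ∀ j → C 0 j ≡ 0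
  C-top j = refl

  C-end : ∀ i → i ≤ n → C i n ≡ i
  C-end i i≤n = trans (∑-cong i (λ p p<i → b-end (≤-trans p<i i≤n))) (trans (∑-const i 1) (*-identityʳ i))

  C≤row : ∀ i j → C i j ≤ i
  C≤row i j = ≤-trans (∑-mono i (λ p _ → b≤1 p j)) (≤-reflexive (trans (∑-const i 1) (*-identityʳ i)))

  -- The step adds a row prefix, the equal column prefix and a zero diagonal entry. Hence all C i i
  -- are even.
  C-diag : ∀ {i} → i < n → C (suc i) (suc i) ≡ C i i + 2 * b i i
  C-diag {i} i<n =
    (lin 4 λ c d β β′ → c ≈ d ⊕ β ⇒ β′ ⊕ # 0 ≈ β ⊕ # 0 ⇒ ⊢ c ⊕ β′ ≈ d ⊕ 2 ⊛ β)
      (C i (suc i)) (C i i) (b i i) (b i (suc i)) (C-right (<⇒≤ i<n) i<n)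
      (subst (λ x → b i (suc i) + neg x ≡ b i i + pos x) (a-diag i<n) (b-step i<n i<n))

  C-even : ∀ i → i ≤ n → ∃ λ T → C i i ≡ 2 * T
  C-even zero    _   = 0 , refl
  C-even (suc i) i<n with C-even i (<⇒≤ i<n)
  ... | T , eq = T + b i i , trans (C-diag i<n) (trans (cong (_+ 2 * b i i) eq) (sym (*-distribˡ-+ 2 T (b i i))))

  zero-diag : ∀ i → i < n → 1 ≤ ∣ suc (C i i) - C (suc i) (suc i) ∣
  zero-diag i i<n rewrite C-diag i<n with b i i | b≤1 i i
  ... | 0           | _ = ≤-reflexive (sym (trans (cong₂ ∣_-_∣ (+-comm 1 (C i i)) refl) (∣m+n-m+o∣≡∣n-o∣ (C i i) 1 0)))
  ... | 1           | _ = ≤-reflexive (sym (trans (cong₂ ∣_-_∣ (+-comm 1 (C i i)) refl) (∣m+n-m+o∣≡∣n-o∣ (C i i) 1 2)))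
  ... | suc (suc _) | s≤s ()

  -- Let β and γ be the row and column prefixes before the entry. If it is zero, |1 - β - γ| + |β -
  -- γ| = 1 for all β, γ in {0, 1}. A nonzero entry forces β = γ and makes both differences vanish.
  cell : ∀ {i j} → i < n → j < n →
         nz (a i j) + (∣ suc (C i j) - C (suc i) (suc j) ∣ + ∣ C (suc i) j - C i (suc j) ∣) ≡ 1
  cell {i} {j} i<n j<n = trans
    (cong₂ (λ x y → nz (a i j) + (x + y))
      (trans (cong₂ ∣_-_∣ (sym (+-comm (C i j) 1))
        (trans (cong (_+ b i (suc j)) (C-right (<⇒≤ i<n) j<n)) (+-assoc (C i j) _ _)))
             (∣m+n-m+o∣≡∣n-o∣ (C i j) 1 _))
      (trans (cong (∣_-_∣ (C (suc i) j)) (C-right (<⇒≤ i<n) j<n)) (∣m+n-m+o∣≡∣n-o∣ (C i j) _ _)))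
    (local (a i j) (b i j) (b i (suc j)) (b j i) (b j (suc i)) (b≤1 i j) (b≤1 i (suc j)) (b≤1 j i) (b≤1 j (suc i))
      (b-step i<n j<n) (subst (λ x → b j (suc i) + neg x ≡ b j i + pos x) (a-sym j<n i<n) (b-step j<n i<n)))
    where
    rise : ∀ {u} β β′ → β′ ≤ 1 → β′ + 0 ≡ β + suc u → β ≡ 0 × β′ ≡ 1
    rise {u} β β′ le e = (lin 3 λ β β′ u → β′ ≼ # 1 ⇒ β′ ⊕ # 0 ≈ β ⊕ 1+ u ⇒ ⊢ β ≈ # 0) β β′ u le e ,
                       (lin 3 λ β β′ u → β′ ≼ # 1 ⇒ β′ ⊕ # 0 ≈ β ⊕ 1+ u ⇒ ⊢ β′ ≈ # 1) β β′ u le e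
    fall : ∀ {u} β β′ → β ≤ 1 → β′ + suc u ≡ β + 0 → β ≡ 1 × β′ ≡ 0
    fall {u} β β′ le e = (lin 3 λ β β′ u → β ≼ # 1 ⇒ β′ ⊕ 1+ u ≈ β ⊕ # 0 ⇒ ⊢ β ≈ # 1) β β′ u le e ,
                       (lin 3 λ β β′ u → β ≼ # 1 ⇒ β′ ⊕ 1+ u ≈ β ⊕ # 0 ⇒ ⊢ β′ ≈ # 0) β β′ u le e
    local : ∀ x β β′ γ γ′ → β ≤ 1 → β′ ≤ 1 → γ ≤ 1 → γ′ ≤ 1 →
            β′ + neg x ≡ β + pos x → γ′ + neg x ≡ γ + pos x → nz x + (∣ 1 - γ + β′ ∣ + ∣ β - γ ∣) ≡ 1
    local (⁺ 0) β β′ γ γ′ β≤1 _ γ≤1 _ eq _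
      rewrite trans (sym (+-identityʳ β′)) (trans eq (+-identityʳ β)) = table β γ β≤1 γ≤1
      where
      table : ∀ β γ → β ≤ 1 → γ ≤ 1 → ∣ 1 - γ + β ∣ + ∣ β - γ ∣ ≡ 1
      table 0 0 _ _ = refl
      table 0 1 _ _ = refl
      table 1 0 _ _ = refl
      table 1 1 _ _ = refl
      table (suc (suc _)) _ (s≤s ()) _
      table 0 (suc (suc _)) _ (s≤s ())
      table 1 (suc (suc _)) _ (s≤s ())
    local (⁺ suc u) β β′ γ γ′ _ β′≤1 _ γ′≤1 eq eq′
      rewrite proj₁ (rise β β′ β′≤1 eq) | proj₂ (rise β β′ β′≤1 eq) | proj₁ (rise γ γ′ γ′≤1 eq′) = refl
    local -[1+ u ] β β′ γ γ′ β≤1 _ γ≤1 _ eq eq′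
      rewrite proj₁ (fall β β′ β≤1 eq) | proj₂ (fall β β′ β≤1 eq) | proj₁ (fall γ γ′ γ≤1 eq′) = refl

  zeroCount : ℕ
  zeroCount = ∑ n (λ i → ∑ n (λ j → ∣ suc (C i j) - C (suc i) (suc j) ∣ + ∣ C (suc i) j - C i (suc j) ∣))

  nnz+zeros : nnz A + zeroCount ≡ n * n
  nnz+zeros = begin
    nnz A + zeroCount
      ≡⟨ cong (_+ zeroCount) (nnz-∑ A a (λ i j → sym (a-toℕ i j))) ⟩
    ∑ n (λ i → ∑ n (λ j → nz (a i j))) + zeroCount
      ≡⟨ ∑-+ n _ _ ⟨
    ∑ n (λ i → ∑ n (λ j → nz (a i j)) + ∑ n (λ j → ∣ suc (C i j) - C (suc i) (suc j) ∣ + ∣ C (suc i) j - C i (suc j) ∣))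
      ≡⟨ ∑-cong n (λ i i<n → trans (sym (∑-+ n _ _)) (trans (∑-cong n (λ j j<n → cell i<n j<n)) (∑-const n 1))) ⟩
    ∑ n (λ i → n * 1)
      ≡⟨ trans (∑-const n (n * 1)) (cong (n *_) (*-identityʳ n)) ⟩
    n * n ∎
    where open ≡-Reasoning

-- The entries forced by flat lattices

even-sign odd-sign : ℕ → ℤ
even-sign 0       = 1ℤ
even-sign (suc _) = -1ℤ
odd-sign 0       = -1ℤ
odd-sign (suc _) = 1ℤ

-- The entries above the diagonal of an extremal matrix of order n.  Both lattices are flat in the
-- middle: Fₑ at p, and Fₒ at p + 1 − δ.  Type 1 is δ = 0, p = k; type 2 is δ = 1, p = k; the
-- near-diamond is δ = 1, p = k + 1.  A cell (i , j) has coordinates (i , j) = (σ − x , σ + x) or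
-- (i , j) = (τ − x , τ + x − 1), and the holes are the cells with x = 1 and τ + p odd.

module _ (δ p n : ℕ) where

  record EvenBand (σ x : ℕ) : Set where
    constructor evenBand
    field
      x≤ : x + δ ≤ p
      σ≥ : p ≤ σ
      σ≤ : σ + p < n

  record OddBand (τ x : ℕ) : Set where
    constructor oddBand
    field
      x≤ : x ≤ p
      τ≥ : p < τ + δ
      τ≤ : τ + p < n + δ

  data EvenRegion (σ x : ℕ) : Set where
    inside  : EvenBand σ x → EvenRegion σ x
    outside : p < x + δ → EvenRegion σ x
    left    : σ < p → EvenRegion σ x
    right   : n ≤ σ + p → EvenRegion σ x

  data OddRegion (τ x : ℕ) : Set where
    inside  : OddBand τ x → OddRegion τ x
    outside : p < x → OddRegion τ x
    left    : τ + δ ≤ p → OddRegion τ x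
    right   : n + δ ≤ τ + p → OddRegion τ x

  evenRegion : ∀ σ x → EvenRegion σ x
  evenRegion σ x with ≤-<-connex (x + δ) p | ≤-<-connex p σ | <-≤-connex (σ + p) n
  ... | inj₂ h | _      | _      = outside h
  ... | inj₁ _ | inj₂ h | _      = left h
  ... | inj₁ _ | inj₁ _ | inj₂ h = right h
  ... | inj₁ f | inj₁ g | inj₁ h = inside (evenBand f g h)

  oddRegion : ∀ τ x → OddRegion τ x
  oddRegion τ x with ≤-<-connex x p | <-≤-connex p (τ + δ) | <-≤-connex (τ + p) (n + δ)
  ... | inj₂ h | _      | _      = outside h
  ... | inj₁ _ | inj₂ h | _      = left h
  ... | inj₁ _ | inj₁ _ | inj₂ h = right h
  ... | inj₁ f | inj₁ g | inj₁ h = inside (oddBand f g h)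

  record Pattern (g : ℕ → ℕ → ℤ) : Set where
    field
      even-in  : ∀ {i j σ x} → 1 ≤ x → i + x ≡ σ → σ + x ≡ j → j < n → EvenBand σ x → g i j ≡ even-sign δ
      even-out : ∀ {i j σ x} → 1 ≤ x → i + x ≡ σ → σ + x ≡ j → j < n →
                 (p < x + δ) ⊎ ((σ < p) ⊎ (n ≤ σ + p)) → g i j ≡ 0ℤ
      odd-in   : ∀ {i j τ x} → 1 ≤ x → i + x ≡ τ → τ + x ≡ suc j → j < n → OddBand τ x →
                 (x ≡ 1 → odd (τ + p) ≡ 0) → g i j ≡ odd-sign δ
      odd-hole : ∀ {i j τ} → i + 1 ≡ τ → τ + 1 ≡ suc j → j < n → OddBand τ 1 → odd (τ + p) ≡ 1 → g i j ≡ 0ℤ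
      odd-out  : ∀ {i j τ x} → 1 ≤ x → i + x ≡ τ → τ + x ≡ suc j → j < n →
                 (p < x) ⊎ ((τ + δ ≤ p) ⊎ (n + δ ≤ τ + p)) → g i j ≡ 0ℤ

halve : ∀ e → ∃ λ y → (e ≡ y + y) ⊎ (e ≡ suc (y + y))
halve zero    = 0 , inj₁ refl
halve (suc e) with halve e
... | y , inj₁ refl = y , inj₂ refl
... | y , inj₂ refl = suc y , inj₁ (cong suc (sym (+-suc y y)))

data Offset (i j : ℕ) : Set where
  evenOffset : ∀ σ x → 1 ≤ x → i + x ≡ σ → σ + x ≡ j → Offset i j
  oddOffset  : ∀ τ x → 1 ≤ x → i + x ≡ τ → τ + x ≡ suc j → Offset i j

offset : ∀ {i j} → i < j → Offset i j
offset {i} i<j with m≤n⇒∃[o]m+o≡n i<j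
... | e , refl with halve e
...   | y , inj₁ refl = oddOffset (i + suc y) (suc y) (s≤s z≤n) refl (identity i y)
  where
  identity : ∀ i y → i + suc y + suc y ≡ suc (suc i + (y + y))
  identity = solve-∀
...   | y , inj₂ refl = evenOffset (i + suc y) (suc y) (s≤s z≤n) refl (identity i y)
  where
  identity : ∀ i y → i + suc y + suc y ≡ suc i + suc (y + y)
  identity = solve-∀

-- Comparing an extremal matrix with a special one is thereby reduced to showing that both have the
-- same pattern.
pattern-unique : ∀ {δ p n f g} → Pattern δ p n f → Pattern δ p n g → ∀ {i j} → i < j → j < n → f i j ≡ g i j
pattern-unique {δ} {p} {n} P Q i<j j<n with offset i<j
... | evenOffset σ x 1≤x e e′ with evenRegion δ p n σ x
...   | inside b  = trans (Pattern.even-in P 1≤x e e′ j<n b) (sym (Pattern.even-in Q 1≤x e e′ j<n b))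
...   | outside h = trans (Pattern.even-out P 1≤x e e′ j<n (inj₁ h)) (sym (Pattern.even-out Q 1≤x e e′ j<n (inj₁ h)))
...   | left h    = trans (Pattern.even-out P 1≤x e e′ j<n (inj₂ (inj₁ h)))
    (sym (Pattern.even-out Q 1≤x e e′ j<n (inj₂ (inj₁ h))))
...   | right h   = trans (Pattern.even-out P 1≤x e e′ j<n (inj₂ (inj₂ h)))
    (sym (Pattern.even-out Q 1≤x e e′ j<n (inj₂ (inj₂ h))))
pattern-unique {δ} {p} {n} P Q i<j j<n | oddOffset τ x 1≤x e e′ with oddRegion δ p n τ x
...   | outside h = trans (Pattern.odd-out P 1≤x e e′ j<n (inj₁ h)) (sym (Pattern.odd-out Q 1≤x e e′ j<n (inj₁ h)))
...   | left h    = trans (Pattern.odd-out P 1≤x e e′ j<n (inj₂ (inj₁ h)))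
    (sym (Pattern.odd-out Q 1≤x e e′ j<n (inj₂ (inj₁ h))))
...   | right h   = trans (Pattern.odd-out P 1≤x e e′ j<n (inj₂ (inj₂ h)))
    (sym (Pattern.odd-out Q 1≤x e e′ j<n (inj₂ (inj₂ h))))
...   | inside b with x ≟ 1 | odd (τ + p) in o | odd≤1 (τ + p)
...     | no x≢1   | _ | _ = trans (Pattern.odd-in P 1≤x e e′ j<n b (⊥-elim ∘ x≢1))
    (sym (Pattern.odd-in Q 1≤x e e′ j<n b (⊥-elim ∘ x≢1)))
 
...     | yes refl | 0 | _ = trans (Pattern.odd-in P 1≤x e e′ j<n b (λ _ → o)) (sym (Pattern.odd-in Q 1≤x e e′ j<n b (λ _ → o)))
 
...     | yes refl | 1 | _ = trans (Pattern.odd-hole P e e′ j<n b o) (sym (Pattern.odd-hole Q e e′ j<n b o))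
 
...     | yes refl | suc (suc _) | s≤s ()

zero-value : ∀ {x} → pos x ≡ neg x → x ≡ 0ℤ
zero-value {⁺ zero} _ = refl

plus-value : ∀ {x} → pos x ≡ suc (neg x) → x ≡ 1ℤ
plus-value {⁺ suc zero} _ = refl

minus-value : ∀ {x} → suc (pos x) ≡ neg x → x ≡ -1ℤ
minus-value { -[1+ zero ]} _ = refl

-- `even-cell` and `odd-cell` write an entry as the second difference of the corner sums around its
-- cell, expressed through F; the constant 1 comes from the coordinates. `diag-near` and parity
-- replace flatness in the column x = 0.
module FlatCells (n p p′ δ : ℕ) (δ≤1 : δ ≤ 1) (p′≡ : p′ + δ ≡ suc p) (1≤p : 1 ≤ p)
  (Fₑ Fₒ : ℕ → ℕ → ℕ) (a : ℕ → ℕ → ℤ) (flatₑ : Flat n p Fₑ) (flatₒ : Flat (1 + n) p′ Fₒ)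
  (even-cell : ∀ {i j σ x} → 1 ≤ x → i + x ≡ σ → σ + x ≡ j → j < n →
     pos (a i j) + Fₑ σ x + Fₑ (suc σ) x + 1 ≡ neg (a i j) + Fₒ (suc σ) x + Fₒ (suc σ) (suc x))
  (odd-cell : ∀ {i j τ y} → i + suc y ≡ τ → τ + suc y ≡ suc j → j < n →
     pos (a i j) + Fₒ τ (suc y) + Fₒ (suc τ) (suc y) ≡ neg (a i j) + 1 + Fₑ τ y + Fₑ τ (suc y))
  (diag-near : ∀ {τ} → 1 ≤ τ → τ < n →
     (Fₑ τ 0 ≤ Fₒ τ 1 × Fₒ τ 1 ≤ suc (Fₑ τ 0)) × (Fₑ τ 0 ≤ Fₒ (suc τ) 1 × Fₒ (suc τ) 1 ≤ suc (Fₑ τ 0)))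
  (Fₑ-parity : ∀ τ → τ ≤ n → ∃ λ T → Fₑ τ 0 + 2 * T ≡ τ) where

  private
    module _ {i j σ x} (1≤x : 1 ≤ x) (e : i + x ≡ σ) (e′ : σ + x ≡ j) (j<n : j < n) where
      x≤σ : x ≤ σ
      x≤σ = subst (x ≤_) e (m≤n+m x i)
      σ+x<n : σ + x < n
      σ+x<n = subst (_< n) (sym e′) j<n

      even-zero : ∀ {f g h l} → Fₑ σ x ≡ f → Fₑ (suc σ) x ≡ g → Fₒ (suc σ) x ≡ h → Fₒ (suc σ) (suc x) ≡ l →
                  f + g + 1 ≡ h + l → a i j ≡ 0ℤ
      even-zero refl refl refl refl bal = zero-value
        ((lin 6 λ u v f g h l → u ⊕ f ⊕ g ⊕ # 1 ≈ v ⊕ h ⊕ l ⇒ f ⊕ g ⊕ # 1 ≈ h ⊕ l ⇒ ⊢ u ≈ v)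
          _ _ _ _ _ _ (even-cell 1≤x e e′ j<n) bal)

      even-outside : p < x + δ → a i j ≡ 0ℤ
      even-outside h = even-zero
        (Flat.outside flatₑ 1≤x x≤σ (<⇒≤ σ+x<n) p≤x)
        (Flat.outside flatₑ 1≤x (m≤n⇒m≤1+n x≤σ) σ+x<n p≤x)
        (Flat.outside flatₒ 1≤x (m≤n⇒m≤1+n x≤σ) (m≤n⇒m≤1+n σ+x<n) p′≤x)
        (Flat.outside flatₒ (s≤s z≤n) (s≤s x≤σ) (s≤s (subst (_≤ n) (sym (+-suc σ x)) σ+x<n)) (m≤n⇒m≤1+n p′≤x))
        ((lin 1 λ x → ⊢ x ⊕ x ⊕ # 1 ≈ x ⊕ 1+ x) x)
        where
        p≤x : p ≤ x
        p≤x = (lin 3 λ p x δ → p ≺ x ⊕ δ ⇒ δ ≼ # 1 ⇒ ⊢ p ≼ x) p x δ h δ≤1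
        p′≤x : p′ ≤ x
        p′≤x = (lin 4 λ p p′ x δ → p ≺ x ⊕ δ ⇒ p′ ⊕ δ ≈ 1+ p ⇒ ⊢ p′ ≼ x) p p′ x δ h p′≡

      even-left : σ < p → a i j ≡ 0ℤ
      even-left h = even-zero
        (Flat.left flatₑ 1≤x x≤σ (<⇒≤ σ+x<n) (<⇒≤ h))
        (Flat.left flatₑ 1≤x (m≤n⇒m≤1+n x≤σ) σ+x<n h)
        (Flat.left flatₒ 1≤x (m≤n⇒m≤1+n x≤σ) (m≤n⇒m≤1+n σ+x<n) σ<p′)
        (Flat.left flatₒ (s≤s z≤n) (s≤s x≤σ) (s≤s (subst (_≤ n) (sym (+-suc σ x)) σ+x<n)) σ<p′)
        ((lin 1 λ x → ⊢ x ⊕ 1+ x ⊕ # 1 ≈ 1+ x ⊕ 1+ x) σ)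
        where
        σ<p′ : σ < p′
        σ<p′ = (lin 4 λ p p′ x δ → x ≺ p ⇒ p′ ⊕ δ ≈ 1+ p ⇒ δ ≼ # 1 ⇒ ⊢ x ≺ p′) p p′ σ δ h p′≡ δ≤1

      even-right : n ≤ σ + p → a i j ≡ 0ℤ
      even-right h = even-zero refl refl refl refl
        ((lin 6 λ f g h l σ n → f ⊕ σ ≈ n ⇒ g ⊕ 1+ σ ≈ n ⇒ h ⊕ 1+ σ ≈ 1+ n ⇒ l ⊕ 1+ σ ≈ 1+ n ⇒
            ⊢ f ⊕ g ⊕ # 1 ≈ h ⊕ l) _ _ _ _ σ n
          (Flat.right flatₑ 1≤x x≤σ (<⇒≤ σ+x<n) h)
          (Flat.right flatₑ 1≤x (m≤n⇒m≤1+n x≤σ) σ+x<n (m≤n⇒m≤1+n h))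
          (Flat.right flatₒ 1≤x (m≤n⇒m≤1+n x≤σ) (m≤n⇒m≤1+n σ+x<n) h′)
          (Flat.right flatₒ (s≤s z≤n) (s≤s x≤σ) (s≤s (subst (_≤ n) (sym (+-suc σ x)) σ+x<n)) h′))
        where
        h′ : 1 + n ≤ suc σ + p′
        h′ = (lin 5 λ p p′ x δ n → n ≼ x ⊕ p ⇒ p′ ⊕ δ ≈ 1+ p ⇒ δ ≼ # 1 ⇒ ⊢ 1+ n ≼ 1+ x ⊕ p′)
               p p′ σ δ n h p′≡ δ≤1

      -- On the plateaus the entry is 2p′ - 2p - 1 = 1 - 2δ.
      even-inside : EvenBand δ p n σ x → a i j ≡ even-sign δ
      even-inside (evenBand x+δ≤p p≤σ σ+p<n) = value δ δ≤1 p′≡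
        (Flat.middle flatₑ 1≤x x≤σ (<⇒≤ σ+x<n) x≤p p≤σ (<⇒≤ σ+p<n))
        (Flat.middle flatₑ 1≤x (m≤n⇒m≤1+n x≤σ) σ+x<n x≤p (m≤n⇒m≤1+n p≤σ) σ+p<n)
        (Flat.middle flatₒ 1≤x (m≤n⇒m≤1+n x≤σ) (m≤n⇒m≤1+n σ+x<n) (<⇒≤ x<p′) p′≤σ σ+p′≤n)
        (Flat.middle flatₒ (s≤s z≤n) (s≤s x≤σ) (s≤s (subst (_≤ n) (sym (+-suc σ x)) σ+x<n)) x<p′ p′≤σ σ+p′≤n)
        where
        x≤p : x ≤ p
        x≤p = ≤-trans (m≤m+n x δ) x+δ≤p
        x<p′ : x < p′
        x<p′ = (lin 4 λ p p′ x δ → x ⊕ δ ≼ p ⇒ p′ ⊕ δ ≈ 1+ p ⇒ ⊢ x ≺ p′) p p′ x δ x+δ≤p p′≡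
        p′≤σ : p′ ≤ suc σ
        p′≤σ = (lin 4 λ p p′ σ δ → p ≼ σ ⇒ p′ ⊕ δ ≈ 1+ p ⇒ ⊢ p′ ≼ 1+ σ) p p′ σ δ p≤σ p′≡
        σ+p′≤n : suc σ + p′ ≤ 1 + n
        σ+p′≤n = (lin 5 λ p p′ σ δ n → σ ⊕ p ≺ n ⇒ p′ ⊕ δ ≈ 1+ p ⇒ ⊢ 1+ σ ⊕ p′ ≼ 1+ n) p p′ σ δ n σ+p<n p′≡
        value : ∀ δ → δ ≤ 1 → p′ + δ ≡ suc p → Fₑ σ x ≡ p → Fₑ (suc σ) x ≡ p → Fₒ (suc σ) x ≡ p′ → Fₒ (suc σ) (suc x) ≡ p′ →
                a i j ≡ even-sign δ
        value 0 _ q f g h l = plus-value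
          ((lin 8 λ p p′ u v f g h l → p′ ⊕ # 0 ≈ 1+ p ⇒ f ≈ p ⇒ g ≈ p ⇒ h ≈ p′ ⇒ l ≈ p′ ⇒ u ⊕ f ⊕ g ⊕ # 1 ≈ v ⊕ h ⊕ l ⇒
            ⊢ u ≈ 1+ v)
            p p′ _ _ _ _ _ _ q f g h l (even-cell 1≤x e e′ j<n))
        value 1 _ q f g h l = minus-value
          ((lin 8 λ p p′ u v f g h l → p′ ⊕ # 1 ≈ 1+ p ⇒ f ≈ p ⇒ g ≈ p ⇒ h ≈ p′ ⇒ l ≈ p′ ⇒ u ⊕ f ⊕ g ⊕ # 1 ≈ v ⊕ h ⊕ l ⇒
            ⊢ 1+ u ≈ v)
            p p′ _ _ _ _ _ _ q f g h l (even-cell 1≤x e e′ j<n))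
        value (suc (suc _)) (s≤s ()) _ _ _ _ _

    module _ {i j τ y} (e : i + suc y ≡ τ) (e′ : τ + suc y ≡ suc j) (j<n : j < n) where
      y<τ : suc y ≤ τ
      y<τ = subst (suc y ≤_) e (m≤n+m (suc y) i)
      τ+y≤n : τ + suc y ≤ n
      τ+y≤n = subst (_≤ n) (sym e′) j<n
      τ<n : τ < n
      τ<n = ≤-trans (subst (_≤ τ + suc y) (+-comm τ 1) (+-monoʳ-≤ τ (s≤s z≤n))) τ+y≤n
      1≤τ : 1 ≤ τ
      1≤τ = ≤-trans (s≤s z≤n) y<τ

      odd-zero : ∀ {f g h l} → Fₒ τ (suc y) ≡ f → Fₒ (suc τ) (suc y) ≡ g → Fₑ τ y ≡ h → Fₑ τ (suc y) ≡ l →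
                 f + g ≡ 1 + h + l → a i j ≡ 0ℤ
      odd-zero refl refl refl refl bal = zero-value
        ((lin 6 λ u v f g h l → u ⊕ f ⊕ g ≈ v ⊕ # 1 ⊕ h ⊕ l ⇒ f ⊕ g ≈ 1+ h ⊕ l ⇒ ⊢ u ≈ v)
          _ _ _ _ _ _ (odd-cell e e′ j<n) bal)

      τ≤1+n : τ + suc y ≤ 1 + n
      τ≤1+n = m≤n⇒m≤1+n τ+y≤n

      odd-outside : p < suc y → a i j ≡ 0ℤ
      odd-outside h = odd-zero
        (Flat.outside flatₒ (s≤s z≤n) y<τ τ≤1+n p′≤x)
        (Flat.outside flatₒ (s≤s z≤n) (m≤n⇒m≤1+n y<τ) (s≤s τ+y≤n) p′≤x)
        (Flat.outside flatₑ (≤-trans 1≤p (s≤s⁻¹ h)) (<⇒≤ y<τ) (≤-trans (+-monoʳ-≤ τ (n≤1+n y)) τ+y≤n) (s≤s⁻¹ h))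
        (Flat.outside flatₑ (s≤s z≤n) y<τ τ+y≤n (<⇒≤ h))
        ((lin 1 λ y → ⊢ 1+ y ⊕ 1+ y ≈ 1+ y ⊕ 1+ y) y)
        where
        p′≤x : p′ ≤ suc y
        p′≤x = (lin 4 λ p p′ x δ → p ≺ x ⇒ p′ ⊕ δ ≈ 1+ p ⇒ ⊢ p′ ≼ x) p p′ (suc y) δ h p′≡

      odd-left : τ + δ ≤ p → a i j ≡ 0ℤ
      odd-left h = odd-zero Fₒτ Fₒτ′ (below₀ y refl) (Flat.left flatₑ (s≤s z≤n) y<τ τ+y≤n τ≤p)
        ((lin 1 λ x → ⊢ x ⊕ 1+ x ≈ 1+ x ⊕ x) τ)
        where
        τ≤p : τ ≤ p
        τ≤p = ≤-trans (m≤m+n τ δ) h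
        τ<p′ : τ < p′
        τ<p′ = (lin 4 λ p p′ x δ → x ⊕ δ ≼ p ⇒ p′ ⊕ δ ≈ 1+ p ⇒ ⊢ x ≺ p′) p p′ τ δ h p′≡
        Fₒτ : Fₒ τ (suc y) ≡ τ
        Fₒτ = Flat.left flatₒ (s≤s z≤n) y<τ τ≤1+n (<⇒≤ τ<p′)
        Fₒτ′ : Fₒ (suc τ) (suc y) ≡ suc τ
        Fₒτ′ = Flat.left flatₒ (s≤s z≤n) (m≤n⇒m≤1+n y<τ) (s≤s τ+y≤n) τ<p′
        below₀ : ∀ y₀ → y₀ ≡ y → Fₑ τ y₀ ≡ τ
        below₀ (suc y₀) refl = Flat.left flatₑ (s≤s z≤n) (<⇒≤ y<τ) (≤-trans (+-monoʳ-≤ τ (n≤1+n y)) τ+y≤n) τ≤p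
        -- Flatness does not reach the diagonal vertex, but its two odd neighbours have values τ and
        -- τ + 1 and leave only τ.
        below₀ zero refl = ≤-antisym
          (≤-trans (proj₁ (proj₁ (diag-near 1≤τ τ<n))) (≤-reflexive Fₒτ))
          (s≤s⁻¹ (≤-trans (≤-reflexive (sym Fₒτ′)) (proj₂ (proj₂ (diag-near 1≤τ τ<n)))))

      odd-right : n + δ ≤ τ + p → a i j ≡ 0ℤ
      odd-right h = odd-zero refl refl refl refl
        ((lin 6 λ f g h l τ n → f ⊕ τ ≈ 1+ n ⇒ g ⊕ 1+ τ ≈ 1+ n ⇒ h ⊕ τ ≈ n ⇒ l ⊕ τ ≈ n ⇒ ⊢ f ⊕ g ≈ 1+ h ⊕ l)
          _ _ _ _ τ n Fₒτ Fₒτ′ (below₀ y refl) (Flat.right flatₑ (s≤s z≤n) y<τ τ+y≤n n≤))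
        where
        n≤ : n ≤ τ + p
        n≤ = ≤-trans (m≤m+n n δ) h
        n<′ : 1 + n ≤ τ + p′
        n<′ = (lin 5 λ p p′ x δ n → n ⊕ δ ≼ x ⊕ p ⇒ p′ ⊕ δ ≈ 1+ p ⇒ ⊢ 1+ n ≼ x ⊕ p′) p p′ τ δ n h p′≡
        Fₒτ : Fₒ τ (suc y) + τ ≡ 1 + n
        Fₒτ = Flat.right flatₒ (s≤s z≤n) y<τ τ≤1+n n<′
        Fₒτ′ : Fₒ (suc τ) (suc y) + suc τ ≡ 1 + n
        Fₒτ′ = Flat.right flatₒ (s≤s z≤n) (m≤n⇒m≤1+n y<τ) (s≤s τ+y≤n) (m≤n⇒m≤1+n n<′)
        below₀ : ∀ y₀ → y₀ ≡ y → Fₑ τ y₀ + τ ≡ n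
        below₀ (suc y₀) refl = Flat.right flatₑ (s≤s z≤n) (<⇒≤ y<τ) (≤-trans (+-monoʳ-≤ τ (n≤1+n y)) τ+y≤n) n≤
        below₀ zero refl =
          (lin 5 λ d f g τ n → f ⊕ τ ≈ 1+ n ⇒ g ⊕ 1+ τ ≈ 1+ n ⇒ f ≼ 1+ d ⇒ d ≼ g ⇒ ⊢ d ⊕ τ ≈ n)
            _ _ _ τ n Fₒτ Fₒτ′ (proj₂ (proj₁ (diag-near 1≤τ τ<n))) (proj₁ (proj₂ (diag-near 1≤τ τ<n)))

      module _ (band : OddBand δ p n τ (suc y)) where
        open OddBand band

        p≤τ : p ≤ τ
        p≤τ = (lin 3 λ p τ δ → p ≺ τ ⊕ δ ⇒ δ ≼ # 1 ⇒ ⊢ p ≼ τ) p τ δ τ≥ δ≤1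
        τ+p≤n : τ + p ≤ n
        τ+p≤n = (lin 4 λ p τ δ n → τ ⊕ p ≺ n ⊕ δ ⇒ δ ≼ # 1 ⇒ ⊢ τ ⊕ p ≼ n) p τ δ n τ≤ δ≤1
        x≤p′ : suc y ≤ p′
        x≤p′ = (lin 4 λ p p′ x δ → x ≼ p ⇒ p′ ⊕ δ ≈ 1+ p ⇒ δ ≼ # 1 ⇒ ⊢ x ≼ p′) p p′ (suc y) δ x≤ p′≡ δ≤1
        p′≤τ : p′ ≤ τ
        p′≤τ = (lin 4 λ p p′ τ δ → p ≺ τ ⊕ δ ⇒ p′ ⊕ δ ≈ 1+ p ⇒ ⊢ p′ ≼ τ) p p′ τ δ τ≥ p′≡
        τ+p′≤n : τ + p′ ≤ n
        τ+p′≤n = (lin 5 λ p p′ τ δ n → τ ⊕ p ≺ n ⊕ δ ⇒ p′ ⊕ δ ≈ 1+ p ⇒ ⊢ τ ⊕ p′ ≼ n) p p′ τ δ n τ≤ p′≡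
        Fₒτ : Fₒ τ (suc y) ≡ p′
        Fₒτ = Flat.middle flatₒ (s≤s z≤n) y<τ τ≤1+n x≤p′ p′≤τ (m≤n⇒m≤1+n τ+p′≤n)
        Fₒτ′ : Fₒ (suc τ) (suc y) ≡ p′
        Fₒτ′ = Flat.middle flatₒ (s≤s z≤n) (m≤n⇒m≤1+n y<τ) (s≤s τ+y≤n) x≤p′ (m≤n⇒m≤1+n p′≤τ) (s≤s τ+p′≤n)
        Fₑτ : Fₑ τ (suc y) ≡ p
        Fₑτ = Flat.middle flatₑ (s≤s z≤n) y<τ τ+y≤n x≤ p≤τ τ+p≤n

        -- Here the even plateau sits on the other diagonal of the cell, so the entry is 2p + 1 -
        -- 2p′ = 2δ - 1.
        odd-inside : Fₑ τ y ≡ p → a i j ≡ odd-sign δ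
        odd-inside low = value δ δ≤1 p′≡ Fₒτ Fₒτ′ low Fₑτ
          where
          value : ∀ δ → δ ≤ 1 → p′ + δ ≡ suc p → Fₒ τ (suc y) ≡ p′ → Fₒ (suc τ) (suc y) ≡ p′ → Fₑ τ y ≡ p → Fₑ τ (suc y) ≡ p →
                  a i j ≡ odd-sign δ
          value 0 _ q f g h l = minus-value
            ((lin 8 λ p p′ u v f g h l → p′ ⊕ # 0 ≈ 1+ p ⇒ f ≈ p′ ⇒ g ≈ p′ ⇒ h ≈ p ⇒ l ≈ p ⇒ u ⊕ f ⊕ g ≈ v ⊕ # 1 ⊕ h ⊕ l ⇒
              ⊢ 1+ u ≈ v)
              p p′ _ _ _ _ _ _ q f g h l (odd-cell e e′ j<n))
          value 1 _ q f g h l = plus-value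
            ((lin 8 λ p p′ u v f g h l → p′ ⊕ # 1 ≈ 1+ p ⇒ f ≈ p′ ⇒ g ≈ p′ ⇒ h ≈ p ⇒ l ≈ p ⇒ u ⊕ f ⊕ g ≈ v ⊕ # 1 ⊕ h ⊕ l ⇒
              ⊢ u ≈ 1+ v)
              p p′ _ _ _ _ _ _ q f g h l (odd-cell e e′ j<n))
          value (suc (suc _)) (s≤s ()) _ _ _ _ _

    F₀-odd : ∀ {τ d} → τ ≤ n → Fₑ τ 0 ≡ d → odd (d + p) ≡ odd (τ + p)
    F₀-odd {τ} {d} τ≤n F≡ with Fₑ-parity τ τ≤n
    ... | T , eq = sym (trans (cong odd
        ((lin 5 λ f d τ T p → f ⊕ 2 ⊛ T ≈ τ ⇒ f ≈ d ⇒ ⊢ τ ⊕ p ≈ T ⊕ T ⊕ (d ⊕ p)) (Fₑ τ 0) d τ T p eq F≡))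
                         (odd-double T (d + p)))

    odd-p+p : odd (p + p) ≡ 0
    odd-p+p = trans (cong odd (sym (+-identityʳ (p + p)))) (odd-double p 0)

  flat-pattern : Pattern δ p n a
  flat-pattern = record
    { even-in  = even-inside
    ; even-out = λ { 1≤x e e′ j<n (inj₁ h) → even-outside 1≤x e e′ j<n h
                   ; 1≤x e e′ j<n (inj₂ (inj₁ h)) → even-left 1≤x e e′ j<n h
                   ; 1≤x e e′ j<n (inj₂ (inj₂ h)) → even-right 1≤x e e′ j<n h }
    ; odd-in   = λ { {x = suc y} _ e e′ j<n band not-hole → odd-inside e e′ j<n band (below e e′ j<n band not-hole) }
    ; odd-hole = hole
    ; odd-out  = λ { {x = suc y} _ e e′ j<n (inj₁ h) → odd-outside e e′ j<n h
                   ; {x = suc y} _ e e′ j<n (inj₂ (inj₁ h)) → odd-left e e′ j<n h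
                   ; {x = suc y} _ e e′ j<n (inj₂ (inj₂ h)) → odd-right e e′ j<n h }
    }
    where
    -- The admissible values are p′ - 1 and p′. Since p′ = p + 1 - δ, one of them is p and the other
    -- is p + 1 - 2δ.
    dichotomy : ∀ d → d ≤ p′ → p′ ≤ suc d → (d ≡ p) ⊎ ((d ≡ suc p) ⊎ (suc d ≡ p))
    dichotomy d d≤ ≤d with <-cmp d p
    ... | tri≈ _ d≡p _ = inj₁ d≡p
    ... | tri> _ _ p<d = inj₂ (inj₁
            ((lin 4 λ d p p′ δ → p ≺ d ⇒ d ≼ p′ ⇒ p′ ⊕ δ ≈ 1+ p ⇒ ⊢ d ≈ 1+ p) d p p′ δ p<d d≤ p′≡))
    ... | tri< d<p _ _ = inj₂ (inj₂
            ((lin 4 λ d p p′ δ → d ≺ p ⇒ p′ ≼ 1+ d ⇒ p′ ⊕ δ ≈ 1+ p ⇒ δ ≼ # 1 ⇒ ⊢ 1+ d ≈ p) d p p′ δ d<p ≤d p′≡ δ≤1))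
    odd-suc-double : ∀ m → odd (suc (m + m)) ≡ 1
    odd-suc-double m = trans (cong odd (+-comm 1 (m + m))) (odd-double m 1)
    0≢1 : ¬ 0 ≡ 1
    0≢1 ()
    module _ {i j τ} (e : i + 1 ≡ τ) (e′ : τ + 1 ≡ suc j) (j<n : j < n) (band : OddBand δ p n τ 1) where
      near = diag-near (1≤τ e e′ j<n) (τ<n e e′ j<n)
      τ≤n : τ ≤ n
      τ≤n = <⇒≤ (τ<n e e′ j<n)
      cases : (Fₑ τ 0 ≡ p) ⊎ ((Fₑ τ 0 ≡ suc p) ⊎ (suc (Fₑ τ 0) ≡ p))
      cases = dichotomy (Fₑ τ 0) (≤-trans (proj₁ (proj₁ near)) (≤-reflexive (Fₒτ e e′ j<n band)))
                                 (≤-trans (≤-reflexive (sym (Fₒτ e e′ j<n band))) (proj₂ (proj₁ near)))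
      not-hole⇒p : odd (τ + p) ≡ 0 → Fₑ τ 0 ≡ p
      not-hole⇒p o with cases
      ... | inj₁ F≡p        = F≡p
      ... | inj₂ (inj₁ F≡)  = ⊥-elim (0≢1 (trans (sym o) (trans (sym (F₀-odd τ≤n F≡)) (odd-suc-double p))))
      ... | inj₂ (inj₂ 1+F≡) = ⊥-elim (0≢1 (trans (sym o) (trans (sym (F₀-odd {d = Fₑ τ 0} τ≤n refl))
              (trans (cong odd (trans (cong (Fₑ τ 0 +_) (sym 1+F≡)) (+-suc (Fₑ τ 0) (Fₑ τ 0)))) (odd-suc-double (Fₑ τ 0))))))
      -- Parity pushes the diagonal vertex from `p` to the other admissible value, for which the
      -- second difference is zero.
      hole : odd (τ + p) ≡ 1 → a i j ≡ 0ℤ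
      hole o with cases
      ... | inj₁ F≡p       = ⊥-elim (0≢1 (trans (sym odd-p+p) (trans (F₀-odd τ≤n F≡p) o)))
      ... | inj₂ (inj₁ F≡) = odd-zero e e′ j<n (Fₒτ e e′ j<n band) (Fₒτ′ e e′ j<n band) refl (Fₑτ e e′ j<n band)
              ((lin 4 λ d p p′ δ → d ≈ 1+ p ⇒ d ≼ p′ ⇒ p′ ⊕ δ ≈ 1+ p ⇒ ⊢ p′ ⊕ p′ ≈ 1+ d ⊕ p)
                (Fₑ τ 0) p p′ δ F≡ (≤-trans (proj₁ (proj₁ near)) (≤-reflexive (Fₒτ e e′ j<n band))) p′≡)
      ... | inj₂ (inj₂ F≡) = odd-zero e e′ j<n (Fₒτ e e′ j<n band) (Fₒτ′ e e′ j<n band) refl (Fₑτ e e′ j<n band)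
              ((lin 4 λ d p p′ δ → 1+ d ≈ p ⇒ p′ ≼ 1+ d ⇒ p′ ⊕ δ ≈ 1+ p ⇒ δ ≼ # 1 ⇒ ⊢ p′ ⊕ p′ ≈ 1+ d ⊕ p)
                (Fₑ τ 0) p p′ δ F≡ (≤-trans (≤-reflexive (sym (Fₒτ e e′ j<n band))) (proj₂ (proj₁ near))) p′≡ δ≤1)
    below : ∀ {i j τ y} (e : i + suc y ≡ τ) (e′ : τ + suc y ≡ suc j) (j<n : j < n) (band : OddBand δ p n τ (suc y)) →
            (suc y ≡ 1 → odd (τ + p) ≡ 0) → Fₑ τ y ≡ p
    below {y = suc y} e e′ j<n band _ =
      Flat.middle flatₑ (s≤s z≤n) (<⇒≤ (y<τ e e′ j<n)) (≤-trans (+-monoʳ-≤ _ (n≤1+n (suc y))) (τ+y≤n e e′ j<n))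
        (<⇒≤ (OddBand.x≤ band)) (p≤τ e e′ j<n band) (τ+p≤n e e′ j<n band)
    below {y = zero} e e′ j<n band not-hole = not-hole⇒p e e′ j<n band (not-hole refl)

-- Three patterns for the extremal matrices

module TightMatrix (k : ℕ) (1≤k : 1 ≤ k) (A : Matrix (4 * k)) (asm : IsASM A) (symm : Symmetric A)
    (zdiag : ZeroDiagonal A) where

  open Corner A asm symm zdiag public

  n : ℕ
  n = order k

  n≡ : n ≡ 4 * k
  n≡ = (lin 1 λ k → ⊢ 2 ⊛ (2 ⊛ k) ≈ 4 ⊛ k) k

  ≤n : ∀ {i} → i ≤ n → i ≤ 4 * k
  ≤n {i} = subst (i ≤_) n≡

  corners : Corners k C
  corners = record
    { 1≤k   = 1≤k
    ; top   = C-top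
    ; right = λ i i≤n → trans (cong (C i) n≡) (C-end i (≤n i≤n))
    ; C-sym = λ i j i≤n j≤n → C-sym i j (≤n i≤n) (≤n j≤n)
    ; C≤row = C≤row
    ; even  = λ i i≤n → C-even i (≤n i≤n)
    ; diag  = λ i i<n → zero-diag i (≤n i<n)
    }

  private
    16k² : ∀ k → (4 * k) * (4 * k) ≡ 16 * (k * k)
    16k² = solve-∀

    count : nnz A + zeros C n ≡ 16 * (k * k)
    count = trans (cong (λ m → nnz A + zeros C m) n≡) (trans nnz+zeros (16k² k))

  nnz-bound : nnz A + 4 * k ≤ 8 * (k * k)
  nnz-bound = (lin 4 λ c z k s → c ⊕ z ≈ 16 ⊛ s ⇒ 2 ⊛ (2 ⊛ k) ⊕ 8 ⊛ s ≼ z ⇒ ⊢ c ⊕ 4 ⊛ k ≼ 8 ⊛ s)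
    (nnz A) (zeros C n) k (k * k) count (CornerSums.zeros-bound corners)

  second-difference : ∀ {i j} → i < 4 * k → j < 4 * k →
    C (suc i) (suc j) + C i j + neg (a i j) ≡ C (suc i) j + C i (suc j) + pos (a i j)
  second-difference {i} {j} i<n j<n =
    (lin 6 λ ne c β β′ u v → β′ ⊕ v ≈ β ⊕ u ⇒ ⊢ (ne ⊕ β′) ⊕ c ⊕ v ≈ (c ⊕ β) ⊕ ne ⊕ u)
      (C i (suc j)) (C i j) (b i j) (b i (suc j)) (pos (a i j)) (neg (a i j)) (b-step i<n j<n)

  even-cell : ∀ {i j σ x} → 1 ≤ x → i + x ≡ σ → σ + x ≡ j → j < n →
    pos (a i j) + Fₑ C σ x + Fₑ C (suc σ) x + 1 ≡ neg (a i j) + Fₒ C (suc σ) x + Fₒ C (suc σ) (suc x)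
  even-cell {i} {j} {σ} {x} 1≤x refl refl j<n =
    (lin 11 λ nw se sw ne fnw fse fsw fne σ u v →
        fnw ⊕ nw ≈ σ ⇒ fse ⊕ se ≈ 1+ σ ⇒ fsw ⊕ sw ≈ 1+ σ ⇒ fne ⊕ ne ≈ 1+ σ ⇒
        se ⊕ nw ⊕ v ≈ sw ⊕ ne ⊕ u ⇒ ⊢ u ⊕ fnw ⊕ fse ⊕ # 1 ≈ v ⊕ fsw ⊕ fne)
      (C i j) (C (suc i) (suc j)) (C (suc i) j) (C i (suc j)) _ _ _ _ σ _ _
      (CornerSums.Fₑ-spec corners refl refl (<⇒≤ j<n)) (CornerSums.Fₑ-spec corners refl refl j<n)
      (CornerSums.Fₒ-spec corners refl refl 1≤x (<⇒≤ j<n))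
      (CornerSums.Fₒ-spec corners {i} {suc j} {suc σ} {suc x} (+-suc i x) (cong suc (+-suc σ x)) (s≤s z≤n) j<n)
      (second-difference (≤-trans (s≤s (≤-trans (m≤m+n i x) (m≤m+n σ x))) (≤n j<n)) (≤n j<n))

  odd-cell : ∀ {i j τ y} → i + suc y ≡ τ → τ + suc y ≡ suc j → j < n →
    pos (a i j) + Fₒ C τ (suc y) + Fₒ C (suc τ) (suc y) ≡ neg (a i j) + 1 + Fₑ C τ y + Fₑ C τ (suc y)
  odd-cell {i} {j} {τ} {y} refl e j<n =
    (lin 11 λ nw se sw ne fnw fse fsw fne τ u v →
        fnw ⊕ nw ≈ τ ⇒ fse ⊕ se ≈ 1+ τ ⇒ fsw ⊕ sw ≈ τ ⇒ fne ⊕ ne ≈ τ ⇒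
        se ⊕ nw ⊕ v ≈ sw ⊕ ne ⊕ u ⇒ ⊢ u ⊕ fnw ⊕ fse ≈ v ⊕ # 1 ⊕ fsw ⊕ fne)
      (C i j) (C (suc i) (suc j)) (C (suc i) j) (C i (suc j)) _ _ _ _ τ _ _
      (CornerSums.Fₒ-spec corners refl e (s≤s z≤n) (<⇒≤ j<n)) (CornerSums.Fₒ-spec corners refl (cong suc e) (s≤s z≤n) j<n)
      (CornerSums.Fₑ-spec corners {suc i} {j} {τ} {y} (sym (+-suc i y)) (suc-injective (trans (sym (+-suc τ y)) e)) (<⇒≤ j<n))
      (CornerSums.Fₑ-spec corners refl e j<n)
      (second-difference i<n (≤n j<n))
    where
    i<n : i < 4 * k
    i<n = (lin 4 λ i y j n → i ⊕ 1+ y ⊕ 1+ y ≈ 1+ j ⇒ j ≺ n ⇒ ⊢ i ≺ n) i y j (4 * k) e (≤n j<n)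

  -- Adjacent vertices differ by 1 in height, hence by 0 or 1 in the halved, rounded values.
  diag-near : ∀ {τ} → 1 ≤ τ → τ < n →
    (Fₑ C τ 0 ≤ Fₒ C τ 1 × Fₒ C τ 1 ≤ suc (Fₑ C τ 0)) × (Fₑ C τ 0 ≤ Fₒ C (suc τ) 1 × Fₒ C (suc τ) 1 ≤ suc (Fₑ C τ 0))
  diag-near {suc i} _ τ<n =
    ((lin 5 λ f f′ c β τ → f ⊕ (c ⊕ β) ≈ 1+ τ ⇒ f′ ⊕ c ≈ 1+ τ ⇒ ⊢ f ≼ f′) _ _ (C i τ) (b i τ) i specₑ specₒ ,
     (lin 5 λ f f′ c β τ → f ⊕ (c ⊕ β) ≈ 1+ τ ⇒ f′ ⊕ c ≈ 1+ τ ⇒ β ≼ # 1 ⇒ ⊢ f′ ≼ 1+ f) _ _ (C i τ) (b i τ) i specₑ specₒ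
       (b≤1 i τ)) ,
    ((lin 5 λ f f′ c β τ → f ⊕ c ≈ τ ⇒ f′ ⊕ (c ⊕ β) ≈ 1+ τ ⇒ β ≼ # 1 ⇒ ⊢ f ≼ f′) _ _ (C τ τ) (b τ τ) τ specₑ specₒ′ (b≤1 τ τ) ,
     (lin 5 λ f f′ c β τ → f ⊕ c ≈ τ ⇒ f′ ⊕ (c ⊕ β) ≈ 1+ τ ⇒ ⊢ f′ ≼ 1+ f) _ _ (C τ τ) (b τ τ) τ specₑ specₒ′)
    where
    τ = suc i
    specₑ : Fₑ C τ 0 + C τ τ ≡ τ
    specₑ = CornerSums.Fₑ-spec corners (+-identityʳ τ) (+-identityʳ τ) (<⇒≤ τ<n)
    specₒ : Fₒ C τ 1 + C i τ ≡ τ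
    specₒ = CornerSums.Fₒ-spec corners (+-comm i 1) (+-comm τ 1) ≤-refl (<⇒≤ τ<n)
    specₒ′ : Fₒ C (suc τ) 1 + (C τ τ + b τ τ) ≡ suc τ
    specₒ′ = subst (λ c → Fₒ C (suc τ) 1 + c ≡ suc τ) (C-right (≤n (<⇒≤ τ<n)) (≤n τ<n))
               (CornerSums.Fₒ-spec corners (+-comm τ 1) (cong suc (+-comm τ 1)) ≤-refl τ<n)

  private
    Fₑ-near : ∀ {i σ} → i + 1 ≡ σ → suc σ ≤ n → Fₑ C σ 1 ≤ Fₒ C σ 1
    Fₑ-near {i} {σ} e σ<n = (lin 5 λ f f′ c β σ → f ⊕ (c ⊕ β) ≈ σ ⇒ f′ ⊕ c ≈ σ ⇒ ⊢ f ≼ f′) (Fₑ C σ 1) (Fₒ C σ 1) (C i σ)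
        (b σ i) σ
      (subst (λ c → Fₑ C σ 1 + c ≡ σ) (C-right (≤n i≤n) (≤n σ<n)) (CornerSums.Fₑ-spec corners {i} {suc σ} e (+-comm σ 1) σ<n))
      (CornerSums.Fₒ-spec corners {i} {σ} e (+-comm σ 1) ≤-refl (<⇒≤ σ<n))
      where
      i≤n : i ≤ n
      i≤n = ≤-trans (m≤m+n i 1) (≤-trans (≤-reflexive e) (<⇒≤ σ<n))

    -- At σ = 2k, x = 1 both plateaus are present on adjacent vertices. The even value cannot exceed
    -- the odd one there, which excludes k + 1 next to k.
    lattices-agree : ∀ {p p′} → Flat n p (Fₑ C) → Flat (1 + n) p′ (Fₒ C) → p′ ≡ k → p ≡ suc k → ⊥
    lattices-agree flatₑ flatₒ refl refl = <⇒≱ ≤-refl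
        (≤-trans (≤-reflexive (sym atₑ)) (≤-trans (Fₑ-near (m∸n+n≡m 1≤2k) 2k<n) (≤-reflexive atₒ)))
      where
      1≤2k : 1 ≤ 2 * k
      1≤2k = ≤-trans 1≤k (m≤m+n k _)
      2k<n : suc (2 * k) ≤ n
      2k<n = (lin 1 λ k → # 1 ≼ k ⇒ ⊢ 1+ (2 ⊛ k) ≼ 2 ⊛ (2 ⊛ k)) k 1≤k
      2k+1≤n : 2 * k + 1 ≤ n
      2k+1≤n = subst (_≤ n) (+-comm 1 (2 * k)) 2k<n
      k<2k : suc k ≤ 2 * k
      k<2k = (lin 1 λ k → # 1 ≼ k ⇒ ⊢ 1+ k ≼ 2 ⊛ k) k 1≤k
      atₑ : Fₑ C (2 * k) 1 ≡ suc k
      atₑ = Flat.middle flatₑ ≤-refl 1≤2k 2k+1≤n (s≤s z≤n) k<2k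
        ((lin 1 λ k → # 1 ≼ k ⇒ ⊢ 2 ⊛ k ⊕ 1+ k ≼ 2 ⊛ (2 ⊛ k)) k 1≤k)
      atₒ : Fₒ C (2 * k) 1 ≡ k
      atₒ = Flat.middle flatₒ ≤-refl 1≤2k (m≤n⇒m≤1+n 2k+1≤n) 1≤k (<⇒≤ k<2k)
        ((lin 1 λ k → ⊢ 2 ⊛ k ⊕ k ≼ 1+ (2 ⊛ (2 ⊛ k))) k)

    cells : ∀ δ {p p′} → δ ≤ 1 → p′ + δ ≡ suc p → 1 ≤ p → Flat n p (Fₑ C) → Flat (1 + n) p′ (Fₒ C) → Pattern δ p (4 * k) a
    cells δ {p} {p′} δ≤1 p′≡ 1≤p flatₑ flatₒ = subst (λ n → Pattern δ p n a) n≡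
      (FlatCells.flat-pattern n p p′ δ δ≤1 p′≡ 1≤p (Fₑ C) (Fₒ C) a flatₑ flatₒ even-cell odd-cell diag-near
        (CornerSums.Fₑ-parity corners))

  tight-pattern : 8 * (k * k) ≤ nnz A + 4 * k →
                  Pattern 0 k (4 * k) a ⊎ (Pattern 1 k (4 * k) a ⊎ Pattern 1 (suc k) (4 * k) a)
  tight-pattern tight = conclude (CornerSums.zeros-tight corners
      ((lin 4 λ c z k s → c ⊕ z ≈ 16 ⊛ s ⇒ 8 ⊛ s ≼ c ⊕ 4 ⊛ k ⇒ ⊢ z ≼ 2 ⊛ (2 ⊛ k) ⊕ 8 ⊛ s) (nnz A) (zeros C n) k
        (k * k) count tight))
    where
    conclude : (∃ λ p′ → ∃ λ p → (Flat (1 + n) p′ (Fₒ C) × Flat n p (Fₑ C)) ×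
        (((p′ ≡ k) ⊎ (p′ ≡ suc k)) × ((p ≡ k) ⊎ (p ≡ suc k)))) →
               Pattern 0 k (4 * k) a ⊎ (Pattern 1 k (4 * k) a ⊎ Pattern 1 (suc k) (4 * k) a)
    conclude (_ , _ , (fo , fe) , (inj₁ po   , inj₂ pe))   = ⊥-elim (lattices-agree fe fo po pe)
    conclude (_ , _ , (fo , fe) , (inj₂ refl , inj₁ refl)) = inj₁ (cells 0 z≤n (+-identityʳ (suc k)) 1≤k fe fo)
    conclude (_ , _ , (fo , fe) , (inj₁ refl , inj₁ refl)) = inj₂ (inj₁ (cells 1 ≤-refl (+-comm k 1) 1≤k fe fo))
    conclude (_ , _ , (fo , fe) , (inj₂ refl , inj₂ refl)) = inj₂ (inj₂ (cells 1 ≤-refl (+-comm (suc k) 1) (s≤s z≤n) fe fo))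

-- The special matrices have these patterns

T⇒≡true : ∀ {b} → T b → b ≡ true
T⇒≡true {true} _ = refl

≤ᵇ-true : ∀ {m n} → m ≤ n → (m ≤ᵇ n) ≡ true
≤ᵇ-true m≤n = T⇒≡true (≤⇒≤ᵇ m≤n)

≤ᵇ-false : ∀ {m n} → n < m → (m ≤ᵇ n) ≡ false
≤ᵇ-false {m} {n} n<m with m ≤ᵇ n in eq
... | false = refl
... | true  = ⊥-elim (<⇒≱ n<m (≤ᵇ⇒≤ m n (subst T (sym eq) _)))

≡ᵇ-refl : ∀ n → (n ≡ᵇ n) ≡ true
≡ᵇ-refl zero    = refl
≡ᵇ-refl (suc n) = ≡ᵇ-refl n

≡ᵇ-sound : ∀ m n → (m ≡ᵇ n) ≡ true → m ≡ n
≡ᵇ-sound m n eq = ≡ᵇ⇒≡ m n (subst T (sym eq) _)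

module _ {A : Set} {lo hi s w d : ℕ} {v o : A} where

  guard-in : lo ≤ s → s ≤ hi → d ≤ w → (if (lo ≤ᵇ s) ∧ (s ≤ᵇ hi) ∧ (d ≤ᵇ w) then v else o) ≡ v
  guard-in p q r rewrite ≤ᵇ-true p | ≤ᵇ-true q | ≤ᵇ-true r = refl

  guard-out : (s < lo) ⊎ ((hi < s) ⊎ (w < d)) → (if (lo ≤ᵇ s) ∧ (s ≤ᵇ hi) ∧ (d ≤ᵇ w) then v else o) ≡ o
  guard-out (inj₁ p) rewrite ≤ᵇ-false p = refl
  guard-out (inj₂ (inj₁ p)) rewrite ≤ᵇ-false p | ∧-zeroʳ (lo ≤ᵇ s) = refl
  guard-out (inj₂ (inj₂ p)) rewrite ≤ᵇ-false p | ∧-zeroʳ (s ≤ᵇ hi) | ∧-zeroʳ (lo ≤ᵇ s) = refl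

module Masked (b : Bool) (v : ℤ) where

  plain : ∀ {w} → b ≡ false → v ≡ w → (if b then 0ℤ else v) ≡ w
  plain refl e = e

  void : v ≡ 0ℤ → (if b then 0ℤ else v) ≡ 0ℤ
  void e = masked b
    where
    masked : ∀ c → (if c then 0ℤ else v) ≡ 0ℤ
    masked true  = refl
    masked false = e

  hole : b ≡ true → (if b then 0ℤ else v) ≡ 0ℤ
  hole refl = refl

exponent : ∀ {s e} m c → s ≡ e + (m + c) → s ∸ m ∸ c ≡ e
exponent {s} {e} m c refl = trans (∸-+-assoc (e + (m + c)) m c) (m+n∸n≡m e (m + c))

signPow-double : ∀ y → signPow (y + y) ≡ 1ℤ
signPow-double zero    = refl
signPow-double (suc y) rewrite +-suc y y = signPow-double y

signPow-suc-double : ∀ y → signPow (suc (y + y)) ≡ -1ℤ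
signPow-suc-double zero    = refl
signPow-suc-double (suc y) rewrite +-suc y y = signPow-suc-double y

dist-≤ : ∀ {a b w} → a ≤ b + w → b ≤ a + w → ∣ a - b ∣ ≤ w
dist-≤ {a} {b} {w} p q with ≤-total a b
... | inj₁ a≤b rewrite m≤n⇒∣m-n∣≡n∸m a≤b = m≤n+o⇒m∸n≤o b a q
... | inj₂ b≤a rewrite m≤n⇒∣n-m∣≡n∸m b≤a = m≤n+o⇒m∸n≤o a b p

dist-> : ∀ {a b w} → (b + w < a) ⊎ (a + w < b) → w < ∣ a - b ∣
dist-> {a} {b} {w} (inj₁ h) = ≰⇒> λ le → <⇒≱ h (≤-trans (m≤n+∣m-n∣ a b) (+-monoʳ-≤ b le))
dist-> {a} {b} {w} (inj₂ h) = ≰⇒> λ le → <⇒≱ h (≤-trans (m≤n+∣m-n∣ b a) (+-monoʳ-≤ a (subst (_≤ w) (∣-∣-comm a b) le)))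

dEntry-sym : ∀ m i j → dEntry m i j ≡ dEntry m j i
dEntry-sym m i j rewrite +-comm i j | ∣-∣-comm i j = refl

eEntry-sym : ∀ k i j → eEntry k i j ≡ eEntry k j i
eEntry-sym k i j rewrite +-comm i j | ∣-∣-comm i j = refl

any-upTo-true : ∀ (f : ℕ → Bool) h r {y} → y < r → f (suc (h y)) ≡ true → any f (map suc (applyUpTo h r)) ≡ true
any-upTo-true f h (suc r) {zero}  _         e rewrite e = refl
any-upTo-true f h (suc r) {suc y} (s≤s y<r) e with f (suc (h 0))
... | true  = refl
... | false = any-upTo-true f (h ∘ suc) r y<r e

any-upTo-false : ∀ (f : ℕ → Bool) h r → (∀ y → y < r → f (suc (h y)) ≡ false) → any f (map suc (applyUpTo h r)) ≡ false
any-upTo-false f h zero    e = refl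
any-upTo-false f h (suc r) e rewrite e 0 (s≤s z≤n) = any-upTo-false f (h ∘ suc) r (λ y y<r → e (suc y) (s≤s y<r))

any-upTo-cong : ∀ (f g : ℕ → Bool) → (∀ t → f t ≡ g t) → ∀ h r → any f (map suc (applyUpTo h r)) ≡ any g
    (map suc (applyUpTo h r))
any-upTo-cong f g e h zero    = refl
any-upTo-cong f g e h (suc r) = cong₂ _∨_ (e _) (any-upTo-cong f g e (h ∘ suc) r)

hollow₁-sym : ∀ k i j → hollow₁ k i j ≡ hollow₁ k j i
hollow₁-sym k i j = any-upTo-cong _ _ (λ t → ∧-comm (block t i) (block t j)) id k
  where
  block : ℕ → ℕ → Bool
  block t x = (x ≡ᵇ (k + 2 * t ∸ 1)) ∨ (x ≡ᵇ (k + 2 * t))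

hollow₂-sym : ∀ k i j → hollow₂ k i j ≡ hollow₂ k j i
hollow₂-sym k i j = any-upTo-cong _ _ (λ t → ∧-comm (block t i) (block t j)) id (k ∸ 1)
  where
  block : ℕ → ℕ → Bool
  block t x = (x ≡ᵇ (k + 2 * t)) ∨ (x ≡ᵇ (k + 2 * t + 1))

pair-first : ∀ {a b x} → x ≡ a → ((x ≡ᵇ a) ∨ (x ≡ᵇ b)) ≡ true
pair-first {a} refl rewrite ≡ᵇ-refl a = refl

pair-second : ∀ {a b x} → x ≡ b → ((x ≡ᵇ a) ∨ (x ≡ᵇ b)) ≡ true
pair-second {a} {b} refl rewrite ≡ᵇ-refl b with b ≡ᵇ a
... | true  = refl
... | false = refl

pair-elim : ∀ {a b x} → ((x ≡ᵇ a) ∨ (x ≡ᵇ b)) ≡ true → (x ≡ a) ⊎ (x ≡ b)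
pair-elim {a} {b} {x} e with x ≡ᵇ a in eq
... | true  = inj₁ (≡ᵇ-sound x a eq)
... | false = inj₂ (≡ᵇ-sound x b e)

both : ∀ {p q} → p ≡ true → q ≡ true → (p ∧ q) ≡ true
both refl refl = refl

-- Of the four cells of a hollowed 2 × 2 block only the upper right one lies above the main
-- diagonal.
block-false : ∀ {a b i j} → b ≡ suc a → i < j → ¬ (i ≡ a × j ≡ suc i) →
              (((i ≡ᵇ a) ∨ (i ≡ᵇ b)) ∧ ((j ≡ᵇ a) ∨ (j ≡ᵇ b))) ≡ false
block-false {a} {b} {i} {j} refl i<j miss with (i ≡ᵇ a) ∨ (i ≡ᵇ b) in e | (j ≡ᵇ a) ∨ (j ≡ᵇ b) in e′
... | false | _     = refl
... | true  | false = refl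
... | true  | true  = ⊥-elim (case (pair-elim {a} {b} {i} e) (pair-elim {a} {b} {j} e′))
  where
  case : (i ≡ a) ⊎ (i ≡ suc a) → (j ≡ a) ⊎ (j ≡ suc a) → ⊥
  case (inj₁ refl) (inj₂ refl) = miss (refl , refl)
  case (inj₁ refl) (inj₁ refl) = <-irrefl refl i<j
  case (inj₂ refl) (inj₁ refl) = <⇒≱ i<j (n≤1+n _)
  case (inj₂ refl) (inj₂ refl) = <-irrefl refl i<j

module _ (k : ℕ) where

  private
    start₁ : ∀ y → suc (k + 2 * suc y ∸ 1) ≡ k + 2 * suc y
    start₁ y = m+[n∸m]≡n {1} ((lin 2 λ k y → ⊢ # 1 ≼ k ⊕ 2 ⊛ 1+ y) k y)

  hollow₁-hit : ∀ {i j} y → y < k → (suc i ≡ k + 2 * suc y) ⊎ (i ≡ k + 2 * suc y) → (suc j ≡ k + 2 * suc y) ⊎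
      (j ≡ k + 2 * suc y) →
                hollow₁ k i j ≡ true
  hollow₁-hit {i} {j} y y<k hi hj = any-upTo-true _ id k y<k (both (within i hi) (within j hj))
    where
    within : ∀ x → (suc x ≡ k + 2 * suc y) ⊎ (x ≡ k + 2 * suc y) → ((x ≡ᵇ (k + 2 * suc y ∸ 1)) ∨ (x ≡ᵇ (k + 2 * suc y))) ≡ true
    within x (inj₁ e) = pair-first {k + 2 * suc y ∸ 1} {k + 2 * suc y} (suc-injective (trans e (sym (start₁ y))))
    within x (inj₂ e) = pair-second {k + 2 * suc y ∸ 1} {k + 2 * suc y} e

  -- The upper right cell of block t has row index k + 2t - 1, so i + k is odd there.
  hollow₁-miss : ∀ {i j} → i < j → ¬ (j ≡ suc i × odd (i + k) ≡ 1) → hollow₁ k i j ≡ false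
  hollow₁-miss {i} {j} i<j miss = any-upTo-false _ id k λ y _ →
    block-false (sym (start₁ y)) i<j λ { (refl , j≡) → miss (j≡ , trans (cong odd (shift y)) (odd-double (k + y) 1)) }
    where
    shift : ∀ y → k + 2 * suc y ∸ 1 + k ≡ k + y + (k + y) + 1
    shift y = (lin 3 λ a k y → 1+ a ≈ k ⊕ 2 ⊛ 1+ y ⇒ ⊢ a ⊕ k ≈ k ⊕ y ⊕ (k ⊕ y) ⊕ # 1) _ k y (start₁ y)

  hollow₂-hit : ∀ {i j} y → suc y < k → (i ≡ k + 2 * suc y) ⊎ (i ≡ k + 2 * suc y + 1) → (j ≡ k + 2 * suc y) ⊎
      (j ≡ k + 2 * suc y + 1) →
                hollow₂ k i j ≡ true
  hollow₂-hit {i} {j} y y<k hi hj = any-upTo-true _ id (k ∸ 1) (m+n≤o⇒m≤o∸n (suc y) (subst (_≤ k) (+-comm 1 (suc y)) y<k))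
      (both (within i hi) (within j hj))
    where
    within : ∀ x → (x ≡ k + 2 * suc y) ⊎ (x ≡ k + 2 * suc y + 1) → ((x ≡ᵇ (k + 2 * suc y)) ∨ (x ≡ᵇ (k + 2 * suc y + 1))) ≡ true
    within x (inj₁ e) = pair-first {k + 2 * suc y} {k + 2 * suc y + 1} e
    within x (inj₂ e) = pair-second {k + 2 * suc y} {k + 2 * suc y + 1} e

  hollow₂-miss : ∀ {i j} → i < j → ¬ (j ≡ suc i × odd (i + suc k) ≡ 1) → hollow₂ k i j ≡ false
  hollow₂-miss {i} {j} i<j miss = any-upTo-false _ id (k ∸ 1) λ y _ →
    block-false (+-comm (k + 2 * suc y) 1) i<j λ { (refl , j≡) → miss
        (j≡ , trans (cong odd (shift k y)) (odd-double (k + suc y) 1)) }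
    where
    shift : ∀ k y → k + 2 * suc y + suc k ≡ k + suc y + (k + suc y) + 1
    shift = solve-∀

  -- Indices are 0-based here, 1-based in Defs.

  entry₁ entry₂ entry₃ : ℕ → ℕ → ℤ
  entry₁ i j = if hollow₁ k (suc i) (suc j) then 0ℤ else dEntry (2 * k) (suc i) (suc j)
  entry₂ i j = if hollow₁ k (suc i) (suc j) then 0ℤ else dEntry (2 * k) (suc (4 * k ∸ suc i)) (suc j)
  entry₃ i j = if hollow₂ k (suc i) (suc j) then 0ℤ else eEntry k (suc i) (suc j)

  matrix₂ : ∀ i j → hollowedDiamond₂ k i j ≡ entry₂ (toℕ i) (toℕ j)
  matrix₂ i j = cong (λ u → if hollow₁ k (suc (toℕ i)) (suc (toℕ j)) then 0ℤ else dEntry (2 * k) (suc u) (suc (toℕ j)))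
      (opposite-prop i)

  entry₁-sym : ∀ i j → entry₁ i j ≡ entry₁ j i
  entry₁-sym i j = cong₂ (λ b v → if b then 0ℤ else v) (hollow₁-sym k (suc i) (suc j)) (dEntry-sym (2 * k) (suc i) (suc j))

  entry₃-sym : ∀ i j → entry₃ i j ≡ entry₃ j i
  entry₃-sym i j = cong₂ (λ b v → if b then 0ℤ else v) (hollow₂-sym k (suc i) (suc j)) (eEntry-sym k (suc i) (suc j))

1≰0 : 1 ≤ 0 → ⊥
1≰0 ()

even-miss : ∀ {i j σ x} → 1 ≤ x → i + x ≡ σ → σ + x ≡ j → ¬ suc j ≡ suc (suc i)
even-miss {i} {j} {σ} {x} 1≤x e e′ j≡ = 1≰0 ((lin 4 λ i j σ x → # 1 ≼ x ⇒ (on-even i j σ x $ 1+ j ≈ # 2 ⊕ i ⇒ ⊢ # 1 ≼ # 0))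
  i j σ x 1≤x e e′ j≡)

odd-miss : ∀ {i j τ x p} → i + x ≡ τ → τ + x ≡ suc j → (x ≡ 1 → odd (τ + p) ≡ 0) → ¬ (suc j ≡ suc (suc i) × odd (suc i + p) ≡ 1)
odd-miss {i} {j} {τ} {x} {p} e e′ not-hole (j≡ , o) with
  trans (sym (not-hole ((lin 4 λ i j τ x → on-odd i j τ x $ 1+ j ≈ # 2 ⊕ i ⇒ ⊢ x ≈ # 1) i j τ x e e′ j≡)))
        (trans (cong (λ u → odd (u + p)) ((lin 4 λ i j τ x → on-odd i j τ x $ 1+ j ≈ # 2 ⊕ i ⇒ ⊢ τ ≈ 1+ i) i j τ x e e′ j≡)) o)
... | ()

even-< : ∀ {i j σ x} → 1 ≤ x → i + x ≡ σ → σ + x ≡ j → i < j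
even-< {i} {j} {σ} {x} = (lin 4 λ i j σ x → # 1 ≼ x ⇒ (on-even i j σ x $ ⊢ i ≺ j)) i j σ x

odd-< : ∀ {i j τ x} → 1 ≤ x → i + x ≡ τ → τ + x ≡ suc j → i < j
odd-< {i} {j} {σ} {x} = (lin 4 λ i j σ x → # 1 ≼ x ⇒ (on-odd i j σ x $ ⊢ i ≺ j)) i j σ x

odd-offset : ∀ {c τ} p → c ≤ τ → odd (τ + p) ≡ 1 → odd (c + p) ≡ 1 → ∃ λ y → τ ≡ c + (y + y)
odd-offset {c} {τ} p c≤τ o o′ with m≤n⇒∃[o]m+o≡n c≤τ
... | e , refl with halve e
...   | y , inj₁ refl = y , refl
...   | y , inj₂ refl with trans (sym (odd-suc (c + p)))
    (trans (+-comm (odd (c + p)) _)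
      (cong₂ _+_ (trans (sym (odd-double y (suc (c + p)))) (trans (cong odd (shift c p y)) o)) o′))
  where
  shift : ∀ c p y → y + y + suc (c + p) ≡ c + suc (y + y) + p
  shift = solve-∀
...     | ()

dEntry-in : ∀ m i j e → m + 2 ≤ i + j → i + j ≤ 3 * m → ∣ i - j ∣ ≤ m → i + j ≡ e + (m + 2) → dEntry m i j ≡ signPow e
dEntry-in m i j e p q r h = trans (guard-in {lo = m + 2} {3 * m} {i + j} {m} {∣ i - j ∣} p q r)
    (cong signPow (exponent {i + j} {e} m 2 h))

dEntry-out : ∀ m i j → (i + j < m + 2) ⊎ ((3 * m < i + j) ⊎ (m < ∣ i - j ∣)) → dEntry m i j ≡ 0ℤ
dEntry-out m i j = guard-out {lo = m + 2} {3 * m} {i + j} {m} {∣ i - j ∣}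

eEntry-in : ∀ k i j e → 2 * k + 3 ≤ i + j → i + j ≤ 6 * k ∸ 1 → ∣ i - j ∣ ≤ 2 * k + 1 → i + j ≡ e + (2 * k + 3) →
    eEntry k i j ≡ signPow e
eEntry-in k i j e p q r h = trans (guard-in {lo = 2 * k + 3} {6 * k ∸ 1} {i + j} {2 * k + 1} {∣ i - j ∣} p q r)
    (cong signPow (exponent {i + j} {e} (2 * k) 3 h))

eEntry-out : ∀ k i j → (i + j < 2 * k + 3) ⊎ ((6 * k ∸ 1 < i + j) ⊎ (2 * k + 1 < ∣ i - j ∣)) → eEntry k i j ≡ 0ℤ
eEntry-out k i j = guard-out {lo = 2 * k + 3} {6 * k ∸ 1} {i + j} {2 * k + 1} {∣ i - j ∣}

module Entry₁ (k i j : ℕ) = Masked (hollow₁ k (suc i) (suc j)) (dEntry (2 * k) (suc i) (suc j))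
module Entry₂ (k i j : ℕ) = Masked (hollow₁ k (suc i) (suc j)) (dEntry (2 * k) (suc (4 * k ∸ suc i)) (suc j))
module Entry₃ (k i j : ℕ) = Masked (hollow₂ k (suc i) (suc j)) (eEntry k (suc i) (suc j))

-- In 1-based indices i + j is 2σ + 2 or 2τ + 1. The guard on the sum bounds σ or τ, the guard on
-- the distance bounds x, and the exponent is 2(σ - k) or 2(τ - k - 1) + 1.
pattern₁ : ∀ k → Pattern 0 k (4 * k) (entry₁ k)
pattern₁ k = record { even-in = even-in ; even-out = even-out ; odd-in = odd-in ; odd-hole = odd-hole ; odd-out = odd-out }
  where
  even-in : ∀ {i j σ x} → 1 ≤ x → i + x ≡ σ → σ + x ≡ j → j < 4 * k → EvenBand 0 k (4 * k) σ x → entry₁ k i j ≡ 1ℤ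
  even-in {i} {j} {σ} {x} 1≤x e e′ _ (evenBand x≤ σ≥ σ≤) = Entry₁.plain k i j
    (hollow₁-miss k (s≤s (even-< 1≤x e e′)) (even-miss 1≤x e e′ ∘ proj₁))
    (trans (dEntry-in (2 * k) (suc i) (suc j) (y + y)
      ((lin 5 λ i j σ x k → on-even i j σ x $ k ≼ σ ⇒ ⊢ 2 ⊛ k ⊕ # 2 ≼ 1+ i ⊕ 1+ j) i j σ x k e e′ σ≥)
      ((lin 5 λ i j σ x k → on-even i j σ x $ σ ⊕ k ≺ 4 ⊛ k ⇒ ⊢ 1+ i ⊕ 1+ j ≼ 3 ⊛ (2 ⊛ k)) i j σ x k e e′ σ≤)
      (dist-≤ {suc i} {suc j}
        ((lin 5 λ i j σ x k → on-even i j σ x $ ⊢ 1+ i ≼ 1+ j ⊕ 2 ⊛ k) i j σ x k e e′)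
        ((lin 5 λ i j σ x k → on-even i j σ x $ x ⊕ # 0 ≼ k ⇒ ⊢ 1+ j ≼ 1+ i ⊕ 2 ⊛ k) i j σ x k e e′ x≤))
      ((lin 6 λ i j σ x k y → on-even i j σ x $ y ⊕ k ≈ σ ⇒ ⊢ 1+ i ⊕ 1+ j ≈ y ⊕ y ⊕ (2 ⊛ k ⊕ # 2)) i j σ x k y e e′
        (m∸n+n≡m σ≥)))
      (signPow-double y))
    where
    y : ℕ
    y = σ ∸ k
  even-out : ∀ {i j σ x} → 1 ≤ x → i + x ≡ σ → σ + x ≡ j → j < 4 * k → (k < x + 0) ⊎ ((σ < k) ⊎ (4 * k ≤ σ + k)) →
      entry₁ k i j ≡ 0ℤ
  even-out {i} {j} {σ} {x} _ e e′ _ out = Entry₁.void k i j (dEntry-out (2 * k) (suc i) (suc j) (off out))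
    where
    off : (k < x + 0) ⊎ ((σ < k) ⊎ (4 * k ≤ σ + k)) → (suc i + suc j < 2 * k + 2) ⊎
        ((3 * (2 * k) < suc i + suc j) ⊎ (2 * k < ∣ suc i - suc j ∣))
    off (inj₁ h) = inj₂ (inj₂ (dist-> {suc i} {suc j} (inj₂
      ((lin 5 λ i j σ x k → on-even i j σ x $ k ≺ x ⊕ # 0 ⇒ ⊢ 1+ i ⊕ 2 ⊛ k ≺ 1+ j) i j σ x k e e′ h))))
    off (inj₂ (inj₁ h)) = inj₁
      ((lin 5 λ i j σ x k → on-even i j σ x $ σ ≺ k ⇒ ⊢ 1+ i ⊕ 1+ j ≺ 2 ⊛ k ⊕ # 2) i j σ x k e e′ h)
    off (inj₂ (inj₂ h)) = inj₂ (inj₁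
      ((lin 5 λ i j σ x k → on-even i j σ x $ 4 ⊛ k ≼ σ ⊕ k ⇒ ⊢ 3 ⊛ (2 ⊛ k) ≺ 1+ i ⊕ 1+ j) i j σ x k e e′ h))
  odd-in : ∀ {i j τ x} → 1 ≤ x → i + x ≡ τ → τ + x ≡ suc j → j < 4 * k → OddBand 0 k (4 * k) τ x →
      (x ≡ 1 → odd (τ + k) ≡ 0) → entry₁ k i j ≡ -1ℤ
  odd-in {i} {j} {τ} {x} 1≤x e e′ _ (oddBand x≤ τ≥ τ≤) not-hole = Entry₁.plain k i j
    (hollow₁-miss k (s≤s (odd-< 1≤x e e′)) (odd-miss e e′ not-hole))
    (trans (dEntry-in (2 * k) (suc i) (suc j) (suc (y + y))
      ((lin 5 λ i j τ x k → on-odd i j τ x $ k ≺ τ ⊕ # 0 ⇒ ⊢ 2 ⊛ k ⊕ # 2 ≼ 1+ i ⊕ 1+ j) i j τ x k e e′ τ≥)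
      ((lin 5 λ i j τ x k → on-odd i j τ x $ τ ⊕ k ≺ 4 ⊛ k ⊕ # 0 ⇒ ⊢ 1+ i ⊕ 1+ j ≼ 3 ⊛ (2 ⊛ k)) i j τ x k e e′ τ≤)
      (dist-≤ {suc i} {suc j}
        ((lin 5 λ i j τ x k → # 1 ≼ x ⇒ (on-odd i j τ x $ ⊢ 1+ i ≼ 1+ j ⊕ 2 ⊛ k)) i j τ x k 1≤x e e′)
        ((lin 5 λ i j τ x k → on-odd i j τ x $ x ≼ k ⇒ ⊢ 1+ j ≼ 1+ i ⊕ 2 ⊛ k) i j τ x k e e′ x≤))
      ((lin 6 λ i j τ x k y → on-odd i j τ x $ y ⊕ 1+ k ≈ τ ⇒ ⊢ 1+ i ⊕ 1+ j ≈ 1+ (y ⊕ y) ⊕ (2 ⊛ k ⊕ # 2))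
        i j τ x k y e e′ (m∸n+n≡m (subst (suc k ≤_) (+-identityʳ τ) τ≥))))
      (signPow-suc-double y))
    where
    y : ℕ
    y = τ ∸ suc k
  odd-hole : ∀ {i j τ} → i + 1 ≡ τ → τ + 1 ≡ suc j → j < 4 * k → OddBand 0 k (4 * k) τ 1 → odd (τ + k) ≡ 1 → entry₁ k i j ≡ 0ℤ
  odd-hole {i} {j} {τ} e e′ _ (oddBand _ τ≥ τ≤) o with odd-offset {suc k} {τ} k (subst (suc k ≤_) (+-identityʳ τ) τ≥) o
      (trans (cong odd (+-comm 1 (k + k))) (odd-double k 1))
  ... | y , refl = Entry₁.hole k i j (hollow₁-hit k y
    ((lin 2 λ y k → (1+ k ⊕ (y ⊕ y)) ⊕ k ≺ 4 ⊛ k ⊕ # 0 ⇒ ⊢ y ≺ k) y k τ≤)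
    (inj₁ ((lin 3 λ i y k → i ⊕ # 1 ≈ 1+ k ⊕ (y ⊕ y) ⇒ ⊢ # 2 ⊕ i ≈ k ⊕ 2 ⊛ 1+ y) i y k e))
    (inj₂ ((lin 3 λ j y k → 1+ k ⊕ (y ⊕ y) ⊕ # 1 ≈ 1+ j ⇒ ⊢ 1+ j ≈ k ⊕ 2 ⊛ 1+ y) j y k e′)))
  odd-out : ∀ {i j τ x} → 1 ≤ x → i + x ≡ τ → τ + x ≡ suc j → j < 4 * k → (k < x) ⊎ ((τ + 0 ≤ k) ⊎ (4 * k + 0 ≤ τ + k)) →
      entry₁ k i j ≡ 0ℤ
  odd-out {i} {j} {τ} {x} _ e e′ _ out = Entry₁.void k i j (dEntry-out (2 * k) (suc i) (suc j) (off out))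
    where
    off : (k < x) ⊎ ((τ + 0 ≤ k) ⊎ (4 * k + 0 ≤ τ + k)) → (suc i + suc j < 2 * k + 2) ⊎
        ((3 * (2 * k) < suc i + suc j) ⊎ (2 * k < ∣ suc i - suc j ∣))
    off (inj₁ h) = inj₂ (inj₂ (dist-> {suc i} {suc j} (inj₂
      ((lin 5 λ i j τ x k → on-odd i j τ x $ k ≺ x ⇒ ⊢ 1+ i ⊕ 2 ⊛ k ≺ 1+ j) i j τ x k e e′ h))))
    off (inj₂ (inj₁ h)) = inj₁
      ((lin 5 λ i j τ x k → on-odd i j τ x $ τ ⊕ # 0 ≼ k ⇒ ⊢ 1+ i ⊕ 1+ j ≺ 2 ⊛ k ⊕ # 2) i j τ x k e e′ h)
    off (inj₂ (inj₂ h)) = inj₂ (inj₁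
      ((lin 5 λ i j τ x k → on-odd i j τ x $ 4 ⊛ k ⊕ # 0 ≼ τ ⊕ k ⇒ ⊢ 3 ⊛ (2 ⊛ k) ≺ 1+ i ⊕ 1+ j) i j τ x k e e′ h))

-- The threshold 2k + 3 is one larger than for type 1, which exchanges the signs of the two kinds of
-- offset.
pattern₃ : ∀ k → 1 ≤ k → Pattern 1 (suc k) (4 * k) (entry₃ k)
pattern₃ k 1≤k = record { even-in = even-in ; even-out = even-out ; odd-in = odd-in ; odd-hole = odd-hole ; odd-out = odd-out }
  where
  p : ℕ
  p = suc k
  6k∸1 : suc (6 * k ∸ 1) ≡ 6 * k
  6k∸1 = m+[n∸m]≡n {1} (≤-trans 1≤k (m≤m+n k _))
  even-in : ∀ {i j σ x} → 1 ≤ x → i + x ≡ σ → σ + x ≡ j → j < 4 * k → EvenBand 1 p (4 * k) σ x → entry₃ k i j ≡ -1ℤ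
  even-in {i} {j} {σ} {x} 1≤x e e′ _ (evenBand x≤ σ≥ σ≤) = Entry₃.plain k i j
    (hollow₂-miss k (s≤s (even-< 1≤x e e′)) (even-miss 1≤x e e′ ∘ proj₁))
    (trans (eEntry-in k (suc i) (suc j) (suc (y + y))
      ((lin 5 λ i j σ x k → on-even i j σ x $ 1+ k ≼ σ ⇒ ⊢ 2 ⊛ k ⊕ # 3 ≼ 1+ i ⊕ 1+ j) i j σ x k e e′ σ≥)
      ((lin 6 λ i j σ x k s → on-even i j σ x $ σ ⊕ 1+ k ≺ 4 ⊛ k ⇒ 1+ s ≈ 6 ⊛ k ⇒ ⊢ 1+ i ⊕ 1+ j ≼ s) i j σ x k
        (6 * k ∸ 1) e e′ σ≤ 6k∸1)
      (dist-≤ {suc i} {suc j}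
        ((lin 5 λ i j σ x k → on-even i j σ x $ ⊢ 1+ i ≼ 1+ j ⊕ (2 ⊛ k ⊕ # 1)) i j σ x k e e′)
        ((lin 5 λ i j σ x k → on-even i j σ x $ x ⊕ # 1 ≼ 1+ k ⇒ ⊢ 1+ j ≼ 1+ i ⊕ (2 ⊛ k ⊕ # 1)) i j σ x k e e′ x≤))
      ((lin 6 λ i j σ x k y → on-even i j σ x $ y ⊕ 1+ k ≈ σ ⇒ 1+ k ≼ σ ⇒ ⊢ 1+ i ⊕ 1+ j ≈ 1+ (y ⊕ y) ⊕ (2 ⊛ k ⊕ # 3))
        i j σ x k y e e′ (m∸n+n≡m σ≥) σ≥))
      (signPow-suc-double y))
    where
    y : ℕ
    y = σ ∸ p
  even-out : ∀ {i j σ x} → 1 ≤ x → i + x ≡ σ → σ + x ≡ j → j < 4 * k → (p < x + 1) ⊎ ((σ < p) ⊎ (4 * k ≤ σ + p)) →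
      entry₃ k i j ≡ 0ℤ
  even-out {i} {j} {σ} {x} _ e e′ _ out = Entry₃.void k i j (eEntry-out k (suc i) (suc j) (off out))
    where
    off : (p < x + 1) ⊎ ((σ < p) ⊎ (4 * k ≤ σ + p)) → (suc i + suc j < 2 * k + 3) ⊎
        ((6 * k ∸ 1 < suc i + suc j) ⊎ (2 * k + 1 < ∣ suc i - suc j ∣))
    off (inj₁ h) = inj₂ (inj₂ (dist-> {suc i} {suc j} (inj₂
      ((lin 5 λ i j σ x k → on-even i j σ x $ 1+ k ≺ x ⊕ # 1 ⇒ ⊢ 1+ i ⊕ (2 ⊛ k ⊕ # 1) ≺ 1+ j) i j σ x k e e′ h))))
    off (inj₂ (inj₁ h)) = inj₁
      ((lin 5 λ i j σ x k → on-even i j σ x $ σ ≺ 1+ k ⇒ ⊢ 1+ i ⊕ 1+ j ≺ 2 ⊛ k ⊕ # 3) i j σ x k e e′ h)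
    off (inj₂ (inj₂ h)) = inj₂ (inj₁
      ((lin 6 λ i j σ x k s → on-even i j σ x $ 4 ⊛ k ≼ σ ⊕ 1+ k ⇒ 1+ s ≈ 6 ⊛ k ⇒ ⊢ s ≺ 1+ i ⊕ 1+ j) i j σ x k
        (6 * k ∸ 1) e e′ h 6k∸1))
  odd-in : ∀ {i j τ x} → 1 ≤ x → i + x ≡ τ → τ + x ≡ suc j → j < 4 * k → OddBand 1 p (4 * k) τ x →
      (x ≡ 1 → odd (τ + p) ≡ 0) → entry₃ k i j ≡ 1ℤ
  odd-in {i} {j} {τ} {x} 1≤x e e′ _ (oddBand x≤ τ≥ τ≤) not-hole = Entry₃.plain k i j
    (hollow₂-miss k (s≤s (odd-< 1≤x e e′)) (odd-miss e e′ not-hole))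
    (trans (eEntry-in k (suc i) (suc j) (y + y)
      ((lin 5 λ i j τ x k → on-odd i j τ x $ 1+ k ≺ τ ⊕ # 1 ⇒ ⊢ 2 ⊛ k ⊕ # 3 ≼ 1+ i ⊕ 1+ j) i j τ x k e e′ τ≥)
      ((lin 6 λ i j τ x k s → on-odd i j τ x $ τ ⊕ 1+ k ≺ 4 ⊛ k ⊕ # 1 ⇒ 1+ s ≈ 6 ⊛ k ⇒ ⊢ 1+ i ⊕ 1+ j ≼ s) i j τ x k
        (6 * k ∸ 1) e e′ τ≤ 6k∸1)
      (dist-≤ {suc i} {suc j}
        ((lin 5 λ i j τ x k → # 1 ≼ x ⇒ (on-odd i j τ x $ ⊢ 1+ i ≼ 1+ j ⊕ (2 ⊛ k ⊕ # 1))) i j τ x k 1≤x e e′)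
        ((lin 5 λ i j τ x k → on-odd i j τ x $ x ≼ 1+ k ⇒ ⊢ 1+ j ≼ 1+ i ⊕ (2 ⊛ k ⊕ # 1)) i j τ x k e e′ x≤))
      ((lin 6 λ i j τ x k y → on-odd i j τ x $ y ⊕ 1+ k ≈ τ ⇒ ⊢ 1+ i ⊕ 1+ j ≈ y ⊕ y ⊕ (2 ⊛ k ⊕ # 3))
        i j τ x k y e e′ (m∸n+n≡m ((lin 2 λ k τ → 1+ k ≺ τ ⊕ # 1 ⇒ ⊢ 1+ k ≼ τ) k τ τ≥))))
      (signPow-double y))
    where
    y : ℕ
    y = τ ∸ p
  odd-hole : ∀ {i j τ} → i + 1 ≡ τ → τ + 1 ≡ suc j → j < 4 * k → OddBand 1 p (4 * k) τ 1 → odd (τ + p) ≡ 1 → entry₃ k i j ≡ 0ℤ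
  odd-hole {i} {j} {τ} e e′ _ (oddBand _ τ≥ τ≤) o with odd-offset {k} {τ} p
      ((lin 2 λ k τ → 1+ k ≺ τ ⊕ # 1 ⇒ ⊢ k ≼ τ) k τ τ≥) o
        (trans (cong odd ((lin 1 λ k → ⊢ k ⊕ 1+ k ≈ k ⊕ k ⊕ # 1) k)) (odd-double k 1))
  -- This would be τ = k, but the band begins at τ = k + 1.
  ... | zero  , refl = ⊥-elim (1≰0 ((lin 1 λ k → 1+ k ≺ k ⊕ # 0 ⊕ # 1 ⇒ ⊢ # 1 ≼ # 0) k τ≥))
  ... | suc y , refl = Entry₃.hole k i j (hollow₂-hit k y
    ((lin 2 λ y k → (k ⊕ (1+ y ⊕ 1+ y)) ⊕ 1+ k ≺ 4 ⊛ k ⊕ # 1 ⇒ ⊢ 1+ y ≺ k) y k τ≤)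
    (inj₁ ((lin 3 λ i y k → i ⊕ # 1 ≈ k ⊕ (1+ y ⊕ 1+ y) ⇒ ⊢ 1+ i ≈ k ⊕ 2 ⊛ 1+ y) i y k e))
    (inj₂ ((lin 3 λ j y k → k ⊕ (1+ y ⊕ 1+ y) ⊕ # 1 ≈ 1+ j ⇒ ⊢ 1+ j ≈ k ⊕ 2 ⊛ 1+ y ⊕ # 1) j y k e′)))
  odd-out : ∀ {i j τ x} → 1 ≤ x → i + x ≡ τ → τ + x ≡ suc j → j < 4 * k → (p < x) ⊎ ((τ + 1 ≤ p) ⊎ (4 * k + 1 ≤ τ + p)) →
      entry₃ k i j ≡ 0ℤ
  odd-out {i} {j} {τ} {x} _ e e′ _ out = Entry₃.void k i j (eEntry-out k (suc i) (suc j) (off out))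
    where
    off : (p < x) ⊎ ((τ + 1 ≤ p) ⊎ (4 * k + 1 ≤ τ + p)) → (suc i + suc j < 2 * k + 3) ⊎
        ((6 * k ∸ 1 < suc i + suc j) ⊎ (2 * k + 1 < ∣ suc i - suc j ∣))
    off (inj₁ h) = inj₂ (inj₂ (dist-> {suc i} {suc j} (inj₂
      ((lin 5 λ i j τ x k → on-odd i j τ x $ 1+ k ≺ x ⇒ ⊢ 1+ i ⊕ (2 ⊛ k ⊕ # 1) ≺ 1+ j) i j τ x k e e′ h))))
    off (inj₂ (inj₁ h)) = inj₁
      ((lin 5 λ i j τ x k → on-odd i j τ x $ τ ⊕ # 1 ≼ 1+ k ⇒ ⊢ 1+ i ⊕ 1+ j ≺ 2 ⊛ k ⊕ # 3) i j τ x k e e′ h)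
    off (inj₂ (inj₂ h)) = inj₂ (inj₁
      ((lin 6 λ i j τ x k s → on-odd i j τ x $ 4 ⊛ k ⊕ # 1 ≼ τ ⊕ 1+ k ⇒ 1+ s ≈ 6 ⊛ k ⇒ ⊢ s ≺ 1+ i ⊕ 1+ j) i j τ x k
        (6 * k ∸ 1) e e′ h 6k∸1))

-- Reversing the rows exchanges sums and differences of indices: with u = 4k - 1 - i, the guard on
-- the sum now bounds x and the guard on the distance bounds σ or τ.
pattern₂ : ∀ k → Pattern 1 k (4 * k) (entry₂ k)
pattern₂ k = record { even-in = even-in ; even-out = even-out ; odd-in = odd-in ; odd-hole = odd-hole ; odd-out = odd-out }
  where
  mirror : ∀ {i j} → i < j → j < 4 * k → 4 * k ∸ suc i + suc i ≡ 4 * k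
  mirror i<j j<n = m∸n+n≡m (≤-trans i<j (<⇒≤ j<n))
  even-in : ∀ {i j σ x} → 1 ≤ x → i + x ≡ σ → σ + x ≡ j → j < 4 * k → EvenBand 1 k (4 * k) σ x → entry₂ k i j ≡ -1ℤ
  even-in {i} {j} {σ} {suc x} 1≤x e e′ j<n (evenBand x≤ σ≥ σ≤) = Entry₂.plain k i j
    (hollow₁-miss k (s≤s (even-< 1≤x e e′)) (even-miss 1≤x e e′ ∘ proj₁))
    (trans (dEntry-in (2 * k) (suc u) (suc j) (suc (y + y))
      ((lin 6 λ i j σ x k u → on-even i j σ (1+ x) $ u ⊕ 1+ i ≈ 4 ⊛ k ⇒ 1+ x ⊕ # 1 ≼ k ⇒
        ⊢ 2 ⊛ k ⊕ # 2 ≼ 1+ u ⊕ 1+ j) i j σ x k u e e′ u≡ x≤)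
      ((lin 6 λ i j σ x k u → on-even i j σ (1+ x) $ u ⊕ 1+ i ≈ 4 ⊛ k ⇒ 1+ x ⊕ # 1 ≼ k ⇒ ⊢ 1+ u ⊕ 1+ j ≼ 3 ⊛
        (2 ⊛ k)) i j σ x k u e e′ u≡ x≤)
      (dist-≤ {suc u} {suc j}
        ((lin 6 λ i j σ x k u → on-even i j σ (1+ x) $ u ⊕ 1+ i ≈ 4 ⊛ k ⇒ k ≼ σ ⇒ ⊢ 1+ u ≼ 1+ j ⊕ 2 ⊛ k) i j σ x k u e e′ u≡ σ≥)
        ((lin 6 λ i j σ x k u → on-even i j σ (1+ x) $ u ⊕ 1+ i ≈ 4 ⊛ k ⇒ σ ⊕ k ≺ 4 ⊛ k ⇒
          ⊢ 1+ j ≼ 1+ u ⊕ 2 ⊛ k) i j σ x k u e e′ u≡ σ≤))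
      ((lin 6 λ i j σ x k u → on-even i j σ (1+ x) $ u ⊕ 1+ i ≈ 4 ⊛ k ⇒ ⊢ 1+ u ⊕ 1+ j ≈ 1+ (k ⊕ x ⊕ (k ⊕ x)) ⊕ (2 ⊛ k ⊕ # 2))
        i j σ x k u e e′ u≡))
      (signPow-suc-double y))
    where
    u y : ℕ
    u = 4 * k ∸ suc i
    y = k + x
    u≡ : u + suc i ≡ 4 * k
    u≡ = mirror (even-< 1≤x e e′) j<n
  even-out : ∀ {i j σ x} → 1 ≤ x → i + x ≡ σ → σ + x ≡ j → j < 4 * k → (k < x + 1) ⊎ ((σ < k) ⊎ (4 * k ≤ σ + k)) →
      entry₂ k i j ≡ 0ℤ
  even-out {i} {j} {σ} {x} 1≤x e e′ j<n out = Entry₂.void k i j (dEntry-out (2 * k) (suc u) (suc j) (off out))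
    where
    u : ℕ
    u = 4 * k ∸ suc i
    u≡ : u + suc i ≡ 4 * k
    u≡ = mirror (even-< 1≤x e e′) j<n
    off : (k < x + 1) ⊎ ((σ < k) ⊎ (4 * k ≤ σ + k)) → (suc u + suc j < 2 * k + 2) ⊎
        ((3 * (2 * k) < suc u + suc j) ⊎ (2 * k < ∣ suc u - suc j ∣))
    off (inj₁ h) = inj₂ (inj₁
      ((lin 6 λ i j σ x k u → on-even i j σ x $ u ⊕ 1+ i ≈ 4 ⊛ k ⇒ k ≺ x ⊕ # 1 ⇒ ⊢ 3 ⊛
        (2 ⊛ k) ≺ 1+ u ⊕ 1+ j) i j σ x k u e e′ u≡ h))
    off (inj₂ (inj₁ h)) = inj₂ (inj₂ (dist-> {suc u} {suc j} (inj₁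
      ((lin 6 λ i j σ x k u → on-even i j σ x $ u ⊕ 1+ i ≈ 4 ⊛ k ⇒ σ ≺ k ⇒ ⊢ 1+ j ⊕ 2 ⊛ k ≺ 1+ u) i j σ x k u e e′ u≡ h))))
    off (inj₂ (inj₂ h)) = inj₂ (inj₂ (dist-> {suc u} {suc j} (inj₂
      ((lin 6 λ i j σ x k u → on-even i j σ x $ u ⊕ 1+ i ≈ 4 ⊛ k ⇒ 4 ⊛ k ≼ σ ⊕ k ⇒
        ⊢ 1+ u ⊕ 2 ⊛ k ≺ 1+ j) i j σ x k u e e′ u≡ h))))
  odd-in : ∀ {i j τ x} → 1 ≤ x → i + x ≡ τ → τ + x ≡ suc j → j < 4 * k → OddBand 1 k (4 * k) τ x →
      (x ≡ 1 → odd (τ + k) ≡ 0) → entry₂ k i j ≡ 1ℤ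
  odd-in {i} {j} {τ} {suc x} 1≤x e e′ j<n (oddBand x≤ τ≥ τ≤) not-hole = Entry₂.plain k i j
    (hollow₁-miss k (s≤s (odd-< 1≤x e e′)) (odd-miss e e′ not-hole))
    (trans (dEntry-in (2 * k) (suc u) (suc j) (y + y)
      ((lin 6 λ i j τ x k u → on-odd i j τ (1+ x) $ u ⊕ 1+ i ≈ 4 ⊛ k ⇒ 1+ x ≼ k ⇒
        ⊢ 2 ⊛ k ⊕ # 2 ≼ 1+ u ⊕ 1+ j) i j τ x k u e e′ u≡ x≤)
      ((lin 6 λ i j τ x k u → on-odd i j τ (1+ x) $ u ⊕ 1+ i ≈ 4 ⊛ k ⇒ 1+ x ≼ k ⇒ ⊢ 1+ u ⊕ 1+ j ≼ 3 ⊛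
        (2 ⊛ k)) i j τ x k u e e′ u≡ x≤)
      (dist-≤ {suc u} {suc j}
        ((lin 6 λ i j τ x k u → on-odd i j τ (1+ x) $ u ⊕ 1+ i ≈ 4 ⊛ k ⇒ k ≺ τ ⊕ # 1 ⇒
          ⊢ 1+ u ≼ 1+ j ⊕ 2 ⊛ k) i j τ x k u e e′ u≡ τ≥)
        ((lin 6 λ i j τ x k u → on-odd i j τ (1+ x) $ u ⊕ 1+ i ≈ 4 ⊛ k ⇒ τ ⊕ k ≺ 4 ⊛ k ⊕ # 1 ⇒
          ⊢ 1+ j ≼ 1+ u ⊕ 2 ⊛ k) i j τ x k u e e′ u≡ τ≤))
      ((lin 6 λ i j τ x k u → on-odd i j τ (1+ x) $ u ⊕ 1+ i ≈ 4 ⊛ k ⇒ ⊢ 1+ u ⊕ 1+ j ≈ k ⊕ x ⊕ (k ⊕ x) ⊕ (2 ⊛ k ⊕ # 2))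
        i j τ x k u e e′ u≡))
      (signPow-double y))
    where
    u y : ℕ
    u = 4 * k ∸ suc i
    y = k + x
    u≡ : u + suc i ≡ 4 * k
    u≡ = mirror (odd-< 1≤x e e′) j<n
  odd-hole : ∀ {i j τ} → i + 1 ≡ τ → τ + 1 ≡ suc j → j < 4 * k → OddBand 1 k (4 * k) τ 1 → odd (τ + k) ≡ 1 → entry₂ k i j ≡ 0ℤ
  odd-hole {i} {j} {τ} e e′ _ (oddBand _ τ≥ τ≤) o with odd-offset {suc k} {τ} k k<τ o
      (trans (cong odd (+-comm 1 (k + k))) (odd-double k 1))
    where
    -- For δ = 1 the band begins at τ = k already, but there τ + k is even and the cell is no hole.
    k<τ : k < τ
    k<τ with m≤n⇒m<n∨m≡n ((lin 2 λ k τ → k ≺ τ ⊕ # 1 ⇒ ⊢ k ≼ τ) k τ τ≥)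
    ... | inj₁ k<τ = k<τ
    ... | inj₂ refl with trans (sym o) (trans (cong odd (sym (+-identityʳ (k + k)))) (odd-double k 0))
    ...   | ()
  ... | y , refl = Entry₂.hole k i j (hollow₁-hit k y
    ((lin 2 λ y k → (1+ k ⊕ (y ⊕ y)) ⊕ k ≺ 4 ⊛ k ⊕ # 1 ⇒ ⊢ y ≺ k) y k τ≤)
    (inj₁ ((lin 3 λ i y k → i ⊕ # 1 ≈ 1+ k ⊕ (y ⊕ y) ⇒ ⊢ # 2 ⊕ i ≈ k ⊕ 2 ⊛ 1+ y) i y k e))
    (inj₂ ((lin 3 λ j y k → 1+ k ⊕ (y ⊕ y) ⊕ # 1 ≈ 1+ j ⇒ ⊢ 1+ j ≈ k ⊕ 2 ⊛ 1+ y) j y k e′)))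
  odd-out : ∀ {i j τ x} → 1 ≤ x → i + x ≡ τ → τ + x ≡ suc j → j < 4 * k → (k < x) ⊎ ((τ + 1 ≤ k) ⊎ (4 * k + 1 ≤ τ + k)) →
      entry₂ k i j ≡ 0ℤ
  odd-out {i} {j} {τ} {x} 1≤x e e′ j<n out = Entry₂.void k i j (dEntry-out (2 * k) (suc u) (suc j) (off out))
    where
    u : ℕ
    u = 4 * k ∸ suc i
    u≡ : u + suc i ≡ 4 * k
    u≡ = mirror (odd-< 1≤x e e′) j<n
    off : (k < x) ⊎ ((τ + 1 ≤ k) ⊎ (4 * k + 1 ≤ τ + k)) → (suc u + suc j < 2 * k + 2) ⊎
        ((3 * (2 * k) < suc u + suc j) ⊎ (2 * k < ∣ suc u - suc j ∣))
    off (inj₁ h) = inj₂ (inj₁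
      ((lin 6 λ i j τ x k u → on-odd i j τ x $ u ⊕ 1+ i ≈ 4 ⊛ k ⇒ k ≺ x ⇒ ⊢ 3 ⊛ (2 ⊛ k) ≺ 1+ u ⊕ 1+ j) i j τ x k u e e′ u≡ h))
    off (inj₂ (inj₁ h)) = inj₂ (inj₂ (dist-> {suc u} {suc j} (inj₁
      ((lin 6 λ i j τ x k u → on-odd i j τ x $ u ⊕ 1+ i ≈ 4 ⊛ k ⇒ τ ⊕ # 1 ≼ k ⇒ ⊢ 1+ j ⊕ 2 ⊛ k ≺ 1+ u) i j τ x k u e e′ u≡ h))))
    off (inj₂ (inj₂ h)) = inj₂ (inj₂ (dist-> {suc u} {suc j} (inj₂
      ((lin 6 λ i j τ x k u → on-odd i j τ x $ u ⊕ 1+ i ≈ 4 ⊛ k ⇒ 4 ⊛ k ⊕ # 1 ≼ τ ⊕ k ⇒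
        ⊢ 1+ u ⊕ 2 ⊛ k ≺ 1+ j) i j τ x k u e e′ u≡ h))))

sign : ℕ → ℤ
sign 0       = 1ℤ
sign (suc _) = -1ℤ

signPow-odd : ∀ e → signPow e ≡ sign (odd e)
signPow-odd 0             = refl
signPow-odd 1             = refl
signPow-odd (suc (suc e)) = signPow-odd e

signPow-cong : ∀ {e e′} m → e + e′ ≡ m + m → signPow e ≡ signPow e′
signPow-cong {e} {e′} m h = trans (signPow-odd e) (trans (cong sign odd≡) (sym (signPow-odd e′)))
  where
  odd≡ : odd e ≡ odd e′
  odd≡ = trans (sym (odd-double m e))
      (trans (cong odd (trans (cong (_+ e) (sym h)) ((lin 2 λ e f → ⊢ e ⊕ f ⊕ e ≈ e ⊕ e ⊕ f) e e′))) (odd-double e e′))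

-- Symmetry of the reversed matrix is invariance of D under reflection in the antidiagonal. The
-- exponents of a cell and its image add up to 2(2k - 1), so they have the same parity.
entry₂-sym : ∀ k {i j} → i < 4 * k → j < 4 * k → entry₂ k i j ≡ entry₂ k j i
entry₂-sym k {i} {j} i<n j<n = cong₂ (λ b v → if b then 0ℤ else v) (hollow₁-sym k (suc i) (suc j)) mirrored
  where
  u v : ℕ
  u = 4 * k ∸ suc i
  v = 4 * k ∸ suc j
  u≡ : u + suc i ≡ 4 * k
  u≡ = m∸n+n≡m i<n
  v≡ : v + suc j ≡ 4 * k
  v≡ = m∸n+n≡m j<n
  dist : ∣ suc u - suc j ∣ ≡ ∣ suc v - suc i ∣
  dist = trans (sym (∣m+n-m+o∣≡∣n-o∣ i u j)) (trans (cong₂ ∣_-_∣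
    ((lin 5 λ i j u v n → u ⊕ 1+ i ≈ n ⇒ v ⊕ 1+ j ≈ n ⇒ ⊢ i ⊕ u ≈ j ⊕ v) i j u v (4 * k) u≡ v≡) (+-comm i j))
      (∣m+n-m+o∣≡∣n-o∣ j v i))
  mirrored : dEntry (2 * k) (suc u) (suc j) ≡ dEntry (2 * k) (suc v) (suc i)
  mirrored with ≤-<-connex (2 * k + 2) (suc u + suc j) | ≤-<-connex (suc u + suc j)
      (3 * (2 * k)) | ≤-<-connex ∣ suc u - suc j ∣ (2 * k)
  ... | inj₂ h | _ | _ = trans (dEntry-out (2 * k) (suc u) (suc j) (inj₁ h))
      (sym (dEntry-out (2 * k) (suc v) (suc i) (inj₂ (inj₁
    ((lin 5 λ i j u v k → u ⊕ 1+ i ≈ 4 ⊛ k ⇒ v ⊕ 1+ j ≈ 4 ⊛ k ⇒ 1+ u ⊕ 1+ j ≺ 2 ⊛ k ⊕ # 2 ⇒ ⊢ 3 ⊛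
      (2 ⊛ k) ≺ 1+ v ⊕ 1+ i) i j u v k u≡ v≡ h)))))
  ... | inj₁ _ | inj₂ h | _ = trans (dEntry-out (2 * k) (suc u) (suc j) (inj₂ (inj₁ h)))
      (sym (dEntry-out (2 * k) (suc v) (suc i) (inj₁
    ((lin 5 λ i j u v k → u ⊕ 1+ i ≈ 4 ⊛ k ⇒ v ⊕ 1+ j ≈ 4 ⊛ k ⇒ 3 ⊛ (2 ⊛ k) ≺ 1+ u ⊕ 1+ j ⇒
      ⊢ 1+ v ⊕ 1+ i ≺ 2 ⊛ k ⊕ # 2) i j u v k u≡ v≡ h))))
  ... | inj₁ _ | inj₁ _ | inj₂ h = trans (dEntry-out (2 * k) (suc u) (suc j) (inj₂ (inj₂ h)))
    (sym (dEntry-out (2 * k) (suc v) (suc i) (inj₂ (inj₂ (subst (2 * k <_) dist h)))))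
  ... | inj₁ lo | inj₁ hi | inj₁ near = trans
    (dEntry-in (2 * k) (suc u) (suc j) e lo hi near (sym (m∸n+n≡m lo)))
    (trans (signPow-cong {e} {f} (2 * k ∸ 1) ((lin 8 λ i j u v k e f m →
        u ⊕ 1+ i ≈ 4 ⊛ k ⇒ v ⊕ 1+ j ≈ 4 ⊛ k ⇒ e ⊕ (2 ⊛ k ⊕ # 2) ≈ 1+ u ⊕ 1+ j ⇒ f ⊕ (2 ⊛ k ⊕ # 2) ≈ 1+ v ⊕ 1+ i ⇒
        m ⊕ # 1 ≈ 2 ⊛ k ⇒ ⊢ e ⊕ f ≈ m ⊕ m) i j u v k e f (2 * k ∸ 1) u≡ v≡ (m∸n+n≡m lo) (m∸n+n≡m lo′) (m∸n+n≡m 1≤2k)))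
      (sym (dEntry-in (2 * k) (suc v) (suc i) f lo′ hi′ (subst (_≤ 2 * k) dist near) (sym (m∸n+n≡m lo′)))))
    where
    e f : ℕ
    e = suc u + suc j ∸ (2 * k + 2)
    f = suc v + suc i ∸ (2 * k + 2)
    lo′ : 2 * k + 2 ≤ suc v + suc i
    lo′ = (lin 5 λ i j u v k → u ⊕ 1+ i ≈ 4 ⊛ k ⇒ v ⊕ 1+ j ≈ 4 ⊛ k ⇒ 1+ u ⊕ 1+ j ≼ 3 ⊛ (2 ⊛ k) ⇒
        ⊢ 2 ⊛ k ⊕ # 2 ≼ 1+ v ⊕ 1+ i) i j u v k u≡ v≡ hi
    hi′ : suc v + suc i ≤ 3 * (2 * k)
    hi′ = (lin 5 λ i j u v k → u ⊕ 1+ i ≈ 4 ⊛ k ⇒ v ⊕ 1+ j ≈ 4 ⊛ k ⇒ 2 ⊛ k ⊕ # 2 ≼ 1+ u ⊕ 1+ j ⇒ ⊢ 1+ v ⊕ 1+ i ≼ 3 ⊛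
        (2 ⊛ k)) i j u v k u≡ v≡ lo
    1≤2k : 1 ≤ 2 * k
    1≤2k = (lin 2 λ u k → 1+ u ≼ 4 ⊛ k ⇒ ⊢ # 1 ≼ 2 ⊛ k) i k i<n

hollow₁-diag : ∀ k {i} → k ≤ i → i < 3 * k → hollow₁ k (suc i) (suc i) ≡ true
hollow₁-diag k {i} k≤i i<3k with m≤n⇒∃[o]m+o≡n k≤i
... | e , refl with halve e
...   | y , inj₁ refl = hollow₁-hit k y ((lin 2 λ y k → k ⊕ (y ⊕ y) ≺ 3 ⊛ k ⇒ ⊢ y ≺ k) y k i<3k) (inj₁ at) (inj₁ at)
  where
  at : suc (suc (k + (y + y))) ≡ k + 2 * suc y
  at = (lin 2 λ y k → ⊢ # 2 ⊕ (k ⊕ (y ⊕ y)) ≈ k ⊕ 2 ⊛ 1+ y) y k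
...   | y , inj₂ refl = hollow₁-hit k y ((lin 2 λ y k → k ⊕ (1+ (y ⊕ y)) ≺ 3 ⊛ k ⇒ ⊢ y ≺ k) y k i<3k) (inj₂ at) (inj₂ at)
  where
  at : suc (k + suc (y + y)) ≡ k + 2 * suc y
  at = (lin 2 λ y k → ⊢ 1+ (k ⊕ (1+ (y ⊕ y))) ≈ k ⊕ 2 ⊛ 1+ y) y k

hollow₂-diag : ∀ k {i} → suc k ≤ i → suc i < 3 * k → hollow₂ k (suc i) (suc i) ≡ true
hollow₂-diag k {i} k<i i<3k with m≤n⇒∃[o]m+o≡n k<i
... | e , refl with halve e
...   | y , inj₁ refl = hollow₂-hit k y ((lin 2 λ y k → # 2 ⊕ (k ⊕ (y ⊕ y)) ≺ 3 ⊛ k ⇒ ⊢ 1+ y ≺ k) y k i<3k) (inj₁ at) (inj₁ at)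
  where
  at : suc (suc (k + (y + y))) ≡ k + 2 * suc y
  at = (lin 2 λ y k → ⊢ # 2 ⊕ (k ⊕ (y ⊕ y)) ≈ k ⊕ 2 ⊛ 1+ y) y k
...   | y , inj₂ refl = hollow₂-hit k y ((lin 2 λ y k → # 2 ⊕ (k ⊕ (1+ (y ⊕ y))) ≺ 3 ⊛ k ⇒ ⊢ 1+ y ≺ k) y k i<3k) (inj₂ at)
    (inj₂ at)
  where
  at : suc (suc (k + suc (y + y))) ≡ k + 2 * suc y + 1
  at = (lin 2 λ y k → ⊢ # 2 ⊕ (k ⊕ (1+ (y ⊕ y))) ≈ k ⊕ 2 ⊛ 1+ y ⊕ # 1) y k

-- The blocks cover the diagonal for k ≤ i < 3k; outside that range it runs outside the diamond.
entry₁-diag : ∀ k i → entry₁ k i i ≡ 0ℤ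
entry₁-diag k i with ≤-<-connex k i | <-≤-connex i (3 * k)
... | inj₁ k≤i | inj₁ i<3k = Entry₁.hole k i i (hollow₁-diag k k≤i i<3k)
... | inj₂ i<k | _ = Entry₁.void k i i (dEntry-out (2 * k) (suc i) (suc i) (inj₁
  ((lin 2 λ i k → i ≺ k ⇒ ⊢ 1+ i ⊕ 1+ i ≺ 2 ⊛ k ⊕ # 2) i k i<k)))
... | inj₁ _ | inj₂ 3k≤i = Entry₁.void k i i (dEntry-out (2 * k) (suc i) (suc i) (inj₂ (inj₁
  ((lin 2 λ i k → 3 ⊛ k ≼ i ⇒ ⊢ 3 ⊛ (2 ⊛ k) ≺ 1+ i ⊕ 1+ i) i k 3k≤i))))

entry₂-diag : ∀ k i → i < 4 * k → entry₂ k i i ≡ 0ℤ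
entry₂-diag k i i<n with ≤-<-connex k i | <-≤-connex i (3 * k)
... | inj₁ k≤i | inj₁ i<3k = Entry₂.hole k i i (hollow₁-diag k k≤i i<3k)
... | inj₂ i<k | _ = Entry₂.void k i i (dEntry-out (2 * k) (suc u) (suc i) (inj₂ (inj₂ (dist-> {suc u} {suc i} (inj₁
  ((lin 3 λ i k u → u ⊕ 1+ i ≈ 4 ⊛ k ⇒ i ≺ k ⇒ ⊢ 1+ i ⊕ 2 ⊛ k ≺ 1+ u) i k u (m∸n+n≡m i<n) i<k))))))
  where
  u : ℕ
  u = 4 * k ∸ suc i
... | inj₁ _ | inj₂ 3k≤i = Entry₂.void k i i (dEntry-out (2 * k) (suc u) (suc i) (inj₂ (inj₂ (dist-> {suc u} {suc i} (inj₂
  ((lin 3 λ i k u → u ⊕ 1+ i ≈ 4 ⊛ k ⇒ 3 ⊛ k ≼ i ⇒ ⊢ 1+ u ⊕ 2 ⊛ k ≺ 1+ i) i k u (m∸n+n≡m i<n) 3k≤i))))))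
  where
  u : ℕ
  u = 4 * k ∸ suc i

entry₃-diag : ∀ k i → 1 ≤ k → entry₃ k i i ≡ 0ℤ
entry₃-diag k i 1≤k with ≤-<-connex (suc k) i | <-≤-connex (suc i) (3 * k)
... | inj₁ k<i | inj₁ i<3k = Entry₃.hole k i i (hollow₂-diag k k<i i<3k)
... | inj₂ i<k | _ = Entry₃.void k i i (eEntry-out k (suc i) (suc i) (inj₁
  ((lin 2 λ i k → i ≺ 1+ k ⇒ ⊢ 1+ i ⊕ 1+ i ≺ 2 ⊛ k ⊕ # 3) i k i<k)))
... | inj₁ _ | inj₂ 3k≤i = Entry₃.void k i i (eEntry-out k (suc i) (suc i) (inj₂ (inj₁
  ((lin 3 λ i k s → 3 ⊛ k ≼ 1+ i ⇒ 1+ s ≈ 6 ⊛ k ⇒ ⊢ s ≺ 1+ i ⊕ 1+ i) i k (6 * k ∸ 1) 3k≤i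
    (m+[n∸m]≡n {1} (≤-trans 1≤k (m≤m+n k _)))))))

-- Counting the nonzero entries of a pattern

∑-1∸odd : ∀ q → ∑ (q + q) (λ r → 1 ∸ odd r) ≡ q
∑-1∸odd q = trans (∑-evenOdd q _) (trans (∑-cong q (λ y _ → pair y)) (trans (∑-const q 1) (*-identityʳ q)))
  where
  pair : ∀ y → (1 ∸ odd (y + y)) + (1 ∸ odd (suc (y + y))) ≡ 1
  pair zero    = refl
  pair (suc y) rewrite +-suc y y = pair y

∑-1∸odd-suc : ∀ q → ∑ (q + q) (λ r → 1 ∸ odd (suc r)) ≡ q
∑-1∸odd-suc q = trans (∑-evenOdd q _) (trans (∑-cong q (λ y _ → pair y)) (trans (∑-const q 1) (*-identityʳ q)))
  where
  pair : ∀ y → (1 ∸ odd (suc (y + y))) + (1 ∸ odd (suc (suc (y + y)))) ≡ 1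
  pair zero    = refl
  pair (suc y) rewrite +-suc y y = pair y

nz-even-sign : ∀ δ → nz (even-sign δ) ≡ 1
nz-even-sign zero    = refl
nz-even-sign (suc _) = refl

nz-odd-sign : ∀ δ → nz (odd-sign δ) ≡ 1
nz-odd-sign zero    = refl
nz-odd-sign (suc _) = refl

module _ {δ p q n : ℕ} (1≤p : 1 ≤ p) (δ≤1 : δ ≤ 1) (n≡ : n ≡ p + p + (q + q)) {g : ℕ → ℕ → ℤ} (P : Pattern δ p n g) where

  open CellSums n
  open Pattern P

  private
    f : ℕ → ℕ → ℕ
    f i j = nz (g i j)

    p≤n : p ≤ n
    p≤n = (lin 3 λ p q n → n ≈ p ⊕ p ⊕ (q ⊕ q) ⇒ ⊢ p ≼ n) p q n n≡

  -- The band consists of p - δ lines with 2q cells each, σ running from p to n - p - 1.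
  even-count : (p ∸ δ) * (q + q) ≤ part f j₁
  even-count = ≤-trans (≤-reflexive (sym (∑-const (p ∸ δ) (q + q)))) (part-lines f j₁ (≤-trans (m∸n≤m p δ) p≤n) line)
    where
    line : ∀ y → y < p ∸ δ → q + q ≤ ∑ n (λ i → cell f i (j₁ i y))
    line y y< = ≤-trans (≤-reflexive
        (trans (sym (trans (∑-const (q + q) 1) (*-identityʳ _))) (∑-cong (q + q) (λ r r< → sym (one r r<)))))
      (∑-window (p ∸ suc y) (q + q) n _
        ((lin 4 λ a p q n → a ≼ p ⇒ n ≈ p ⊕ p ⊕ (q ⊕ q) ⇒ ⊢ a ⊕ (q ⊕ q) ≼ n) (p ∸ suc y) p q n (m∸n≤m p (suc y)) n≡))
      where
      y+δ<p : suc y + δ ≤ p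
      y+δ<p = ≤-trans (+-monoˡ-≤ δ y<) (≤-reflexive (m∸n+n≡m {p} {δ} (≤-trans δ≤1 1≤p)))
      e : p ∸ suc y + suc y ≡ p
      e = m∸n+n≡m (≤-trans (m≤m+n (suc y) δ) y+δ<p)
      one : ∀ r → r < q + q → cell f (p ∸ suc y + r) (j₁ (p ∸ suc y + r) y) ≡ 1
      one r r< = trans (cell-inside f j<n) (trans (cong nz (even-in {i} {j₁ i y} {p + r} {suc y} (s≤s z≤n)
          ((lin 4 λ a y p r → a ⊕ 1+ y ≈ p ⇒ ⊢ a ⊕ r ⊕ 1+ y ≈ p ⊕ r) a y p r e)
          ((lin 4 λ a y p r → a ⊕ 1+ y ≈ p ⇒ ⊢ p ⊕ r ⊕ 1+ y ≈ 1+ (a ⊕ r) ⊕ (1+ (y ⊕ y))) a y p r e)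
          j<n (evenBand y+δ<p (m≤m+n p r)
            ((lin 4 λ p q n r → n ≈ p ⊕ p ⊕ (q ⊕ q) ⇒ r ≺ q ⊕ q ⇒ ⊢ p ⊕ r ⊕ p ≺ n) p q n r n≡ r<)))) (nz-even-sign δ))
        where
        a = p ∸ suc y
        i = a + r
        j<n : j₁ i y < n
        j<n = (lin 7 λ a y p q n r d → a ⊕ 1+ y ≈ p ⇒ n ≈ p ⊕ p ⊕ (q ⊕ q) ⇒ r ≺ q ⊕ q ⇒ 1+ y ⊕ d ≼ p ⇒
                 ⊢ 1+ (a ⊕ r) ⊕ (1+ (y ⊕ y)) ≺ n) a y p q n r δ e n≡ r< y+δ<p

  -- On the line y = 0 the cells at odd distance from the start of the band are holes.
  odd-count : ∀ {L w₀} s → s + δ ≡ suc p → L + 2 * s ≡ suc n → w₀ ≤ ∑ L (λ r → 1 ∸ odd (s + r + p)) →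
              w₀ + (p ∸ 1) * L ≤ part f j₀
  odd-count {L} {w₀} s s≡ L≡ w₀≤ = begin
    w₀ + (p ∸ 1) * L                ≡⟨ cong (w₀ +_) (sym (∑-const (p ∸ 1) L)) ⟩
    w₀ + ∑ (p ∸ 1) (λ _ → L)        ≡⟨ ∑-head (p ∸ 1) w ⟨
    ∑ (suc (p ∸ 1)) w               ≡⟨ cong (λ m → ∑ m w) (m+[n∸m]≡n 1≤p) ⟩
    ∑ p w                           ≤⟨ part-lines f j₀ p≤n line ⟩
    part f j₀                       ∎
    where
    open ≤-Reasoning
    w : ℕ → ℕ
    w zero    = w₀
    w (suc _) = L
    y<s : ∀ {y} → y < p → suc y ≤ s
    y<s {y} y<p = (lin 4 λ y p s d → y ≺ p ⇒ s ⊕ d ≈ 1+ p ⇒ d ≼ # 1 ⇒ ⊢ 1+ y ≼ s) y p s δ y<p s≡ δ≤1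
    module _ {y r} (y<p : y < p) (r<L : r < L) where
      i : ℕ
      i = s ∸ suc y + r
      e : s ∸ suc y + suc y ≡ s
      e = m∸n+n≡m (y<s y<p)
      j<n : j₀ i y < n
      j<n = (lin 6 λ a y s r L n → a ⊕ 1+ y ≈ s ⇒ L ⊕ 2 ⊛ s ≈ 1+ n ⇒ r ≺ L ⇒ 1+ y ≼ s ⇒
               ⊢ 1+ (a ⊕ r) ⊕ (y ⊕ y) ≺ n) (s ∸ suc y) y s r L n e L≡ r<L (y<s y<p)
      e₁ : i + suc y ≡ s + r
      e₁ = (lin 4 λ a y s r → a ⊕ 1+ y ≈ s ⇒ ⊢ a ⊕ r ⊕ 1+ y ≈ s ⊕ r) (s ∸ suc y) y s r e
      e₂ : s + r + suc y ≡ suc (j₀ i y)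
      e₂ = (lin 4 λ a y s r → a ⊕ 1+ y ≈ s ⇒ ⊢ s ⊕ r ⊕ 1+ y ≈ 1+ (1+ (a ⊕ r) ⊕ (y ⊕ y))) (s ∸ suc y) y s r e
      band : OddBand δ p n (s + r) (suc y)
      band = oddBand y<p
        ((lin 4 λ s r d p → s ⊕ d ≈ 1+ p ⇒ ⊢ p ≺ s ⊕ r ⊕ d) s r δ p s≡)
        ((lin 6 λ s r d p L n → s ⊕ d ≈ 1+ p ⇒ L ⊕ 2 ⊛ s ≈ 1+ n ⇒ r ≺ L ⇒ ⊢ s ⊕ r ⊕ p ≺ n ⊕ d) s r δ p L n s≡ L≡ r<L)
      value : (suc y ≡ 1 → odd (s + r + p) ≡ 0) → cell f i (j₀ i y) ≡ 1
      value not-hole = trans (cell-inside f j<n) (trans (cong nz (odd-in (s≤s z≤n) e₁ e₂ j<n band not-hole)) (nz-odd-sign δ))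
    window : ∀ y → y < p → ∑ L (λ r → cell f (s ∸ suc y + r) (j₀ (s ∸ suc y + r) y)) ≤ ∑ n (λ i → cell f i (j₀ i y))
    window y y<p = ∑-window (s ∸ suc y) L n _
      ((lin 5 λ a y s L n → a ⊕ 1+ y ≈ s ⇒ L ⊕ 2 ⊛ s ≈ 1+ n ⇒ 1+ y ≼ s ⇒ ⊢ a ⊕ L ≼ n)
        (s ∸ suc y) y s L n (m∸n+n≡m (y<s y<p)) L≡ (y<s y<p))
    line : ∀ y → y < p → w y ≤ ∑ n (λ i → cell f i (j₀ i y))
    line zero y<p = ≤-trans w₀≤ (≤-trans (∑-mono L holes) (window 0 y<p))
      where
      holes : ∀ r → r < L → 1 ∸ odd (s + r + p) ≤ cell f (s ∸ 1 + r) (j₀ (s ∸ 1 + r) 0)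
      holes r r<L with odd (s + r + p) in o
      ... | 0     = ≤-reflexive (sym (value y<p r<L (λ _ → o)))
      ... | suc m = ≤-trans (≤-reflexive (0∸n≡0 m)) z≤n
    line (suc y) y<p = ≤-trans (≤-reflexive (trans (sym (trans (∑-const L 1) (*-identityʳ L)))
      (∑-cong L (λ r r<L → sym (value y<p r<L (λ ())))))) (window (suc y) y<p)

module _ {k δ p q : ℕ} (1≤p : 1 ≤ p) (δ≤1 : δ ≤ 1) {g : ℕ → ℕ → ℤ} (P : Pattern δ p (4 * k) g)
         (g-sym : ∀ {i j} → i < 4 * k → j < 4 * k → g i j ≡ g j i) where

  open CellSums (4 * k)

  pattern-count : ∀ {e o t} → 4 * k ≡ p + p + (q + q) → e ≤ part (λ i j → nz (g i j)) j₁ → o ≤ part (λ i j → nz (g i j)) j₀ →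
                  t ≡ 2 * (o + e) → t ≤ total (λ i j → nz (g i j))
  pattern-count {e} {o} {t} n≡ evens odds t≡ =
    (lin 7 λ t o e b a c d → t ≈ 2 ⊛ (o ⊕ e) ⇒ e ≼ a ⇒ o ≼ b ⇒ b ⊕ a ≼ c ⇒ 2 ⊛ c ≼ d ⇒ ⊢ t ≼ d)
      t o e (part f j₀) (part f j₁) (above f) (total f) t≡ evens odds (above-split f)
      (subst (λ u → u + 2 * above f ≤ total f) (*-zeroʳ (4 * k))
        (total-above f 0 (λ i<n j<n → cong nz (g-sym i<n j<n)) (λ _ → z≤n)))
    where
    f : ℕ → ℕ → ℕ
    f i j = nz (g i j)

-- Each odd line has 2k + 1 cells. On the first one every other cell is a hole, beginning with a
-- hole, which leaves k.
count-δ0 : ∀ k {g} → Pattern 0 (suc k) (4 * suc k) g → (∀ {i j} → i < 4 * suc k → j < 4 * suc k → g i j ≡ g j i) →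
  8 * (suc k * suc k) ≤ ∑ (4 * suc k) (λ i → ∑ (4 * suc k) (λ j → nz (g i j))) + 4 * suc k
count-δ0 k P g-sym = ≤-trans (≤-reflexive (identity k)) (+-monoˡ-≤ (4 * suc k)
    (pattern-count {k = suc k} {q = suc k} (s≤s z≤n) z≤n P g-sym n≡
      (even-count {q = suc k} (s≤s z≤n) z≤n n≡ P)
      (odd-count {q = suc k} (s≤s z≤n) z≤n n≡ P {L = suc (k + k)} {w₀ = k} (suc (suc k)) (+-identityʳ _)
        ((lin 1 λ k → ⊢ 1+ (k ⊕ k) ⊕ 2 ⊛ (# 2 ⊕ k) ≈ 1+ (4 ⊛ 1+ k)) k) firstLine) refl))
  where
  n≡ : 4 * suc k ≡ suc k + suc k + (suc k + suc k)
  n≡ = (lin 1 λ k → ⊢ 4 ⊛ 1+ k ≈ 1+ k ⊕ 1+ k ⊕ (1+ k ⊕ 1+ k)) k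
  e : ∀ k r → suc k + suc k + suc r ≡ suc (suc k) + r + suc k
  e = solve-∀
  firstLine : k ≤ ∑ (suc (k + k)) (λ r → 1 ∸ odd (suc (suc k) + r + suc k))
  firstLine = ≤-trans (≤-reflexive (trans (sym (∑-1∸odd-suc k))
      (∑-cong (k + k) (λ r _ → cong (1 ∸_) (trans (sym (odd-double (suc k) (suc r))) (cong odd (e k r)))))))
    (∑-prefix (k + k) (suc (k + k)) _ (n≤1+n _))
  identity : ∀ k → 8 * (suc k * suc k) ≡ 2 * ((k + k * suc (k + k)) + suc k * (suc k + suc k)) + 4 * suc k
  identity = solve-∀

-- The odd lines now have 2k + 3 cells. The first one begins and ends with a nonzero cell, which
-- leaves k + 2 of them.
count-δ1 : ∀ k {g} → Pattern 1 (suc k) (4 * suc k) g → (∀ {i j} → i < 4 * suc k → j < 4 * suc k → g i j ≡ g j i) →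
  8 * (suc k * suc k) ≤ ∑ (4 * suc k) (λ i → ∑ (4 * suc k) (λ j → nz (g i j))) + 4 * suc k
count-δ1 k P g-sym = ≤-trans (≤-reflexive (identity k)) (+-monoˡ-≤ (4 * suc k)
    (pattern-count {k = suc k} {q = suc k} (s≤s z≤n) ≤-refl P g-sym n≡
      (even-count {q = suc k} (s≤s z≤n) ≤-refl n≡ P)
      (odd-count {q = suc k} (s≤s z≤n) ≤-refl n≡ P {L = suc (suc k + suc k)} {w₀ = suc k + 1} (suc k) (+-comm (suc k) 1)
        ((lin 1 λ k → ⊢ # 2 ⊕ (k ⊕ 1+ k) ⊕ 2 ⊛ 1+ k ≈ 1+ (4 ⊛ 1+ k)) k) (≤-reflexive firstLine)) refl))
  where
  n≡ : 4 * suc k ≡ suc k + suc k + (suc k + suc k)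
  n≡ = (lin 1 λ k → ⊢ 4 ⊛ 1+ k ≈ 1+ k ⊕ 1+ k ⊕ (1+ k ⊕ 1+ k)) k
  e : ∀ k r → suc k + suc k + r ≡ suc k + r + suc k
  e = solve-∀
  firstLine : suc k + 1 ≡ ∑ (suc (suc k + suc k)) (λ r → 1 ∸ odd (suc k + r + suc k))
  firstLine = trans (cong₂ _+_ (sym (∑-1∸odd (suc k)))
      (cong (1 ∸_) (sym (trans (cong odd (sym (+-identityʳ (suc k + suc k)))) (odd-double (suc k) 0)))))
    (∑-cong (suc (suc k + suc k)) (λ r _ → cong (1 ∸_) (trans (sym (odd-double (suc k) r)) (cong odd (e k r)))))
  identity : ∀ k → 8 * (suc k * suc k) ≡ 2 * (((suc k + 1) + k * suc (suc k + suc k)) + k * (suc k + suc k)) + 4 * suc k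
  identity = solve-∀

-- The higher plateau shortens the odd lines to 2k + 1 cells but adds one line. The first begins and
-- ends with a nonzero cell, which leaves k + 1.
count-near : ∀ k {g} → Pattern 1 (suc (suc k)) (4 * suc k) g → (∀ {i j} → i < 4 * suc k → j < 4 * suc k → g i j ≡ g j i) →
  8 * (suc k * suc k) ≤ ∑ (4 * suc k) (λ i → ∑ (4 * suc k) (λ j → nz (g i j))) + 4 * suc k
count-near k P g-sym = ≤-trans (≤-reflexive (identity k)) (+-monoˡ-≤ (4 * suc k)
    (pattern-count {k = suc k} {q = k} (s≤s z≤n) ≤-refl P g-sym n≡
      (even-count {q = k} (s≤s z≤n) ≤-refl n≡ P)
      (odd-count {q = k} (s≤s z≤n) ≤-refl n≡ P {L = suc (k + k)} {w₀ = k + 1} (suc (suc k)) (+-comm (suc (suc k)) 1)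
        ((lin 1 λ k → ⊢ 1+ (k ⊕ k) ⊕ 2 ⊛ (# 2 ⊕ k) ≈ 1+ (4 ⊛ 1+ k)) k) (≤-reflexive firstLine)) refl))
  where
  n≡ : 4 * suc k ≡ suc (suc k) + suc (suc k) + (k + k)
  n≡ = (lin 1 λ k → ⊢ 4 ⊛ 1+ k ≈ # 2 ⊕ k ⊕ (# 2 ⊕ k) ⊕ (k ⊕ k)) k
  e : ∀ k r → suc (suc k) + suc (suc k) + r ≡ suc (suc k) + r + suc (suc k)
  e = solve-∀
  firstLine : k + 1 ≡ ∑ (suc (k + k)) (λ r → 1 ∸ odd (suc (suc k) + r + suc (suc k)))
  firstLine = trans (cong₂ _+_ (sym (∑-1∸odd k))
      (cong (1 ∸_) (sym (trans (cong odd (sym (+-identityʳ (k + k)))) (odd-double k 0)))))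
    (∑-cong (suc (k + k)) (λ r _ → cong (1 ∸_) (trans (sym (odd-double (suc (suc k)) r)) (cong odd (e k r)))))
  identity : ∀ k → 8 * (suc k * suc k) ≡ 2 * (((k + 1) + suc k * suc (k + k)) + suc k * (k + k)) + 4 * suc k
  identity = solve-∀

-- The type 1 matrix is an alternating sign matrix

data Step : ℕ → ℤ → ℕ → Set where
  hold : ∀ {s} → Step s 0ℤ s
  up   : Step 0 1ℤ 1
  down : Step 1 -1ℤ 0

step-eq : ∀ {s x t s′ x′ t′} → s′ ≡ s → x′ ≡ x → t′ ≡ t → Step s x t → Step s′ x′ t′
step-eq refl refl refl st = st

-- A converse to `run-alternating`: the states are supplied in advance as `β`, and only single
-- transitions have to be checked.
steps-alternate : ∀ n (g : ℕ → ℤ) (β : ℕ → ℕ) → β n ≡ 1 → (∀ j → j < n → Step (β j) (g j) (β (suc j))) →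
                  AltFrom (β 0) (nonzeros (L.tabulate {n = n} (g ∘ toℕ)))
steps-alternate zero    g β β-end steps = subst (λ s → AltFrom s L.[]) (sym β-end) single
steps-alternate (suc n) g β β-end steps
  with β 0 | g 0 | β 1 | steps 0 (s≤s z≤n) | steps-alternate n (g ∘ suc) (β ∘ suc) β-end (λ j j<n → steps (suc j) (s≤s j<n))
... | s | _ | _ | hold | alt = alt
... | _ | _ | _ | up   | alt = alt
... | _ | _ | _ | down | alt = cons alt

-- Partial row sums of the type 1 matrix.  In the band they alternate with the
-- parity of i + j; the hollowed entries make them constant across the diagonal.

module Prefix (k : ℕ) (1≤k : 1 ≤ k) where

  -- The prefix is 0 left of the diamond and 1 right of it. At j = i and j = i + 1 both prefixes
  -- around the zero diagonal entry are `odd (i + k)`.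
  β : ℕ → ℕ → ℕ
  β i j =
    if (i + j ≤ᵇ 2 * k) ∨ (j + 2 * k ≤ᵇ i) then 0 else
    if (6 * k ≤ᵇ suc (i + j)) ∨ (suc (i + 2 * k) ≤ᵇ j) then 1 else
    if (j ≡ᵇ i) ∨ (j ≡ᵇ suc i) then odd (i + k) else odd (i + j)

  β-low : ∀ i j → (i + j ≤ 2 * k) ⊎ (j + 2 * k ≤ i) → β i j ≡ 0
  β-low i j (inj₁ h) rewrite ≤ᵇ-true h = refl
  β-low i j (inj₂ h) rewrite ≤ᵇ-true h | ∨-zeroʳ (i + j ≤ᵇ 2 * k) = refl

  β-high : ∀ i j → i < 4 * k → (6 * k ≤ suc (i + j)) ⊎ (suc (i + 2 * k) ≤ j) → β i j ≡ 1
  β-high i j i<n (inj₁ h)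
    rewrite ≤ᵇ-false {i + j} {2 * k} ((lin 3 λ i j k → # 1 ≼ k ⇒ 6 ⊛ k ≼ 1+ (i ⊕ j) ⇒ ⊢ 2 ⊛ k ≺ i ⊕ j) i j k 1≤k h)
          | ≤ᵇ-false {j + 2 * k} {i} ((lin 3 λ i j k → i ≺ 4 ⊛ k ⇒ 6 ⊛ k ≼ 1+ (i ⊕ j) ⇒ ⊢ i ≺ j ⊕ 2 ⊛ k) i j k i<n h)
          | ≤ᵇ-true h = refl
  β-high i j i<n (inj₂ h)
    rewrite ≤ᵇ-false {i + j} {2 * k} ((lin 3 λ i j k → 1+ (i ⊕ 2 ⊛ k) ≼ j ⇒ ⊢ 2 ⊛ k ≺ i ⊕ j) i j k h)
          | ≤ᵇ-false {j + 2 * k} {i} ((lin 3 λ i j k → 1+ (i ⊕ 2 ⊛ k) ≼ j ⇒ ⊢ i ≺ j ⊕ 2 ⊛ k) i j k h)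
          | ≤ᵇ-true h | ∨-zeroʳ (6 * k ≤ᵇ suc (i + j)) = refl

  private
    β-inner : ∀ i j → 2 * k < i + j → i < j + 2 * k → suc (i + j) < 6 * k → j < suc (i + 2 * k) →
              β i j ≡ (if (j ≡ᵇ i) ∨ (j ≡ᵇ suc i) then odd (i + k) else odd (i + j))
    β-inner i j a b c d rewrite ≤ᵇ-false a | ≤ᵇ-false b | ≤ᵇ-false c | ≤ᵇ-false d = refl

    ≡ᵇ-false : ∀ {m n} → ¬ m ≡ n → (m ≡ᵇ n) ≡ false
    ≡ᵇ-false {m} {n} m≢n with m ≡ᵇ n in eq
    ... | false = refl
    ... | true  = ⊥-elim (m≢n (≡ᵇ-sound m n eq))

    odd-even : ∀ {m} y → m ≡ 2 * y → odd m ≡ 0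
    odd-even y refl = odd-2* y

    odd-odd : ∀ {m} y → m ≡ suc (2 * y) → odd m ≡ 1
    odd-odd y refl = trans (cong odd ((lin 1 λ y → ⊢ 1+ (2 ⊛ y) ≈ y ⊕ y ⊕ # 1) y)) (odd-double y 1)

  -- On the rim of the band the constants 0 and 1 coincide with the parity of i + j, so the bounds
  -- may be non-strict.
  β-band : ∀ i j → i < 4 * k → 2 * k ≤ i + j → i ≤ j + 2 * k → suc (i + j) ≤ 6 * k → j ≤ suc (i + 2 * k) →
           ¬ j ≡ i → ¬ j ≡ suc i → β i j ≡ odd (i + j)
  β-band i j i<n a b c d j≢i j≢1+i with m≤n⇒m<n∨m≡n a | m≤n⇒m<n∨m≡n b | m≤n⇒m<n∨m≡n c | m≤n⇒m<n∨m≡n d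
  ... | inj₂ e  | _       | _       | _       = trans (β-low i j (inj₁ (≤-reflexive (sym e)))) (sym (odd-even k (sym e)))
  ... | inj₁ _  | inj₂ e  | _       | _       = trans (β-low i j (inj₂ (≤-reflexive (sym e))))
    (sym (odd-even (j + k) ((lin 3 λ i j k → i ≈ j ⊕ 2 ⊛ k ⇒ ⊢ i ⊕ j ≈ 2 ⊛ (j ⊕ k)) i j k e)))
  ... | inj₁ _  | inj₁ _  | inj₂ e  | _       = trans (β-high i j i<n (inj₁ (≤-reflexive (sym e))))
    (sym (odd-odd (3 * k ∸ 1) ((lin 4 λ i j k s → 1+ (i ⊕ j) ≈ 6 ⊛ k ⇒ 1+ s ≈ 3 ⊛ k ⇒ ⊢ i ⊕ j ≈ 1+ (2 ⊛ s)) i j k (3 * k ∸ 1) e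
      (m+[n∸m]≡n {1} (≤-trans 1≤k (m≤m+n k _))))))
  ... | inj₁ _  | inj₁ _  | inj₁ _  | inj₂ e  = trans (β-high i j i<n (inj₂ (≤-reflexive (sym e))))
    (sym (odd-odd (i + k) ((lin 3 λ i j k → j ≈ 1+ (i ⊕ 2 ⊛ k) ⇒ ⊢ i ⊕ j ≈ 1+ (2 ⊛ (i ⊕ k))) i j k e)))
  ... | inj₁ a′ | inj₁ b′ | inj₁ c′ | inj₁ d′ = trans (β-inner i j a′ b′ c′ d′)
    (cong₂ (λ p q → if p ∨ q then odd (i + k) else odd (i + j)) (≡ᵇ-false j≢i) (≡ᵇ-false j≢1+i))

  β-diag : ∀ i → k ≤ i → i < 3 * k → β i i ≡ odd (i + k)
  β-diag i k≤i i<3k with m≤n⇒m<n∨m≡n k≤i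
  ... | inj₂ refl = trans (β-low i i (inj₁ ((lin 1 λ k → ⊢ k ⊕ k ≼ 2 ⊛ k) k)))
      (sym (odd-even k ((lin 1 λ k → ⊢ k ⊕ k ≈ 2 ⊛ k) k)))
  ... | inj₁ k<i = trans (β-inner i i
      ((lin 2 λ i k → k ≺ i ⇒ ⊢ 2 ⊛ k ≺ i ⊕ i) i k k<i) ((lin 2 λ i k → # 1 ≼ k ⇒ ⊢ i ≺ i ⊕ 2 ⊛ k) i k 1≤k)
      ((lin 2 λ i k → i ≺ 3 ⊛ k ⇒ ⊢ 1+ (i ⊕ i) ≺ 6 ⊛ k) i k i<3k) ((lin 2 λ i k → ⊢ i ≺ 1+ (i ⊕ 2 ⊛ k)) i k))
    (cong (λ p → if p ∨ (i ≡ᵇ suc i) then odd (i + k) else odd (i + i)) (≡ᵇ-refl i))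

  β-diag-suc : ∀ i → k ≤ i → i < 3 * k → β i (suc i) ≡ odd (i + k)
  β-diag-suc i k≤i i<3k with m≤n⇒m<n∨m≡n i<3k
  ... | inj₂ e = trans (β-high i (suc i) ((lin 2 λ i k → # 1 ≼ k ⇒ 1+ i ≈ 3 ⊛ k ⇒ ⊢ i ≺ 4 ⊛ k) i k 1≤k e)
      (inj₁ ((lin 2 λ i k → 1+ i ≈ 3 ⊛ k ⇒ ⊢ 6 ⊛ k ≼ 1+ (i ⊕ 1+ i)) i k e)))
    (sym (odd-odd (2 * k ∸ 1) ((lin 3 λ i k s → 1+ i ≈ 3 ⊛ k ⇒ 1+ s ≈ 2 ⊛ k ⇒ ⊢ i ⊕ k ≈ 1+ (2 ⊛ s)) i k (2 * k ∸ 1) e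
      (m+[n∸m]≡n {1} (≤-trans 1≤k (m≤m+n k _))))))
  ... | inj₁ h = trans (β-inner i (suc i)
      ((lin 2 λ i k → k ≼ i ⇒ ⊢ 2 ⊛ k ≺ i ⊕ 1+ i) i k k≤i) ((lin 2 λ i k → ⊢ i ≺ 1+ i ⊕ 2 ⊛ k) i k)
      ((lin 2 λ i k → 1+ i ≺ 3 ⊛ k ⇒ ⊢ 1+ (i ⊕ 1+ i) ≺ 6 ⊛ k) i k h)
        ((lin 2 λ i k → # 1 ≼ k ⇒ ⊢ 1+ i ≺ 1+ (i ⊕ 2 ⊛ k)) i k 1≤k))
    (cong₂ (λ p q → if p ∨ q then odd (i + k) else odd (i + suc i)) (≡ᵇ-false {suc i} {i} 1+n≢n) (≡ᵇ-refl i))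

  private
    module P = Pattern (pattern₁ k)

    lows : ∀ {i j} → entry₁ k i j ≡ 0ℤ → (i + suc j ≤ 2 * k) ⊎ (suc j + 2 * k ≤ i) → Step (β i j) (entry₁ k i j) (β i (suc j))
    lows {i} {j} e (inj₁ h) = step-eq (β-low i j (inj₁ (≤-trans (+-monoʳ-≤ i (n≤1+n j)) h))) e (β-low i (suc j) (inj₁ h)) hold
    lows {i} {j} e (inj₂ h) = step-eq (β-low i j (inj₂ (<⇒≤ h))) e (β-low i (suc j) (inj₂ h)) hold

    highs : ∀ {i j} → i < 4 * k → entry₁ k i j ≡ 0ℤ → (6 * k ≤ suc (i + j)) ⊎ (suc (i + 2 * k) ≤ j) → Step (β i j)
        (entry₁ k i j) (β i (suc j))
    highs {i} {j} i<n e (inj₁ h) = step-eq (β-high i j i<n (inj₁ h)) e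
      (β-high i (suc j) i<n (inj₁ (≤-trans h (s≤s (+-monoʳ-≤ i (n≤1+n j)))))) hold
    highs {i} {j} i<n e (inj₂ h) = step-eq (β-high i j i<n (inj₂ h)) e (β-high i (suc j) i<n (inj₂ (m≤n⇒m≤1+n h))) hold

    odd-pred : ∀ {i τ} → i + 1 ≡ τ → odd (i + k) + odd (τ + k) ≡ 1
    odd-pred {i} refl = trans (cong (λ t → odd (i + k) + odd (t + k)) (+-comm i 1)) (odd-suc (i + k))

    module Band (i j : ℕ) (i<n : i < 4 * k) where
      module _ (σ : ℕ) (s : i + j ≡ 2 * σ) (k≤σ : k ≤ σ) (σ<3k : σ < 3 * k) (i≤ : i ≤ j + 2 * k) (j≤ : j ≤ i + 2 * k)
               (j≢i : ¬ j ≡ i) (j≢1+i : ¬ j ≡ suc i) (1+j≢i : ¬ suc j ≡ i) where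
        even-step : entry₁ k i j ≡ 1ℤ → Step (β i j) (entry₁ k i j) (β i (suc j))
        even-step e = step-eq
          (trans (β-band i j i<n ((lin 4 λ i j σ k → i ⊕ j ≈ 2 ⊛ σ ⇒ k ≼ σ ⇒ ⊢ 2 ⊛ k ≼ i ⊕ j) i j σ k s k≤σ) i≤
                   ((lin 4 λ i j σ k → i ⊕ j ≈ 2 ⊛ σ ⇒ σ ≺ 3 ⊛ k ⇒ ⊢ 1+ (i ⊕ j) ≼ 6 ⊛ k) i j σ k s σ<3k)
                     (m≤n⇒m≤1+n j≤) j≢i j≢1+i)
                 (odd-even σ s))
          e
          (trans (β-band i (suc j) i<n ((lin 4 λ i j σ k → i ⊕ j ≈ 2 ⊛ σ ⇒ k ≼ σ ⇒ ⊢ 2 ⊛ k ≼ i ⊕ 1+ j) i j σ k s k≤σ)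
            (m≤n⇒m≤1+n i≤)
                   ((lin 4 λ i j σ k → i ⊕ j ≈ 2 ⊛ σ ⇒ σ ≺ 3 ⊛ k ⇒ ⊢ 1+ (i ⊕ 1+ j) ≼ 6 ⊛ k) i j σ k s σ<3k) (s≤s j≤) 1+j≢i
                     (j≢i ∘ suc-injective))
                 (odd-odd σ (trans (+-suc i j) (cong suc s))))
          up
      module _ (τ : ℕ) (s : suc (i + j) ≡ 2 * τ) (k<τ : k < τ) (τ<3k : τ < 3 * k) (i≤ : i ≤ j + 2 * k) (j≤ : j ≤ i + 2 * k)
               (j≢i : ¬ j ≡ i) where
        before : ¬ j ≡ suc i → β i j ≡ 1
        before j≢1+i = trans (β-band i j i<n ((lin 4 λ i j τ k → 1+ (i ⊕ j) ≈ 2 ⊛ τ ⇒ k ≺ τ ⇒ ⊢ 2 ⊛ k ≼ i ⊕ j) i j τ k s k<τ) i≤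
                   ((lin 4 λ i j τ k → 1+ (i ⊕ j) ≈ 2 ⊛ τ ⇒ τ ≺ 3 ⊛ k ⇒ ⊢ 1+ (i ⊕ j) ≼ 6 ⊛ k) i j τ k s τ<3k)
                     (m≤n⇒m≤1+n j≤) j≢i j≢1+i)
                 (odd-odd (τ ∸ 1) ((lin 4 λ i j τ u → 1+ (i ⊕ j) ≈ 2 ⊛ τ ⇒ 1+ u ≈ τ ⇒ ⊢ i ⊕ j ≈ 1+ (2 ⊛ u)) i j τ
                   (τ ∸ 1) s (m+[n∸m]≡n {1} (≤-trans (s≤s z≤n) k<τ))))
        after : ¬ suc j ≡ i → β i (suc j) ≡ 0
        after 1+j≢i = trans (β-band i (suc j) i<n
            ((lin 4 λ i j τ k → 1+ (i ⊕ j) ≈ 2 ⊛ τ ⇒ k ≺ τ ⇒ ⊢ 2 ⊛ k ≼ i ⊕ 1+ j) i j τ k s k<τ) (m≤n⇒m≤1+n i≤)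
                   ((lin 4 λ i j τ k → 1+ (i ⊕ j) ≈ 2 ⊛ τ ⇒ τ ≺ 3 ⊛ k ⇒ ⊢ 1+ (i ⊕ 1+ j) ≼ 6 ⊛ k) i j τ k s τ<3k)
                     (s≤s j≤) 1+j≢i (j≢i ∘ suc-injective))
                 (odd-even τ (trans (+-suc i j) s))

  -- Below the diagonal the entry is read off the pattern by symmetry. The row prefix has no such
  -- symmetry, hence the separate treatment of both sides.
  transition : ∀ i j → i < 4 * k → j < 4 * k → Step (β i j) (entry₁ k i j) (β i (suc j))
  transition i j i<n j<n with <-cmp i j
  ... | tri≈ _ refl _ with ≤-<-connex k i | <-≤-connex i (3 * k)
  ...   | inj₂ i<k | _          = lows (entry₁-diag k i) (inj₁ ((lin 2 λ i k → i ≺ k ⇒ ⊢ i ⊕ 1+ i ≼ 2 ⊛ k) i k i<k))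
  ...   | inj₁ _   | inj₂ 3k≤i  = highs i<n (entry₁-diag k i) (inj₁ ((lin 2 λ i k → 3 ⊛ k ≼ i ⇒ ⊢ 6 ⊛ k ≼ 1+ (i ⊕ i)) i k 3k≤i))
  ...   | inj₁ k≤i | inj₁ i<3k  = step-eq (β-diag i k≤i i<3k) (entry₁-diag k i) (β-diag-suc i k≤i i<3k) hold
  transition i j i<n j<n | tri< i<j _ _ with offset i<j
  ... | evenOffset σ x 1≤x e e′ with evenRegion 0 k (4 * k) σ x
  ...   | outside h = highs i<n (P.even-out 1≤x e e′ j<n (inj₁ h)) (inj₂
            ((lin 5 λ i j σ x k → on-even i j σ x $ k ≺ x ⊕ # 0 ⇒ ⊢ 1+ (i ⊕ 2 ⊛ k) ≼ j) i j σ x k e e′ h))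
  ...   | left h = lows (P.even-out 1≤x e e′ j<n (inj₂ (inj₁ h))) (inj₁
            ((lin 5 λ i j σ x k → on-even i j σ x $ σ ≺ k ⇒ ⊢ i ⊕ 1+ j ≼ 2 ⊛ k) i j σ x k e e′ h))
  ...   | right h = highs i<n (P.even-out 1≤x e e′ j<n (inj₂ (inj₂ h))) (inj₁
            ((lin 5 λ i j σ x k → on-even i j σ x $ 4 ⊛ k ≼ σ ⊕ k ⇒ ⊢ 6 ⊛ k ≼ 1+ (i ⊕ j)) i j σ x k e e′ h))
  ...   | inside band@(evenBand x≤ σ≥ σ≤) = Band.even-step i j i<n σ
            ((lin 4 λ i j σ x → on-even i j σ x $ ⊢ i ⊕ j ≈ 2 ⊛ σ) i j σ x e e′) σ≥
            ((lin 2 λ σ k → σ ⊕ k ≺ 4 ⊛ k ⇒ ⊢ σ ≺ 3 ⊛ k) σ k σ≤)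
            (≤-trans (<⇒≤ i<j) (m≤m+n j _))
            ((lin 5 λ i j σ x k → on-even i j σ x $ x ⊕ # 0 ≼ k ⇒ ⊢ j ≼ i ⊕ 2 ⊛ k) i j σ x k e e′ x≤)
            (λ { refl → <-irrefl refl i<j }) (even-miss 1≤x e e′ ∘ cong suc) (λ { refl → <⇒≱ i<j (n≤1+n j) })
            (P.even-in 1≤x e e′ j<n band)
  transition i j i<n j<n | tri< i<j _ _ | oddOffset τ x 1≤x e e′ with oddRegion 0 k (4 * k) τ x
  ...   | outside h = highs i<n (P.odd-out 1≤x e e′ j<n (inj₁ h)) (inj₂
            ((lin 5 λ i j τ x k → on-odd i j τ x $ k ≺ x ⇒ ⊢ 1+ (i ⊕ 2 ⊛ k) ≼ j) i j τ x k e e′ h))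
  ...   | left h = lows (P.odd-out 1≤x e e′ j<n (inj₂ (inj₁ h))) (inj₁
            ((lin 5 λ i j τ x k → on-odd i j τ x $ τ ⊕ # 0 ≼ k ⇒ ⊢ i ⊕ 1+ j ≼ 2 ⊛ k) i j τ x k e e′ h))
  ...   | right h = highs i<n (P.odd-out 1≤x e e′ j<n (inj₂ (inj₂ h))) (inj₁
            ((lin 5 λ i j τ x k → on-odd i j τ x $ 4 ⊛ k ⊕ # 0 ≼ τ ⊕ k ⇒ ⊢ 6 ⊛ k ≼ 1+ (i ⊕ j)) i j τ x k e e′ h))
  ...   | inside band@(oddBand x≤ τ≥ τ≤) = right-of x refl
    where
    sum≡ : suc (i + j) ≡ 2 * τ
    sum≡ = (lin 4 λ i j τ x → on-odd i j τ x $ ⊢ 1+ (i ⊕ j) ≈ 2 ⊛ τ) i j τ x e e′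
    k<τ : k < τ
    k<τ = subst (k <_) (+-identityʳ τ) τ≥
    τ<3k : τ < 3 * k
    τ<3k = (lin 2 λ τ k → τ ⊕ k ≺ 4 ⊛ k ⊕ # 0 ⇒ ⊢ τ ≺ 3 ⊛ k) τ k τ≤
    j≤ : j ≤ i + 2 * k
    j≤ = (lin 5 λ i j τ x k → on-odd i j τ x $ x ≼ k ⇒ ⊢ j ≼ i ⊕ 2 ⊛ k) i j τ x k e e′ x≤
    j≢i : ¬ j ≡ i
    j≢i refl = <-irrefl refl i<j
    after : β i (suc j) ≡ 0
    after = Band.after i j i<n τ sum≡ k<τ τ<3k (≤-trans (<⇒≤ i<j) (m≤m+n j _)) j≤ j≢i (λ { refl → <⇒≱ i<j (n≤1+n j) })
    right-of : ∀ x′ → x′ ≡ x → Step (β i j) (entry₁ k i j) (β i (suc j))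
    right-of zero refl = ⊥-elim (1≰0 1≤x)
    right-of (suc (suc y)) refl = step-eq
      (Band.before i j i<n τ sum≡ k<τ τ<3k (≤-trans (<⇒≤ i<j) (m≤m+n j _)) j≤ j≢i
        (λ j≡ → 1≰0 ((lin 4 λ i j τ y → on-odd i j τ (# 2 ⊕ y) $ j ≈ 1+ i ⇒ ⊢ # 1 ≼ # 0) i j τ y e e′ j≡)))
      (P.odd-in 1≤x e e′ j<n band (λ ())) after down
    -- Just right of the diagonal it is the incoming state that depends on the hole: 1 before an
    -- entry -1, 0 before a hole.
    right-of 1 refl with odd (τ + k) in o | odd≤1 (τ + k) | odd-pred {i} e
    ... | 0 | _ | opp = step-eq (trans start (trans (sym (+-identityʳ _)) opp))
        (P.odd-in 1≤x e e′ j<n band (λ _ → o)) after down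
      where
      start : β i j ≡ odd (i + k)
      start = trans (cong (β i) ((lin 3 λ i j τ → on-odd i j τ (# 1) $ ⊢ j ≈ 1+ i) i j τ e e′))
        (β-diag-suc i ((lin 3 λ i τ k → i ⊕ # 1 ≈ τ ⇒ k ≺ τ ⇒ ⊢ k ≼ i) i τ k e k<τ)
          ((lin 3 λ i τ k → i ⊕ # 1 ≈ τ ⇒ τ ≺ 3 ⊛ k ⇒ ⊢ i ≺ 3 ⊛ k) i τ k e τ<3k))
    ... | 1 | _ | opp = step-eq (trans start ((lin 1 λ a → a ⊕ # 1 ≈ # 1 ⇒ ⊢ a ≈ # 0) _ opp))
        (P.odd-hole e e′ j<n band o) after hold
      where
      start : β i j ≡ odd (i + k)
      start = trans (cong (β i) ((lin 3 λ i j τ → on-odd i j τ (# 1) $ ⊢ j ≈ 1+ i) i j τ e e′))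
        (β-diag-suc i ((lin 3 λ i τ k → i ⊕ # 1 ≈ τ ⇒ k ≺ τ ⇒ ⊢ k ≼ i) i τ k e k<τ)
          ((lin 3 λ i τ k → i ⊕ # 1 ≈ τ ⇒ τ ≺ 3 ⊛ k ⇒ ⊢ i ≺ 3 ⊛ k) i τ k e τ<3k))
    ... | suc (suc _) | s≤s () | _
  transition i j i<n j<n | tri> _ _ j<i with offset j<i
  ... | evenOffset σ x 1≤x e e′ with evenRegion 0 k (4 * k) σ x
  ...   | outside h = lows (trans (entry₁-sym k i j) (P.even-out 1≤x e e′ i<n (inj₁ h))) (inj₂
            ((lin 5 λ i j σ x k → on-even j i σ x $ k ≺ x ⊕ # 0 ⇒ ⊢ 1+ j ⊕ 2 ⊛ k ≼ i) i j σ x k e e′ h))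
  ...   | left h = lows (trans (entry₁-sym k i j) (P.even-out 1≤x e e′ i<n (inj₂ (inj₁ h)))) (inj₁
            ((lin 5 λ i j σ x k → on-even j i σ x $ σ ≺ k ⇒ ⊢ i ⊕ 1+ j ≼ 2 ⊛ k) i j σ x k e e′ h))
  ...   | right h = highs i<n (trans (entry₁-sym k i j) (P.even-out 1≤x e e′ i<n (inj₂ (inj₂ h)))) (inj₁
            ((lin 5 λ i j σ x k → on-even j i σ x $ 4 ⊛ k ≼ σ ⊕ k ⇒ ⊢ 6 ⊛ k ≼ 1+ (i ⊕ j)) i j σ x k e e′ h))
  ...   | inside band@(evenBand x≤ σ≥ σ≤) = Band.even-step i j i<n σ
            ((lin 4 λ i j σ x → on-even j i σ x $ ⊢ i ⊕ j ≈ 2 ⊛ σ) i j σ x e e′) σ≥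
            ((lin 2 λ σ k → σ ⊕ k ≺ 4 ⊛ k ⇒ ⊢ σ ≺ 3 ⊛ k) σ k σ≤)
            ((lin 5 λ i j σ x k → on-even j i σ x $ x ⊕ # 0 ≼ k ⇒ ⊢ i ≼ j ⊕ 2 ⊛ k) i j σ x k e e′ x≤)
            (≤-trans (<⇒≤ j<i) (m≤m+n i _))
            (λ { refl → <-irrefl refl j<i }) (λ { refl → <⇒≱ j<i (n≤1+n i) }) (λ i≡ → even-miss 1≤x e e′ (cong suc (sym i≡)))
            (trans (entry₁-sym k i j) (P.even-in 1≤x e e′ i<n band))
  transition i j i<n j<n | tri> _ _ j<i | oddOffset τ x 1≤x e e′ with oddRegion 0 k (4 * k) τ x
  ...   | outside h = lows (trans (entry₁-sym k i j) (P.odd-out 1≤x e e′ i<n (inj₁ h))) (inj₂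
            ((lin 5 λ i j τ x k → on-odd j i τ x $ k ≺ x ⇒ ⊢ 1+ j ⊕ 2 ⊛ k ≼ i) i j τ x k e e′ h))
  ...   | left h = lows (trans (entry₁-sym k i j) (P.odd-out 1≤x e e′ i<n (inj₂ (inj₁ h)))) (inj₁
            ((lin 5 λ i j τ x k → on-odd j i τ x $ τ ⊕ # 0 ≼ k ⇒ ⊢ i ⊕ 1+ j ≼ 2 ⊛ k) i j τ x k e e′ h))
  ...   | right h = highs i<n (trans (entry₁-sym k i j) (P.odd-out 1≤x e e′ i<n (inj₂ (inj₂ h)))) (inj₁
            ((lin 5 λ i j τ x k → on-odd j i τ x $ 4 ⊛ k ⊕ # 0 ≼ τ ⊕ k ⇒ ⊢ 6 ⊛ k ≼ 1+ (i ⊕ j)) i j τ x k e e′ h))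
  ...   | inside band@(oddBand x≤ τ≥ τ≤) = left-of x refl
    where
    sum≡ : suc (i + j) ≡ 2 * τ
    sum≡ = (lin 4 λ i j τ x → on-odd j i τ x $ ⊢ 1+ (i ⊕ j) ≈ 2 ⊛ τ) i j τ x e e′
    k<τ : k < τ
    k<τ = subst (k <_) (+-identityʳ τ) τ≥
    τ<3k : τ < 3 * k
    τ<3k = (lin 2 λ τ k → τ ⊕ k ≺ 4 ⊛ k ⊕ # 0 ⇒ ⊢ τ ≺ 3 ⊛ k) τ k τ≤
    i≤ : i ≤ j + 2 * k
    i≤ = (lin 5 λ i j τ x k → on-odd j i τ x $ x ≼ k ⇒ ⊢ i ≼ j ⊕ 2 ⊛ k) i j τ x k e e′ x≤
    j≢i : ¬ j ≡ i
    j≢i refl = <-irrefl refl j<i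
    before : β i j ≡ 1
    before = Band.before i j i<n τ sum≡ k<τ τ<3k i≤ (≤-trans (<⇒≤ j<i) (m≤m+n i _)) j≢i (λ { refl → <⇒≱ j<i (n≤1+n i) })
    left-of : ∀ x′ → x′ ≡ x → Step (β i j) (entry₁ k i j) (β i (suc j))
    left-of zero refl = ⊥-elim (1≰0 1≤x)
    left-of (suc (suc y)) refl = step-eq before (trans (entry₁-sym k i j) (P.odd-in 1≤x e e′ i<n band (λ ())))
      (Band.after i j i<n τ sum≡ k<τ τ<3k i≤ (≤-trans (<⇒≤ j<i) (m≤m+n i _)) j≢i
        (λ i≡ → 1≰0 ((lin 4 λ i j τ y → on-odd j i τ (# 2 ⊕ y) $ 1+ j ≈ i ⇒ ⊢ # 1 ≼ # 0) i j τ y e e′ i≡))) down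
    -- Just left of the diagonal the incoming state is always 1, and a hole shows in the outgoing
    -- state `β i i`.
    left-of 1 refl with odd (τ + k) in o | odd≤1 (τ + k)
    ... | 0 | _ = step-eq before (trans (entry₁-sym k i j) (P.odd-in 1≤x e e′ i<n band (λ _ → o))) (trans end o) down
      where
      end : β i (suc j) ≡ odd (τ + k)
      end = subst₂ (λ u v → β u v ≡ odd (τ + k)) (suc-injective (trans (+-comm 1 τ) e′)) (trans (sym e) (+-comm j 1))
          (β-diag τ (<⇒≤ k<τ) τ<3k)
    ... | 1 | _ = step-eq before (trans (entry₁-sym k i j) (P.odd-hole e e′ i<n band o)) (trans end o) hold
      where
      end : β i (suc j) ≡ odd (τ + k)
      end = subst₂ (λ u v → β u v ≡ odd (τ + k)) (suc-injective (trans (+-comm 1 τ) e′)) (trans (sym e) (+-comm j 1))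
          (β-diag τ (<⇒≤ k<τ) τ<3k)
    ... | suc (suc _) | s≤s ()

  β-start : ∀ i → β i 0 ≡ 0
  β-start i with ≤-total i (2 * k)
  ... | inj₁ h = β-low i 0 (inj₁ (subst (_≤ 2 * k) (sym (+-identityʳ i)) h))
  ... | inj₂ h = β-low i 0 (inj₂ h)

  β-end : ∀ i → i < 4 * k → β i (4 * k) ≡ 1
  β-end i i<n with ≤-<-connex (2 * k) i
  ... | inj₁ h = β-high i (4 * k) i<n (inj₁ ((lin 2 λ i k → 2 ⊛ k ≼ i ⇒ ⊢ 6 ⊛ k ≼ 1+ (i ⊕ 4 ⊛ k)) i k h))
  ... | inj₂ h = β-high i (4 * k) i<n (inj₂ ((lin 2 λ i k → i ≺ 2 ⊛ k ⇒ ⊢ 1+ (i ⊕ 2 ⊛ k) ≼ 4 ⊛ k) i k h))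

  rows : ∀ i → AltPlus (nonzeros (row (hollowedDiamond₁ k) i))
  rows i = subst (λ s → AltFrom s (nonzeros (row (hollowedDiamond₁ k) i))) (β-start (toℕ i))
    (steps-alternate (4 * k) (entry₁ k (toℕ i)) (β (toℕ i)) (β-end (toℕ i) (toℕ<n i)) (λ j → transition (toℕ i) j (toℕ<n i)))

  symmetric : Symmetric (hollowedDiamond₁ k)
  symmetric i j = entry₁-sym k (toℕ i) (toℕ j)

  asm : IsASM (hollowedDiamond₁ k)
  asm = record
    { entries = λ i j → sign-of (transition (toℕ i) (toℕ j) (toℕ<n i) (toℕ<n j))
    ; rows    = rows
    ; cols    = λ j → subst (AltPlus ∘ nonzeros) (tabulate-cong (λ i → symmetric j i)) (rows j)
    }
    where
    sign-of : ∀ {s x t} → Step s x t → IsSign x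
    sign-of hold = inj₁ refl
    sign-of up   = inj₂ (inj₁ refl)
    sign-of down = inj₂ (inj₂ refl)

-- The maximum and the extremal matrices

maxEntries : ℕ → ℕ
maxEntries k = ((4 * k) * (4 * k) ∸ 2 * (4 * k)) / 2

-- An additive form without division, in which the maximum can be compared with the counts.
maxEntries-spec : ∀ k → 1 ≤ k → maxEntries k + 4 * k ≡ 8 * (k * k)
maxEntries-spec k@(suc _) _ = trans (cong (_+ 4 * k) half) (m∸n+n≡m 4k≤8k²)
  where
  doubled : (4 * k) * (4 * k) ∸ 2 * (4 * k) ≡ (8 * (k * k) ∸ 4 * k) * 2
  doubled = trans (cong₂ _∸_ (square k) (*-comm 2 (4 * k))) (sym (*-distribʳ-∸ 2 (8 * (k * k)) (4 * k)))
    where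
    square : ∀ k → (4 * k) * (4 * k) ≡ 8 * (k * k) * 2
    square = solve-∀
  half : maxEntries k ≡ 8 * (k * k) ∸ 4 * k
  half = trans (cong (_/ 2) doubled) (m*n/n≡m (8 * (k * k) ∸ 4 * k) 2)
  4k≤8k² : 4 * k ≤ 8 * (k * k)
  4k≤8k² = (lin 2 λ k s → k ≼ s ⇒ ⊢ 4 ⊛ k ≼ 8 ⊛ s) k (k * k) (m≤m*n k k)

module _ (k : ℕ) (1≤k : 1 ≤ k) (A : Matrix (4 * k)) (asm : IsASM A) (symm : Symmetric A) (zdiag : ZeroDiagonal A) where

  open Corner A asm symm zdiag using (a; a-toℕ)

  bound : nnz A ≤ maxEntries k
  bound = +-cancelʳ-≤ (4 * k) _ _
      (≤-trans (TightMatrix.nnz-bound k 1≤k A asm symm zdiag) (≤-reflexive (sym (maxEntries-spec k 1≤k))))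

  agree : ∀ {δ p} {g : ℕ → ℕ → ℤ} → Pattern δ p (4 * k) a → Pattern δ p (4 * k) g →
          (∀ {i j} → i < 4 * k → j < 4 * k → g i j ≡ g j i) → (∀ i → i < 4 * k → g i i ≡ 0ℤ) →
          ∀ i j → A i j ≡ g (toℕ i) (toℕ j)
  agree P Q g-sym g-diag i j with <-cmp (toℕ i) (toℕ j)
  ... | tri< i<j _ _ = trans (sym (a-toℕ i j)) (pattern-unique P Q i<j (toℕ<n j))
  ... | tri> _ _ j<i = trans (symm i j)
      (trans (sym (a-toℕ j i)) (trans (pattern-unique P Q j<i (toℕ<n i)) (g-sym (toℕ<n j) (toℕ<n i))))
  ... | tri≈ _ i≡j _ with toℕ-injective i≡j
  ...   | refl = trans (zdiag i) (sym (g-diag (toℕ i) (toℕ<n i)))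

  extremal : nnz A ≡ maxEntries k →
             (A ≗M hollowedDiamond₁ k) ⊎ ((A ≗M hollowedDiamond₂ k) ⊎ (A ≗M hollowedNearDiamond k))
  extremal e = Sum.map (λ P → agree P (pattern₁ k) (λ {i} {j} _ _ → entry₁-sym k i j) (λ i _ → entry₁-diag k i))
    (Sum.map (λ P i j → trans (agree P (pattern₂ k) (entry₂-sym k) (entry₂-diag k) i j) (sym (matrix₂ k i j)))
             (λ P → agree P (pattern₃ k 1≤k) (λ {i} {j} _ _ → entry₃-sym k i j) (λ i _ → entry₃-diag k i 1≤k)))
    (TightMatrix.tight-pattern k 1≤k A asm symm zdiag
      (≤-reflexive (trans (sym (maxEntries-spec k 1≤k)) (cong (_+ 4 * k) (sym e)))))

  -- Only a lower count is asked for, because `bound` supplies the other inequality.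
  attained : ∀ {g} → (∀ i j → A i j ≡ g (toℕ i) (toℕ j)) →
             8 * (k * k) ≤ ∑ (4 * k) (λ i → ∑ (4 * k) (λ j → nz (g i j))) + 4 * k → nnz A ≡ maxEntries k
  attained {g} A≡g count = ≤-antisym bound (+-cancelʳ-≤ (4 * k) _ _
    (≤-trans (≤-reflexive (maxEntries-spec k 1≤k)) (≤-trans count (≤-reflexive (cong (_+ 4 * k) (sym (nnz-∑ A g A≡g)))))))

extremal-attained : ∀ k → 1 ≤ k → (A : Matrix (4 * k)) → IsASM A → Symmetric A → ZeroDiagonal A →
  (A ≗M hollowedDiamond₁ k) ⊎ ((A ≗M hollowedDiamond₂ k) ⊎ (A ≗M hollowedNearDiamond k)) → nnz A ≡ maxEntries k
extremal-attained k@(suc k₀) 1≤k A asm symm zdiag (inj₁ e) =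
  attained k 1≤k A asm symm zdiag {entry₁ k} e (count-δ0 k₀ (pattern₁ k) (λ {i} {j} _ _ → entry₁-sym k i j))
extremal-attained k@(suc k₀) 1≤k A asm symm zdiag (inj₂ (inj₁ e)) =
  attained k 1≤k A asm symm zdiag {entry₂ k} (λ i j → trans (e i j) (matrix₂ k i j)) (count-δ1 k₀ (pattern₂ k) (entry₂-sym k))
extremal-attained k@(suc k₀) 1≤k A asm symm zdiag (inj₂ (inj₂ e)) =
  attained k 1≤k A asm symm zdiag {entry₃ k} e (count-near k₀ (pattern₃ k 1≤k) (λ {i} {j} _ _ → entry₃-sym k i j))

theorem5p1 : (k : ℕ) → 1 ≤ k →
    ((∀ (A : Matrix (4 * k)) → IsASM A → Symmetric A → ZeroDiagonal A →
    nnz A ≤ ((4 * k) * (4 * k) ∸ 2 * (4 * k)) / 2)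
    × Σ (Matrix (4 * k)) (λ A → IsASM A × Symmetric A × ZeroDiagonal A
    × nnz A ≡ ((4 * k) * (4 * k) ∸ 2 * (4 * k)) / 2))
    × (∀ (A : Matrix (4 * k)) → IsASM A → Symmetric A → ZeroDiagonal A →
    (nnz A ≡ ((4 * k) * (4 * k) ∸ 2 * (4 * k)) / 2)
    ⇔ ((A ≗M hollowedDiamond₁ k) ⊎ ((A ≗M hollowedDiamond₂ k) ⊎ (A ≗M hollowedNearDiamond k))))
theorem5p1 k 1≤k =
  (bound k 1≤k , hollowedDiamond₁ k , asm , symmetric , diagonal ,
    extremal-attained k 1≤k (hollowedDiamond₁ k) asm symmetric diagonal (inj₁ (λ _ _ → refl))) ,
  λ A asmA symA zdA → mk⇔ (extremal k 1≤k A asmA symA zdA) (extremal-attained k 1≤k A asmA symA zdA)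
  where
  asm = Prefix.asm k 1≤k
  symmetric = Prefix.symmetric k 1≤k
  diagonal : ZeroDiagonal (hollowedDiamond₁ k)
  diagonal i = entry₁-diag k (toℕ i)
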